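{- Let $Q:=q^7$. Then $$\frac{(1,0,14)-(3,2,5)}{(2,0,7)+(3,2,5)}=q\frac{E^2(Q^4)E^2(q^2)}{E^2(Q^2)E^2(q^4)}.$$
   Context: $|q|<1$, $E(q)=(q;q)_\infty=\prod_{k\ge1}(1-q^k)$, and $E^2(x)$ means $E(x)^2$. For integers $a,b,c$ with $a,c>0$, $b^2-4ac<0$, $(a,b,c)$ denotes $\sum_{n,m=-\infty}^{\infty}q^{an^2+bnm+cm^2}$. -}

module Defs where

open import Data.Nat as ℕ using (ℕ; zero; suc)
open import Data.Integer as ℤ using (ℤ; +_)
open import Data.Rational using (ℚ; 0ℚ; 1ℚ; _+_; _*_; -_; _-_; 1/_; ≢-nonZero)
open import Data.Rational.Properties using (_≟_)
open import Data.List using (List; []; _∷_; upTo; map; filter; length; concatMap)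
open import Data.Product using (_×_; _,_)
open import Relation.Nullary using (yes; no)
open import Relation.Binary.PropositionalEquality using (_≡_)

-- Formal power series in q with rational coefficients:
-- a series is its coefficient sequence  n ↦ [q^n] f.

Series : Set
Series = ℕ → ℚ

sumTo : ℕ → (ℕ → ℚ) → ℚ
sumTo zero    h = h zero
sumTo (suc n) h = sumTo n h + h (suc n)

_⊕_ : Series → Series → Series
(f ⊕ g) n = f n + g n

_⊖_ : Series → Series → Series
(f ⊖ g) n = f n - g n

_⊗_ : Series → Series → Series
(f ⊗ g) n = sumTo n (λ k → f k * g (n ℕ.∸ k))

infixl 6 _⊕_ _⊖_
infixl 7 _⊗_ _⊘_

one : Series
one zero    = 1ℚ
one (suc _) = 0ℚ

qtimes : Series → Series
qtimes f zero    = 0ℚ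
qtimes f (suc n) = f n

-- Multiplicative inverse of a power series with nonzero constant term:
-- g 0 = 1/f 0,  g n = -(1/f 0) * sum_{k=1}^{n} f k * g (n-k).
-- (If f 0 = 0 the series is not invertible; we then return 0 as a junk value,
-- which never occurs in the statement.)
module _ (f : Series) (c : ℚ) where
  dot : ℕ → List ℚ → ℚ
  dot k []       = 0ℚ
  dot k (x ∷ xs) = f k * x + dot (suc k) xs

  -- pre n = [g n, g (n-1), …, g 0]
  pre : ℕ → List ℚ
  pre zero    = c ∷ []
  pre (suc n) = (- (c * dot 1 (pre n))) ∷ pre n

headℚ : List ℚ → ℚ
headℚ []      = 0ℚ
headℚ (x ∷ _) = x

inv : Series → Series
inv f with f 0 ≟ 0ℚ
... | yes _  = λ _ → 0ℚ
... | no f0≢0 = λ n → headℚ (pre f (1/_ (f 0) {{≢-nonZero f0≢0}}) n)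

_⊘_ : Series → Series → Series
f ⊘ g = f ⊗ inv g

-- Binary quadratic theta series
--   (a,b,c) = sum_{n,m ∈ ℤ} q^{a n² + b n m + c m²}   (a, c > 0, b² - 4ac < 0).
-- The coefficient of q^N is the (finite) number of pairs (n,m) ∈ ℤ² with
-- a n² + b n m + c m² = N.  For a positive definite form,
--   4aN = (2an+bm)² + (4ac-b²) m²  gives |m| ≤ m² ≤ 4aN, and likewise |n| ≤ 4cN,
-- so all such pairs lie in the box [-K,K]² with K = 4(a+c)N; we count there.

intRange : ℕ → List ℤ
intRange K = map (λ i → + i ℤ.- + K) (upTo (suc (K ℕ.+ K)))

qform : ℕ → ℤ → ℕ → ℤ × ℤ → ℤ
qform a b c (n , m) = + a ℤ.* (n ℤ.* n) ℤ.+ b ℤ.* (n ℤ.* m) ℤ.+ + c ℤ.* (m ℤ.* m)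

reps : ℕ → ℤ → ℕ → ℕ → ℕ
reps a b c N =
  length (filter (λ p → qform a b c p ℤ.≟ + N)
                 (concatMap (λ n → map (λ m → (n , m)) (intRange K)) (intRange K)))
  where K = 4 ℕ.* (a ℕ.+ c) ℕ.* N

theta : ℕ → ℤ → ℕ → Series
theta a b c N = + (reps a b c N) Data.Rational./ 1

-- E(q^s) = prod_{k ≥ 1} (1 - q^{s k}).

-- the polynomial 1 - q^j  (j ≥ 1)
oneMinusPow : ℕ → Series
oneMinusPow j n with n ℕ.≟ 0
... | yes _ = 1ℚ
... | no _ with n ℕ.≟ j
...   | yes _ = - 1ℚ
...   | no _  = 0ℚ

partialE : ℕ → ℕ → Series
partialE s zero    = one
partialE s (suc M) = partialE s M ⊗ oneMinusPow (s ℕ.* suc M)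

-- For s ≥ 1, factors with k > N do not affect the coefficient of q^N.
E : ℕ → Series
E s N = partialE s N N

E² : ℕ → Series
E² s = E s ⊗ E s

_≈_ : Series → Series → Set
f ≈ g = ∀ n → f n ≡ g n
infix 4 _≈_

{-# OPTIONS --safe #-}

-- Write Q = q⁷, a = (1,0,14) = φ(q)φ(Q²), b = (2,0,7) = φ(q²)φ(Q), T = (3,2,5), and let ρ be the right-hand side.
--
-- * Counting lattice points by residue classes (in ℤ[(1+√-7)/2], and in T ⊥ T, which has an orthogonal frame of
--   norms 8, 8, 56, 56) gives φ(q)φ(Q) = φ(q²)φ(Q²) + 2qψ(q)ψ(Q) - 4q²ψ(q²)ψ(Q²) + 4q⁴ψ(q⁴)ψ(Q⁴) and T² = ab - Z
--   with Z = 2qψ(q)ψ(Q)(φ(q²)φ(Q²) - 2q²ψ(q²)ψ(Q²)).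
-- * With the classical relations ψ(q)² = φ(q)ψ(q²) and φ(q)² = φ(q²)² + 4qψ(q⁴)², all quotients involved become
--   algebraic over t = q²ψ(q²)ψ(Q²)/φ(q²)φ(Q²) and δ with δ² = t(1 - 3t + 4t²).  In that field (TZ)² = (ab(a-b))²,
--   hence TZ = ab(a-b), hence (a-T)²(Z+ab-b²) = (b+T)²(Z+ab-a²); moreover (Z+ab-a²)³ = ρ⁶(Z+ab-b²)³, where ρ⁶ is
--   expressed through φ and ψ by Gauss's products for φ(-q) and ψ(q).
-- * Cube roots in ℚ[[q]] are unique and square roots are unique up to sign, so a - T = ρ(b + T).
module Submission where

open import Data.Integer using (+_)
open import Algebra.Bundles using (CommutativeRing)
open import Algebra.Solver.Ring.AlmostCommutativeRing using (fromCommutativeRing; _-Raw-AlmostCommutative⟶_)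
import Algebra.Solver.Ring as RingSolver
import Algebra.Properties.Ring as RingProperties
import Algebra.Properties.AbelianGroup as AbelianGroupProperties
import Algebra.Properties.Semiring.Mult.TCOptimised as SemiringMult
open import Data.Empty using (⊥; ⊥-elim)
open import Data.Integer as ℤ using (ℤ; -[1+_])
import Data.Integer.DivMod as ℤD
import Data.Integer.Properties as ℤP
open import Data.Integer.Solver using (module +-*-Solver)
open import Data.List using (List; []; _∷_; _++_; map; filter; length; concatMap; cartesianProduct; upTo)
import Data.List.Properties as ListP
open import Data.List.Membership.Propositional using (_∈_; _∉_)
import Data.List.Membership.Propositional.Properties as ∈P
open import Data.List.Membership.Propositional.Properties.WithK using (unique∧set⇒bag)
open import Data.List.Relation.Binary.BagAndSetEquality using (∼bag⇒↭)
open import Data.List.Relation.Binary.Permutation.Propositional.Properties using (↭-length)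
open import Data.List.Relation.Unary.All as All using ([]; _∷_)
open import Data.List.Relation.Unary.AllPairs using ([]; _∷_)
open import Data.List.Relation.Unary.Any using (here; there)
open import Data.List.Relation.Unary.Unique.Propositional using (Unique)
import Data.List.Relation.Unary.Unique.Propositional.Properties as UniqueP
open import Data.Maybe using (Maybe; just; nothing)
open import Data.Nat as ℕ using (ℕ; zero; suc; z≤n; s≤s)
open import Data.Nat.Induction using (<-rec)
import Data.Nat.Properties as ℕP
import Data.Nat.Solver
open import Data.Product using (_,_; _×_; ∃; proj₁; proj₂)
open import Data.Rational as ℚ using (ℚ; 0ℚ; 1ℚ)
import Data.Rational.Properties as ℚP
import Data.Rational.Unnormalised as ℚᵘ
import Data.Rational.Unnormalised.Properties as ℚᵘP
open import Data.Sum using (_⊎_; inj₁; inj₂; [_,_]′; swap)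
open import Data.Sum.Properties using (inj₁-injective; inj₂-injective; swap-involutive)
open import Data.Unit using (⊤; tt)
open import Function using (_∘_)
open import Function.Bundles using (mk⇔)
import Relation.Binary.PropositionalEquality as ≡
import Relation.Binary.Reasoning.Setoid as SetoidReasoning
open import Relation.Nullary using (¬_; Dec; yes; no)

-- The sixth power of `ρ` is forced by two facts. Gauss's products give E(q²)³ψ(q²) = E(q⁴)³φ(-q²),
-- so only the cube of E(q²)/E(q⁴) is a quotient of theta functions; and it is the fourth powers of
-- ψ(q²) and φ(-q²) that are polynomial in x = φ(q²)² and u = 4qψ(q⁴)², namely 4qψ(q²)⁴ = xu and
-- φ(-q²)⁴ = x² - u². The equation between t and δ defines a curve of genus 1, so no single
-- parameter expresses everything rationally; identities are instead checked modulo the equation for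
-- δ². The quotients h = uX/w² and H = xU/w², with X and U the analogues of x and u for Q, enter
-- through h + H and hH, which are polynomials in t and δ; moreover a² = (1 + h)w² and b² = (1 +
-- H)w². The form (3,2,5) is not diagonal like the other two, so T is reached through T², and its
-- sign is recovered at the level of TZ by comparing lowest coefficients. Apart from the inverse of
-- w, denominators are cleared and common factors cancelled in the integral domain ℚ[[q]].

-- A ring solver with integer coefficients over an arbitrary commutative ring.

module IntegerCoefficients {c ℓ} (R : CommutativeRing c ℓ) where
  open CommutativeRing R
  open RingProperties ring using (-‿distribˡ-*; -‿distribʳ-*; -‿involutive; -0#≈0#)
  open AbelianGroupProperties +-abelianGroup using (⁻¹-∙-comm)
  open SemiringMult semiring using (1+×; ×-homo-+; ×1-homo-*) renaming (_×_ to _×ᴿ_)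
  open SetoidReasoning setoid

  -- `_×ᴿ_` is the type-checking optimised multiple: `num (+ 0)` and `num (+ 1)` reduce to `0#` and
  -- `1#`, so that `con (+ 1)` in a solver call matches `1#` in the goal by computation.
  num : ℤ → Carrier
  num (+ n)    = n ×ᴿ 1#
  num -[1+ n ] = - (suc n ×ᴿ 1#)

  num-⊖ : ∀ m n → num (m ℤ.⊖ n) ≈ m ×ᴿ 1# + - (n ×ᴿ 1#)
  num-⊖ m zero = begin
    m ×ᴿ 1#          ≈⟨ +-identityʳ _ ⟨
    m ×ᴿ 1# + 0#     ≈⟨ +-congˡ -0#≈0# ⟨
    m ×ᴿ 1# + - 0#   ∎
  num-⊖ zero (suc n) = sym (+-identityˡ _)
  num-⊖ (suc m) (suc n) = begin
    num (suc m ℤ.⊖ suc n)                     ≡⟨ ≡.cong num (ℤP.[1+m]⊖[1+n]≡m⊖n m n) ⟩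
    num (m ℤ.⊖ n)                             ≈⟨ num-⊖ m n ⟩
    m ×ᴿ 1# + - (n ×ᴿ 1#)                       ≈⟨ +-congʳ (+-identityʳ _) ⟨
    m ×ᴿ 1# + 0# + - (n ×ᴿ 1#)                  ≈⟨ +-congʳ (+-congˡ (-‿inverseʳ 1#)) ⟨
    m ×ᴿ 1# + (1# + - 1#) + - (n ×ᴿ 1#)         ≈⟨ +-congʳ (+-assoc _ _ _) ⟨
    m ×ᴿ 1# + 1# + - 1# + - (n ×ᴿ 1#)           ≈⟨ +-congʳ (+-congʳ (+-comm _ _)) ⟩
    1# + m ×ᴿ 1# + - 1# + - (n ×ᴿ 1#)           ≈⟨ +-congʳ (+-congʳ (1+× m 1#)) ⟨
    suc m ×ᴿ 1# + - 1# + - (n ×ᴿ 1#)            ≈⟨ +-assoc _ _ _ ⟩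
    suc m ×ᴿ 1# + (- 1# + - (n ×ᴿ 1#))          ≈⟨ +-congˡ (⁻¹-∙-comm _ _) ⟩
    suc m ×ᴿ 1# + - (1# + n ×ᴿ 1#)              ≈⟨ +-congˡ (-‿cong (1+× n 1#)) ⟨
    suc m ×ᴿ 1# + - (suc n ×ᴿ 1#)               ∎

  num-+ : ∀ i j → num (i ℤ.+ j) ≈ num i + num j
  num-+ (+ m)    (+ n)    = ×-homo-+ 1# m n
  num-+ (+ m)    -[1+ n ] = num-⊖ m (suc n)
  num-+ -[1+ m ] (+ n)    = trans (num-⊖ n (suc m)) (+-comm _ _)
  num-+ -[1+ m ] -[1+ n ] = begin
    - (suc (suc (m ℕ.+ n)) ×ᴿ 1#)           ≡⟨ ≡.cong (λ k → - (suc k ×ᴿ 1#)) (≡.sym (ℕP.+-suc m n)) ⟩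
    - ((suc m ℕ.+ suc n) ×ᴿ 1#)             ≈⟨ -‿cong (×-homo-+ 1# (suc m) (suc n)) ⟩
    - (suc m ×ᴿ 1# + suc n ×ᴿ 1#)            ≈⟨ ⁻¹-∙-comm _ _ ⟨
    - (suc m ×ᴿ 1#) + - (suc n ×ᴿ 1#)        ∎

  num-neg : ∀ i → num (ℤ.- i) ≈ - num i
  num-neg (+ zero)   = sym -0#≈0#
  num-neg (+ suc n)  = refl
  num-neg -[1+ n ]   = sym (-‿involutive _)

  num-*⁺ : ∀ m j → num (+ m ℤ.* j) ≈ num (+ m) * num j
  num-*⁺ m (+ n)    = trans (reflexive (≡.cong num (≡.sym (ℤP.pos-* m n)))) (×1-homo-* m n)
  num-*⁺ m -[1+ n ] = begin
    num (+ m ℤ.* -[1+ n ])        ≡⟨ ≡.cong num (ℤP.neg-distribʳ-* (+ m) (+ suc n)) ⟨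
    num (ℤ.- (+ m ℤ.* + suc n))   ≈⟨ num-neg (+ m ℤ.* + suc n) ⟩
    - num (+ m ℤ.* + suc n)       ≈⟨ -‿cong (num-*⁺ m (+ suc n)) ⟩
    - (num (+ m) * (suc n ×ᴿ 1#))  ≈⟨ -‿distribʳ-* _ _ ⟩
    num (+ m) * num -[1+ n ]      ∎

  num-* : ∀ i j → num (i ℤ.* j) ≈ num i * num j
  num-* (+ m)    j = num-*⁺ m j
  num-* -[1+ m ] j = begin
    num (-[1+ m ] ℤ.* j)          ≡⟨ ≡.cong num (ℤP.neg-distribˡ-* (+ suc m) j) ⟨
    num (ℤ.- (+ suc m ℤ.* j))     ≈⟨ num-neg (+ suc m ℤ.* j) ⟩
    - num (+ suc m ℤ.* j)         ≈⟨ -‿cong (num-*⁺ (suc m) j) ⟩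
    - (num (+ suc m) * num j)     ≈⟨ -‿distribˡ-* _ _ ⟩
    num -[1+ m ] * num j          ∎

  numMorphism : ℤ.+-*-rawRing -Raw-AlmostCommutative⟶ fromCommutativeRing R
  numMorphism = record
    { ⟦_⟧    = num
    ; +-homo = num-+
    ; *-homo = num-*
    ; -‿homo = num-neg
    ; 0-homo = refl
    ; 1-homo = refl
    }

  num-≟ : ∀ i j → Maybe (num i ≈ num j)
  num-≟ i j with i ℤ.≟ j
  ... | yes i≡j = just (reflexive (≡.cong num i≡j))
  ... | no  _   = nothing

  open RingSolver ℤ.+-*-rawRing (fromCommutativeRing R) numMorphism num-≟ public
    using (solve; _:=_; _:+_; _:*_; _:-_; :-_; con; Polynomial)

-- Consequences of the relations of degree seven, in an arbitrary commutative ring.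

module DegreeSeven {c ℓ} (R : CommutativeRing c ℓ) where
  open CommutativeRing R
  open IntegerCoefficients R

  private
    # : ℤ → Carrier
    # = num

  -- Consequences of the relations are certified by explicit cofactors; drop removes them one at a time.
  drop : ∀ {x y} z k → x ≈ y → z + k * (x - y) ≈ z
  drop {x} {y} z k e = trans (+-congˡ (*-congˡ (trans (+-congʳ e) (-‿inverseʳ y))))
    (solve 2 (λ z k → z :+ k :* con (+ 0) := z) refl z k)

  -- `θ₁`, ..., `θ₈` stand for the theta series of the norm form of ℤ[(1+√-7)/2] in q, q², q⁴, q⁸;
  -- `Y`, `N`, `P` for yψ(y)ψ(y⁷) at y = q, q², q⁴; `B` for φ(q)φ(Q), `w` for φ(q²)φ(Q²). As `θ₁`
  -- and `θ₂` are each described twice, elimination leaves a linear relation between `B`, `w`, `Y`,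
  -- `N` and `P`.
  module Halvings
    (θ₁ θ₂ θ₄ θ₈ ω w B Y N P : Carrier)
    (θ₁≈ : θ₁ ≈ θ₂ + (Y + Y))
    (θ₂≈ : θ₂ ≈ θ₄ + (N + N))
    (θ₄≈ : θ₄ ≈ θ₈ + (P + P))
    (θ₁≈B : θ₁ ≈ B + ((N + N) + (N + N)))
    (θ₂≈w : θ₂ ≈ w + ((P + P) + (P + P)))
    (w≈ : w ≈ θ₈ + ω)
    where

    B≈ : B ≈ w + # (+ 4) * P + # (+ 2) * Y - # (+ 4) * N
    B≈ = trans (solve 7 (λ B θ₁ θ₂ w P Y N → B := w :+ con (+ 4) :* P :+ con (+ 2) :* Y :- con (+ 4) :* N
            :+ (:- con (+ 1)) :* (θ₁ :- (B :+ ((N :+ N) :+ (N :+ N))))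
            :+ con (+ 1) :* (θ₁ :- (θ₂ :+ (Y :+ Y)))
            :+ con (+ 1) :* (θ₂ :- (w :+ ((P :+ P) :+ (P :+ P))))) refl B θ₁ θ₂ w P Y N)
      (trans (drop _ _ θ₂≈w) (trans (drop _ _ θ₁≈) (drop _ _ θ₁≈B)))

    θ₈≈ : θ₈ ≈ w + (P + P) - (N + N)
    θ₈≈ = trans (solve 6 (λ θ₈ θ₄ θ₂ w P N → θ₈ := w :+ (P :+ P) :- (N :+ N)
            :+ (:- con (+ 1)) :* (θ₄ :- (θ₈ :+ (P :+ P)))
            :+ (:- con (+ 1)) :* (θ₂ :- (θ₄ :+ (N :+ N)))
            :+ con (+ 1) :* (θ₂ :- (w :+ ((P :+ P) :+ (P :+ P))))) refl θ₈ θ₄ θ₂ w P N)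
      (trans (drop _ _ θ₂≈w) (trans (drop _ _ θ₂≈) (drop _ _ θ₄≈)))

    ω≈ : ω ≈ (N + N) - (P + P)
    ω≈ = trans (solve 5 (λ ω θ₈ w P N → ω := (N :+ N) :- (P :+ P)
            :+ (:- con (+ 1)) :* (w :- (θ₈ :+ ω))
            :+ (:- con (+ 1)) :* (θ₈ :- (w :+ (P :+ P) :- (N :+ N)))) refl ω θ₈ w P N)
      (trans (drop _ _ θ₈≈) (drop _ _ w≈))

  module Relations (t δ : Carrier) (δ² : δ * δ ≈ t * (1# - # (+ 3) * t + # (+ 4) * (t * t))) where
    -- These become B/w, Z/w², z̄ + β - 1 and uU/w². The third is the part common to Wᵃ/w² = m - h
    -- and Wᵇ/w² = m - H.
    β z̄ m p : Carrier
    β  = 1# - # (+ 2) * t + # (+ 4) * (t * t) + # (+ 2) * δ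
    z̄  = # (+ 2) * (t + δ) * (1# - # (+ 2) * t)
    m  = # (+ 4) * (1# - t) * δ
    p  = # (+ 16) * ((t * t) * (t * t))

    -- Since (x + u)(X + U) = B², xX = w² and uU = pw², the left side is (uX + xU)/w², that is, h +
    -- H.
    β²≈ : β * β - 1# - p ≈ # (+ 4) * δ * (1# - # (+ 2) * t + # (+ 4) * (t * t))
    β²≈ = trans (solve 2 (λ t δ → let β = con (+ 1) :- con (+ 2) :* t :+ con (+ 4) :* (t :* t) :+ con (+ 2) :* δ in
        β :* β :- con (+ 1) :- con (+ 16) :* ((t :* t) :* (t :* t))
          := con (+ 4) :* δ :* (con (+ 1) :- con (+ 2) :* t :+ con (+ 4) :* (t :* t))
             :+ con (+ 4) :* (δ :* δ :- t :* (con (+ 1) :- con (+ 3) :* t :+ con (+ 4) :* (t :* t)))) refl t δ)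
      (drop _ _ δ²)

    -- This is (TZ)² = (ab(a - b))² divided by w⁶: T² = ab - Z contributes β - z̄, and (a - b)²
    -- contributes 2 + (β² - 1 - p) - 2β = (β - 1)² - p.
    squares-agree : (β - z̄) * (z̄ * z̄) ≈ (β * β) * ((β - 1#) * (β - 1#) - p)
    squares-agree = trans (solve 2 (λ t δ →
        let β = con (+ 1) :- con (+ 2) :* t :+ con (+ 4) :* (t :* t) :+ con (+ 2) :* δ
            z = con (+ 2) :* (t :+ δ) :* (con (+ 1) :- con (+ 2) :* t) in
        (β :- z) :* (z :* z)
          := (β :* β) :* ((β :- con (+ 1)) :* (β :- con (+ 1)) :- con (+ 16) :* ((t :* t) :* (t :* t)))
             :+ (con (ℤ.- + 16) :* δ :- con (+ 16) :* (δ :* δ) :+ con (+ 80) :* (t :* δ) :- con (+ 192) :* (t :* t :* δ)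
                 :+ con (+ 64) :* (t :* t :* t :* δ) :- con (+ 64) :* ((t :* t) :* (t :* t)))
                :* (δ :* δ :- t :* (con (+ 1) :- con (+ 3) :* t :+ con (+ 4) :* (t :* t)))) refl t δ)
      (drop _ _ δ²)

    -- The difference of the two sides changes sign when `h` and `H` are exchanged, so it is `h - H`
    -- times a symmetric polynomial. That polynomial, `disc`, is determined by `h + H` and `h * H`,
    -- both known in terms of t and δ.
    cubes-agree : ∀ h H → h + H ≈ # (+ 4) * δ * (1# - # (+ 2) * t + # (+ 4) * (t * t)) → h * H ≈ p →
      ((m - h) * ((m - h) * (m - h))) * (h - p * H) ≈ ((m - H) * ((m - H) * (m - H))) * (H - p * h)
    cubes-agree h H sum product = trans
      (solve 4 (λ h H m p → ((m :- h) :* ((m :- h) :* (m :- h))) :* (h :- p :* H)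
         := ((m :- H) :* ((m :- H) :* (m :- H))) :* (H :- p :* h) :+ (h :- H) :* (discᵖ m p (h :+ H) (h :* H) :- con (+ 0))) refl h H m p)
      (drop _ _ (trans (disc-cong sum product) disc≈0))
      where
      disc : Carrier → Carrier → Carrier
      disc s π = (m - s) * ((m - s) * (m - s)) - π * (# (+ 3) * m - # (+ 2) * s)
                 + p * (m * (m * m) - # (+ 3) * (m * π) + π * s)
      discᵖ : ∀ {n} → (m p s π : Polynomial n) → Polynomial n
      discᵖ m p s π = (m :- s) :* ((m :- s) :* (m :- s)) :- π :* (con (+ 3) :* m :- con (+ 2) :* s)
                 :+ p :* (m :* (m :* m) :- con (+ 3) :* (m :* π) :+ π :* s)
      disc-cong : ∀ {s s′ π π′} → s ≈ s′ → π ≈ π′ → disc s π ≈ disc s′ π′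
      disc-cong es eπ = +-cong (+-cong (*-cong e (*-cong e e)) (-‿cong (*-cong eπ (+-congˡ (-‿cong (*-congˡ es))))))
        (*-congˡ (+-cong (+-congˡ (-‿cong (*-congˡ (*-congˡ eπ)))) (*-cong eπ es)))
        where e = +-congˡ (-‿cong es)
      disc≈0 : disc (# (+ 4) * δ * (1# - # (+ 2) * t + # (+ 4) * (t * t))) p ≈ 0#
      -- All terms are odd in δ. As m - s = 4t(1 - 4t)δ, the cubic ones are 64t³δ³(1 - 4t)³ and 16t⁴
      -- · 64(1 - t)³δ³; replacing their δ² cancels the linear ones, which explains the cofactor.
      disc≈0 = trans (solve 2 (λ t δ →
          discᵖ (con (+ 4) :* (con (+ 1) :- t) :* δ) (con (+ 16) :* ((t :* t) :* (t :* t)))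
                (con (+ 4) :* δ :* (con (+ 1) :- con (+ 2) :* t :+ con (+ 4) :* (t :* t))) (con (+ 16) :* ((t :* t) :* (t :* t)))
            := con (+ 0) :+ con (+ 64) :* (t :* t :* t) :* δ
                 :* ((con (+ 1) :- con (+ 4) :* t) :* ((con (+ 1) :- con (+ 4) :* t) :* (con (+ 1) :- con (+ 4) :* t))
                     :+ con (+ 16) :* t :* ((con (+ 1) :- t) :* ((con (+ 1) :- t) :* (con (+ 1) :- t))))
               :* (δ :* δ :- t :* (con (+ 1) :- con (+ 3) :* t :+ con (+ 4) :* (t :* t)))) refl t δ)
        (drop _ _ δ²)

  module Homogeneous
    (w w⁻¹ N Y P B : Carrier)
    (unit : w * w⁻¹ ≈ 1#)
    (N² : N * N ≈ P * w)
    (Y² : Y * Y ≈ N * B)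
    (B≈ : B ≈ w + # (+ 4) * P + # (+ 2) * Y - # (+ 4) * N)
    where
    open SetoidReasoning setoid

    t δ : Carrier
    t = N * w⁻¹
    δ = Y * w⁻¹ - t

    N≈tw : N ≈ t * w
    N≈tw = trans (solve 3 (λ N w v → N := (N :* v) :* w :+ (:- N) :* (w :* v :- con (+ 1))) refl N w w⁻¹) (drop _ _ unit)

    Y≈yw : Y ≈ (t + δ) * w
    Y≈yw = trans (solve 4 (λ N Y w v → Y := (N :* v :+ (Y :* v :- N :* v)) :* w :+ (:- Y) :* (w :* v :- con (+ 1))) refl N Y w w⁻¹) (drop _ _ unit)

    P≈t²w : P ≈ (t * t) * w
    P≈t²w = trans (solve 4 (λ N P w v → P := ((N :* v) :* (N :* v)) :* w :+ (:- (v :* v :* w)) :* (N :* N :- P :* w)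
                                               :+ (:- (P :* (w :* v :+ con (+ 1)))) :* (w :* v :- con (+ 1))) refl N P w w⁻¹)
              (trans (drop _ _ unit) (drop _ _ N²))

    -- For y = Y/w, dividing Y² = NB by w² gives y² = t(1 + 4t² + 2y - 4t); the shift δ = y - t
    -- completes the square.
    δ²≈ : δ * δ ≈ t * (1# - # (+ 3) * t + # (+ 4) * (t * t))
    δ²≈ = trans (solve 6 (λ N Y P B w v → let t = N :* v ; δ = Y :* v :- t in
        δ :* δ := t :* (con (+ 1) :- con (+ 3) :* t :+ con (+ 4) :* (t :* t))
                  :+ (v :* v) :* (Y :* Y :- N :* B)
                  :+ (t :* v) :* (B :- (w :+ con (+ 4) :* P :+ con (+ 2) :* Y :- con (+ 4) :* N))
                  :+ (con (+ 4) :* (t :* v)) :* (P :- (t :* t) :* w)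
                  :+ (t :* (con (+ 1) :+ con (+ 4) :* (t :* t))) :* (w :* v :- con (+ 1))) refl N Y P B w w⁻¹)
      (trans (drop _ _ unit) (trans (drop _ _ P≈t²w) (trans (drop _ _ B≈) (drop _ _ Y²))))

    open Relations t δ δ²≈

    B≈βw : B ≈ β * w
    B≈βw = trans (solve 6 (λ N Y P B w v → let t = N :* v ; δ = Y :* v :- t in
        B := (con (+ 1) :- con (+ 2) :* t :+ con (+ 4) :* (t :* t) :+ con (+ 2) :* δ) :* w
             :+ con (+ 1) :* (B :- (w :+ con (+ 4) :* P :+ con (+ 2) :* Y :- con (+ 4) :* N))
             :+ con (+ 4) :* (P :- (t :* t) :* w)
             :+ (con (+ 4) :* N :- con (+ 2) :* Y) :* (w :* v :- con (+ 1))) refl N Y P B w w⁻¹)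
      (trans (drop _ _ unit) (trans (drop _ _ P≈t²w) (drop _ _ B≈)))

    Z : Carrier
    Z = # (+ 2) * Y * (w - # (+ 2) * N)

    Z≈ : Z ≈ z̄ * (w * w)
    Z≈ = trans (*-cong (*-congˡ Y≈yw) (+-congˡ (-‿cong (*-congˡ N≈tw))))
      (solve 3 (λ t δ w → con (+ 2) :* ((t :+ δ) :* w) :* (w :- con (+ 2) :* (t :* w))
                 := con (+ 2) :* (t :+ δ) :* (con (+ 1) :- con (+ 2) :* t) :* (w :* w)) refl t δ w)

    ww-cancel : ∀ {f g} → f * (w * w) ≈ g * (w * w) → f ≈ g
    ww-cancel {f} {g} e = begin
      f                                    ≈⟨ expand f ⟩
      (f * (w * w)) * (w⁻¹ * w⁻¹)          ≈⟨ *-congʳ e ⟩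
      (g * (w * w)) * (w⁻¹ * w⁻¹)          ≈⟨ expand g ⟨
      g                                    ∎
      where
      expand : ∀ f → f ≈ (f * (w * w)) * (w⁻¹ * w⁻¹)
      expand f = trans (solve 3 (λ f w v → f := (f :* (w :* w)) :* (v :* v) :+ (:- (f :* (w :* v :+ con (+ 1)))) :* (w :* v :- con (+ 1))) refl f w w⁻¹)
                       (drop _ _ unit)

    PP≈ : # (+ 16) * (P * P) ≈ p * (w * w)
    PP≈ = trans (*-congˡ (*-cong P≈t²w P≈t²w))
      (solve 2 (λ t w → con (+ 16) :* (((t :* t) :* w) :* ((t :* t) :* w)) := (con (+ 16) :* ((t :* t) :* (t :* t))) :* (w :* w)) refl t w)

    -- Intended values: x = φ(q²)², X = φ(Q²)², u = 4qψ(q⁴)², U = 4Qψ(Q⁴)², so that φ(q)² = x + u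
    -- and φ(Q)² = X + U.
    module Forms
      (x X u U a b T : Carrier)
      (xX : x * X ≈ w * w)
      (uU : u * U ≈ # (+ 16) * (P * P))
      (BB : (x + u) * (X + U) ≈ B * B)
      (aa : a * a ≈ (x + u) * X)
      (bb : b * b ≈ x * (X + U))
      (ab : a * b ≈ w * B)
      (TT : T * T ≈ a * b - Z)
      where

      ab≈ : a * b ≈ β * (w * w)
      ab≈ = trans ab (trans (*-congˡ B≈βw) (solve 2 (λ β w → w :* (β :* w) := β :* (w :* w)) refl β w))

      cross≈ : u * X + x * U ≈ (β * β - 1# - p) * (w * w)
      cross≈ = begin
        u * X + x * U
          ≈⟨ solve 4 (λ x X u U → u :* X :+ x :* U := (x :+ u) :* (X :+ U) :- x :* X :- u :* U) refl x X u U ⟩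
        (x + u) * (X + U) - x * X - u * U
          ≈⟨ +-cong (+-cong (trans BB (*-cong B≈βw B≈βw)) (-‿cong xX)) (-‿cong (trans uU PP≈)) ⟩
        (β * w) * (β * w) - w * w - p * (w * w)
          ≈⟨ solve 3 (λ β p w → (β :* w) :* (β :* w) :- w :* w :- p :* (w :* w) := (β :* β :- con (+ 1) :- p) :* (w :* w)) refl β p w ⟩
        (β * β - 1# - p) * (w * w) ∎

      squares : (T * Z) * (T * Z) ≈ ((a * b) * (a - b)) * ((a * b) * (a - b))
      squares = begin
        (T * Z) * (T * Z)
          ≈⟨ solve 2 (λ T Z → (T :* Z) :* (T :* Z) := (T :* T) :* (Z :* Z)) refl T Z ⟩
        (T * T) * (Z * Z)
          ≈⟨ *-cong (trans TT (+-cong ab≈ (-‿cong Z≈))) (*-cong Z≈ Z≈) ⟩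
        (β * (w * w) - z̄ * (w * w)) * ((z̄ * (w * w)) * (z̄ * (w * w)))
          ≈⟨ solve 3 (λ β z v → (β :* v :- z :* v) :* ((z :* v) :* (z :* v)) := ((β :- z) :* (z :* z)) :* (v :* v :* v)) refl β z̄ (w * w) ⟩
        ((β - z̄) * (z̄ * z̄)) * (w * w * (w * w) * (w * w))
          ≈⟨ *-congʳ squares-agree ⟩
        ((β * β) * ((β - 1#) * (β - 1#) - p)) * (w * w * (w * w) * (w * w))
          ≈⟨ solve 3 (λ β p v → ((β :* β) :* ((β :- con (+ 1)) :* (β :- con (+ 1)) :- p)) :* (v :* v :* v)
               := ((β :* v) :* (β :* v)) :* (con (+ 2) :* v :+ (β :* β :- con (+ 1) :- p) :* v :- con (+ 2) :* (β :* v))) refl β p (w * w) ⟩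
        ((β * (w * w)) * (β * (w * w))) * (# (+ 2) * (w * w) + (β * β - 1# - p) * (w * w) - # (+ 2) * (β * (w * w)))
          ≈⟨ *-cong (*-cong ab≈ ab≈) difference² ⟨
        ((a * b) * (a * b)) * ((a - b) * (a - b))
          ≈⟨ solve 2 (λ c d → (c :* c) :* (d :* d) := (c :* d) :* (c :* d)) refl (a * b) (a - b) ⟩
        ((a * b) * (a - b)) * ((a * b) * (a - b)) ∎
        where
        difference² : (a - b) * (a - b) ≈ # (+ 2) * (w * w) + (β * β - 1# - p) * (w * w) - # (+ 2) * (β * (w * w))
        difference² = begin
          (a - b) * (a - b)
            ≈⟨ solve 2 (λ a b → (a :- b) :* (a :- b) := a :* a :+ b :* b :- con (+ 2) :* (a :* b)) refl a b ⟩
          a * a + b * b - # (+ 2) * (a * b)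
            ≈⟨ +-cong (+-cong aa bb) (-‿cong (*-congˡ ab≈)) ⟩
          (x + u) * X + x * (X + U) - # (+ 2) * (β * (w * w))
            ≈⟨ solve 5 (λ x X u U r → (x :+ u) :* X :+ x :* (X :+ U) :- r := con (+ 2) :* (x :* X) :+ (u :* X :+ x :* U) :- r)
                 refl x X u U (# (+ 2) * (β * (w * w))) ⟩
          # (+ 2) * (x * X) + (u * X + x * U) - # (+ 2) * (β * (w * w))
            ≈⟨ +-congʳ (+-cong (*-congˡ xX) cross≈) ⟩
          # (+ 2) * (w * w) + (β * β - 1# - p) * (w * w) - # (+ 2) * (β * (w * w)) ∎

      Wᵃ Wᵇ : Carrier
      Wᵃ = Z + a * b - a * a
      Wᵇ = Z + a * b - b * b

      private
        -- Chosen so that a² = (1 + h)w² and b² = (1 + H)w².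
        h H : Carrier
        h = (u * X) * (w⁻¹ * w⁻¹)
        H = (x * U) * (w⁻¹ * w⁻¹)

        rescale : ∀ f → f ≈ (f * (w⁻¹ * w⁻¹)) * (w * w)
        rescale f = trans (solve 3 (λ f w v → f := (f :* (v :* v)) :* (w :* w) :+ (:- (f :* (w :* v :+ con (+ 1)))) :* (w :* v :- con (+ 1))) refl f w w⁻¹)
                          (drop _ _ unit)

        sum≈ : h + H ≈ # (+ 4) * δ * (1# - # (+ 2) * t + # (+ 4) * (t * t))
        sum≈ = trans (ww-cancel (begin
          (h + H) * (w * w)                ≈⟨ distribʳ (w * w) h H ⟩
          h * (w * w) + H * (w * w)        ≈⟨ +-cong (rescale (u * X)) (rescale (x * U)) ⟨
          u * X + x * U                    ≈⟨ cross≈ ⟩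
          (β * β - 1# - p) * (w * w)       ∎)) β²≈

        product≈ : h * H ≈ p
        product≈ = ww-cancel (ww-cancel (begin
          ((h * H) * (w * w)) * (w * w)    ≈⟨ solve 3 (λ h H v → ((h :* H) :* v) :* v := (h :* v) :* (H :* v)) refl h H (w * w) ⟩
          (h * (w * w)) * (H * (w * w))    ≈⟨ *-cong (rescale (u * X)) (rescale (x * U)) ⟨
          (u * X) * (x * U)                ≈⟨ solve 4 (λ x X u U → (u :* X) :* (x :* U) := (u :* U) :* (x :* X)) refl x X u U ⟩
          (u * U) * (x * X)                ≈⟨ *-cong (trans uU PP≈) xX ⟩
          (p * (w * w)) * (w * w)          ∎))

        m≈ : ∀ f → z̄ * (w * w) + β * (w * w) - (w * w + f * (w * w)) ≈ (m - f) * (w * w)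
        m≈ f = solve 4 (λ t δ f v →
          (con (+ 2) :* (t :+ δ) :* (con (+ 1) :- con (+ 2) :* t)) :* v
            :+ (con (+ 1) :- con (+ 2) :* t :+ con (+ 4) :* (t :* t) :+ con (+ 2) :* δ) :* v :- (v :+ f :* v)
            := (con (+ 4) :* (con (+ 1) :- t) :* δ :- f) :* v) refl t δ f (w * w)

        Wᵃ≈ : Wᵃ ≈ (m - h) * (w * w)
        Wᵃ≈ = trans (+-cong (+-cong Z≈ ab≈) (-‿cong (trans aa (trans (distribʳ X x u) (+-cong xX (rescale (u * X))))))) (m≈ h)

        Wᵇ≈ : Wᵇ ≈ (m - H) * (w * w)
        Wᵇ≈ = trans (+-cong (+-cong Z≈ ab≈) (-‿cong (trans bb (trans (distribˡ x X U) (+-cong xX (rescale (x * U))))))) (m≈ H)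

        quartic : ∀ {f g} F → F ≈ (x * X) * f - (u * U) * g →
                  F ≈ ((f * (w⁻¹ * w⁻¹)) - p * (g * (w⁻¹ * w⁻¹))) * (w * w) * (w * w)
        quartic {f} {g} F e = trans e (trans
          (+-cong (*-cong xX (rescale f)) (-‿cong (*-cong (trans uU PP≈) (rescale g))))
          (solve 4 (λ f g p v → v :* (f :* v) :- (p :* v) :* (g :* v) := (f :- p :* g) :* v :* v)
             refl (f * (w⁻¹ * w⁻¹)) (g * (w⁻¹ * w⁻¹)) p (w * w)))

        gather : ∀ f g v → ((f * v) * ((f * v) * (f * v))) * (g * v * v) ≈ ((f * (f * f)) * g) * (v * v * v * (v * v))
        gather = solve 3 (λ f g v → ((f :* v) :* ((f :* v) :* (f :* v))) :* (g :* v :* v) := ((f :* (f :* f)) :* g) :* (v :* v :* v :* (v :* v))) refl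

      -- The factors x u (X² - U²) and X U (x² - u²) are w⁴(h - pH) and w⁴(H - ph), so this is
      -- `cubes-agree` times w¹⁰. They are the combinations which turn into fourth powers of ψ and
      -- φ(-·).
      cubes : (Wᵃ * (Wᵃ * Wᵃ)) * ((x * u) * (X * X - U * U)) ≈ (Wᵇ * (Wᵇ * Wᵇ)) * ((X * U) * (x * x - u * u))
      cubes = begin
        (Wᵃ * (Wᵃ * Wᵃ)) * ((x * u) * (X * X - U * U))
          ≈⟨ *-cong (*-cong Wᵃ≈ (*-cong Wᵃ≈ Wᵃ≈)) (quartic {u * X} {x * U} _
               (solve 4 (λ x X u U → (x :* u) :* (X :* X :- U :* U) := (x :* X) :* (u :* X) :- (u :* U) :* (x :* U)) refl x X u U)) ⟩
        (((m - h) * (w * w)) * (((m - h) * (w * w)) * ((m - h) * (w * w)))) * ((h - p * H) * (w * w) * (w * w))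
          ≈⟨ gather (m - h) (h - p * H) (w * w) ⟩
        (((m - h) * ((m - h) * (m - h))) * (h - p * H)) * (w * w * (w * w) * (w * w) * (w * w * (w * w)))
          ≈⟨ *-congʳ (cubes-agree h H sum≈ product≈) ⟩
        (((m - H) * ((m - H) * (m - H))) * (H - p * h)) * (w * w * (w * w) * (w * w) * (w * w * (w * w)))
          ≈⟨ gather (m - H) (H - p * h) (w * w) ⟨
        (((m - H) * (w * w)) * (((m - H) * (w * w)) * ((m - H) * (w * w)))) * ((H - p * h) * (w * w) * (w * w))
          ≈⟨ *-cong (*-cong Wᵇ≈ (*-cong Wᵇ≈ Wᵇ≈)) (quartic {x * U} {u * X} _
               (solve 4 (λ x X u U → (X :* U) :* (x :* x :- u :* u) := (x :* X) :* (x :* U) :- (u :* U) :* (u :* X)) refl x X u U)) ⟨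
        (Wᵇ * (Wᵇ * Wᵇ)) * ((X * U) * (x * x - u * u)) ∎

      -- `Wᵃ` and `Wᵇ` satisfy a Wᵇ + b Wᵃ = (a + b)Z, so the terms linear in T add up to -2(a +
      -- b)TZ = -2ab(a² - b²). The remaining terms are (a² - b²)(Z + ab + T²) = 2ab(a² - b²), and
      -- everything cancels.
      ratio² : T * Z ≈ (a * b) * (a - b) → ((a - T) * (a - T)) * Wᵇ ≈ ((b + T) * (b + T)) * Wᵃ
      ratio² TZ = trans (solve 4 (λ a b T Z →
          ((a :- T) :* (a :- T)) :* (Z :+ a :* b :- b :* b)
            := ((b :+ T) :* (b :+ T)) :* (Z :+ a :* b :- a :* a)
               :+ (a :* a :- b :* b) :* (T :* T :- (a :* b :- Z))
               :+ (con (ℤ.- + 2) :* (a :+ b)) :* (T :* Z :- (a :* b) :* (a :- b))) refl a b T Z)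
        (trans (drop _ _ TZ) (drop _ _ TT))

  -- Here `φ`, `ψ` stand for φ(-q²), ψ(q²), the capitals for the same functions of Q², and `e₂`,
  -- `e₄`, `e₁₄`, `e₂₈` for E(q²), E(q⁴), E(Q²), E(Q⁴).
  module EtaQuotients
    (e₂ e₄ e₁₄ e₂₈ φ ψ Φ Ψ q² Wᵃ Wᵇ : Carrier)
    (φ-product : φ * e₄ ≈ e₂ * e₂)
    (ψ-product : ψ * e₂ ≈ e₄ * e₄)
    (Φ-product : Φ * e₂₈ ≈ e₁₄ * e₁₄)
    (Ψ-product : Ψ * e₁₄ ≈ e₂₈ * e₂₈)
    (cubes : (Wᵃ * (Wᵃ * Wᵃ)) * (((ψ * ψ) * (ψ * ψ)) * ((Φ * Φ) * (Φ * Φ)))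
           ≈ (q² * (q² * q²)) * ((Wᵇ * (Wᵇ * Wᵇ)) * (((Ψ * Ψ) * (Ψ * Ψ)) * ((φ * φ) * (φ * φ)))))
    where
    open SetoidReasoning setoid

    private
      cube : Carrier → Carrier
      cube f = f * (f * f)

      U V : Carrier
      U = (e₂₈ * e₂₈) * (e₂ * e₂)
      V = (e₁₄ * e₁₄) * (e₄ * e₄)

      -- Applied to Gauss's products this is E(y)³ψ(y) = E(y²)³φ(-y): the square relations combine
      -- into one for the cube of E(y)/E(y²).
      exchange : ∀ f g k l → k * l ≈ f * f → g * f ≈ l * l → cube f * g ≈ cube l * k
      exchange f g k l e e′ = begin
        f * (f * f) * g          ≈⟨ solve 2 (λ f g → f :* (f :* f) :* g := (f :* f) :* (g :* f)) refl f g ⟩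
        (f * f) * (g * f)        ≈⟨ *-cong (sym e) e′ ⟩
        (k * l) * (l * l)        ≈⟨ solve 2 (λ k l → (k :* l) :* (l :* l) := l :* (l :* l) :* k) refl k l ⟩
        l * (l * l) * k          ∎

      cube-product : ∀ f g → cube ((f * f) * (g * g)) ≈ (cube f * cube f) * (cube g * cube g)
      cube-product = solve 2 (λ f g → let h = (f :* f) :* (g :* g) in h :* (h :* h)
        := ((f :* (f :* f)) :* (f :* (f :* f))) :* ((g :* (g :* g)) :* (g :* (g :* g)))) refl

      fourth : ∀ f g h k → ((f * f) * (g * g)) * ((f * f) * (g * g)) * (((h * h) * (h * h)) * ((k * k) * (k * k)))
                         ≈ ((f * h) * (f * h)) * ((f * h) * (f * h)) * (((g * k) * (g * k)) * ((g * k) * (g * k)))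
      fourth = solve 4 (λ f g h k → ((f :* f) :* (g :* g)) :* ((f :* f) :* (g :* g)) :* (((h :* h) :* (h :* h)) :* ((k :* k) :* (k :* k)))
        := ((f :* h) :* (f :* h)) :* ((f :* h) :* (f :* h)) :* (((g :* k) :* (g :* k)) :* ((g :* k) :* (g :* k)))) refl

      -- Sixth powers of `V` and `U` are fourth powers of products of cubes of the `e`'s, so each
      -- exchange of a cube is used four times.
      V⁶≈U⁶ : (cube V * cube V) * (((Ψ * Ψ) * (Ψ * Ψ)) * ((φ * φ) * (φ * φ)))
            ≈ (cube U * cube U) * (((Φ * Φ) * (Φ * Φ)) * ((ψ * ψ) * (ψ * ψ)))
      V⁶≈U⁶ = begin
        (cube V * cube V) * (((Ψ * Ψ) * (Ψ * Ψ)) * ((φ * φ) * (φ * φ)))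
          ≈⟨ *-congʳ (*-cong (cube-product e₁₄ e₄) (cube-product e₁₄ e₄)) ⟩
        _ ≈⟨ fourth (cube e₁₄) (cube e₄) Ψ φ ⟩
        _ ≈⟨ *-cong (*-cong (*-cong c₁₄ c₁₄) (*-cong c₁₄ c₁₄)) (*-cong (*-cong c₄ c₄) (*-cong c₄ c₄)) ⟩
        _ ≈⟨ fourth (cube e₂₈) (cube e₂) Φ ψ ⟨
        _ ≈⟨ *-congʳ (*-cong (cube-product e₂₈ e₂) (cube-product e₂₈ e₂)) ⟨
        (cube U * cube U) * (((Φ * Φ) * (Φ * Φ)) * ((ψ * ψ) * (ψ * ψ))) ∎
        where
        c₁₄ : cube e₁₄ * Ψ ≈ cube e₂₈ * Φ
        c₁₄ = exchange e₁₄ Ψ Φ e₂₈ Φ-product Ψ-product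
        c₄ : cube e₄ * φ ≈ cube e₂ * ψ
        c₄ = sym (exchange e₂ ψ φ e₄ φ-product ψ-product)

    -- The factor ψ⁴Φ⁴ stays on both sides because a general commutative ring has no cancellation;
    -- it is removed once the ring is ℚ[[q]].
    quotient³ : (((ψ * ψ) * (ψ * ψ)) * ((Φ * Φ) * (Φ * Φ))) * cube (Wᵃ * (V * V))
              ≈ (((ψ * ψ) * (ψ * ψ)) * ((Φ * Φ) * (Φ * Φ))) * cube (q² * ((U * U) * Wᵇ))
    quotient³ = begin
      (ψ⁴ * Φ⁴) * cube (Wᵃ * (V * V))
        ≈⟨ solve 3 (λ c W V → let h = W :* (V :* V) in c :* (h :* (h :* h))
             := (W :* (W :* W) :* c) :* ((V :* (V :* V)) :* (V :* (V :* V)))) refl (ψ⁴ * Φ⁴) Wᵃ V ⟩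
      (cube Wᵃ * (ψ⁴ * Φ⁴)) * (cube V * cube V)
        ≈⟨ *-congʳ cubes ⟩
      (cube q² * (cube Wᵇ * (Ψ⁴ * φ⁴))) * (cube V * cube V)
        ≈⟨ solve 4 (λ q W c v → (q :* (W :* c)) :* v := (q :* W) :* (v :* c)) refl (cube q²) (cube Wᵇ) (Ψ⁴ * φ⁴) (cube V * cube V) ⟩
      (cube q² * cube Wᵇ) * ((cube V * cube V) * (Ψ⁴ * φ⁴))
        ≈⟨ *-congˡ V⁶≈U⁶ ⟩
      (cube q² * cube Wᵇ) * ((cube U * cube U) * (Φ⁴ * ψ⁴))
        ≈⟨ solve 5 (λ q W U c d → let h = q :* ((U :* U) :* W) in
             ((q :* (q :* q)) :* (W :* (W :* W))) :* (((U :* (U :* U)) :* (U :* (U :* U))) :* (d :* c))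
             := (c :* d) :* (h :* (h :* h))) refl q² Wᵇ U ψ⁴ Φ⁴ ⟩
      (ψ⁴ * Φ⁴) * cube (q² * ((U * U) * Wᵇ)) ∎
      where
      ψ⁴ = (ψ * ψ) * (ψ * ψ)
      Φ⁴ = (Φ * Φ) * (Φ * Φ)
      Ψ⁴ = (Ψ * Ψ) * (Ψ * Ψ)
      φ⁴ = (φ * φ) * (φ * φ)

open import Defs

-- The commutative ring of formal power series over ℚ.

module SeriesAlgebra where

  open ≡ using (_≡_; _≢_; refl; sym; trans; cong; cong₂; subst; subst₂; module ≡-Reasoning)
  open import Data.Rational using (_+_; _*_; -_; 1/_; ≢-nonZero)

  module ℚR = IntegerCoefficients ℚP.+-*-commutativeRing

  sumTo-cong : ∀ n {f g : ℕ → ℚ} → (∀ k → k ℕ.≤ n → f k ≡ g k) → sumTo n f ≡ sumTo n g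
  sumTo-cong zero    e = e 0 z≤n
  sumTo-cong (suc n) e =
    cong₂ _+_ (sumTo-cong n (λ k k≤n → e k (ℕP.m≤n⇒m≤1+n k≤n))) (e (suc n) ℕP.≤-refl)

  zeroS : Series
  zeroS _ = 0ℚ

  negS : Series → Series
  negS f n = - f n

  infixr 8 _·_
  _·_ : ℚ → Series → Series
  (c · f) n = c * f n

  tail : Series → Series
  tail f n = f (suc n)

  ⊗-cong : ∀ {f f′ g g′} → f ≈ f′ → g ≈ g′ → f ⊗ g ≈ f′ ⊗ g′
  ⊗-cong e e′ n = sumTo-cong n (λ k _ → cong₂ _*_ (e k) (e′ (n ℕ.∸ k)))

  -- Splitting off the constant term of a factor lowers the index of a Cauchy product by one; the
  -- ring laws follow by induction on the coefficient index, for all series at once, with no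
  -- manipulation of double sums.
  ⊗-tailˡ : ∀ f g n → (f ⊗ g) (suc n) ≡ f 0 * g (suc n) + (tail f ⊗ g) n
  ⊗-tailˡ f g n = go n
    where
    go : ∀ m → sumTo (suc m) (λ k → f k * g (suc n ℕ.∸ k))
             ≡ f 0 * g (suc n) + sumTo m (λ k → f (suc k) * g (n ℕ.∸ k))
    go zero    = refl
    go (suc m) = trans (cong (_+ f (suc (suc m)) * g (n ℕ.∸ suc m)) (go m))
      (ℚP.+-assoc (f 0 * g (suc n)) (sumTo m (λ k → f (suc k) * g (n ℕ.∸ k))) (f (suc (suc m)) * g (n ℕ.∸ suc m)))

  ⊗-tailʳ : ∀ f g n → (f ⊗ g) (suc n) ≡ (f ⊗ tail g) n + f (suc n) * g 0
  ⊗-tailʳ f g n = cong₂ _+_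
    (sumTo-cong n λ k k≤n → cong (λ j → f k * g j) (ℕP.+-∸-assoc 1 k≤n))
    (cong (λ j → f (suc n) * g j) (ℕP.n∸n≡0 n))

  ⊗-comm : ∀ f g → f ⊗ g ≈ g ⊗ f
  ⊗-comm f g zero    = ℚP.*-comm (f 0) (g 0)
  ⊗-comm f g (suc n) = begin
    (f ⊗ g) (suc n)                     ≡⟨ ⊗-tailʳ f g n ⟩
    (f ⊗ tail g) n + f (suc n) * g 0    ≡⟨ cong₂ _+_ (⊗-comm f (tail g) n) (ℚP.*-comm (f (suc n)) (g 0)) ⟩
    (tail g ⊗ f) n + g 0 * f (suc n)    ≡⟨ ℚP.+-comm ((tail g ⊗ f) n) (g 0 * f (suc n)) ⟩
    g 0 * f (suc n) + (tail g ⊗ f) n    ≡⟨ ⊗-tailˡ g f n ⟨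
    (g ⊗ f) (suc n)                     ∎
    where open ≡-Reasoning

  ⊗-distribʳ : ∀ h f g → (f ⊕ g) ⊗ h ≈ (f ⊗ h) ⊕ (g ⊗ h)
  ⊗-distribʳ h f g zero    = ℚP.*-distribʳ-+ (h 0) (f 0) (g 0)
  ⊗-distribʳ h f g (suc n) = begin
    ((f ⊕ g) ⊗ h) (suc n)
      ≡⟨ ⊗-tailˡ (f ⊕ g) h n ⟩
    (f 0 + g 0) * h (suc n) + ((tail f ⊕ tail g) ⊗ h) n
      ≡⟨ cong (λ x → (f 0 + g 0) * h (suc n) + x) (⊗-distribʳ h (tail f) (tail g) n) ⟩
    (f 0 + g 0) * h (suc n) + ((tail f ⊗ h) n + (tail g ⊗ h) n)
      ≡⟨ solve 5 (λ a b c d e → (a :+ b) :* c :+ (d :+ e) := (a :* c :+ d) :+ (b :* c :+ e))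
           refl (f 0) (g 0) (h (suc n)) ((tail f ⊗ h) n) ((tail g ⊗ h) n) ⟩
    (f 0 * h (suc n) + (tail f ⊗ h) n) + (g 0 * h (suc n) + (tail g ⊗ h) n)
      ≡⟨ cong₂ _+_ (⊗-tailˡ f h n) (⊗-tailˡ g h n) ⟨
    (f ⊗ h) (suc n) + (g ⊗ h) (suc n) ∎
    where
    open ≡-Reasoning
    open ℚR

  ·-⊗ : ∀ c f g → (c · f) ⊗ g ≈ c · (f ⊗ g)
  ·-⊗ c f g zero    = ℚP.*-assoc c (f 0) (g 0)
  ·-⊗ c f g (suc n) = begin
    ((c · f) ⊗ g) (suc n)                               ≡⟨ ⊗-tailˡ (c · f) g n ⟩
    c * f 0 * g (suc n) + ((c · tail f) ⊗ g) n          ≡⟨ cong (λ x → c * f 0 * g (suc n) + x) (·-⊗ c (tail f) g n) ⟩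
    c * f 0 * g (suc n) + c * (tail f ⊗ g) n            ≡⟨ solve 4 (λ a b d e → a :* b :* d :+ a :* e := a :* (b :* d :+ e)) refl c (f 0) (g (suc n)) ((tail f ⊗ g) n) ⟩
    c * (f 0 * g (suc n) + (tail f ⊗ g) n)              ≡⟨ cong (c *_) (⊗-tailˡ f g n) ⟨
    c * (f ⊗ g) (suc n)                                 ∎
    where
    open ≡-Reasoning
    open ℚR

  ⊗-assoc : ∀ f g h → (f ⊗ g) ⊗ h ≈ f ⊗ (g ⊗ h)
  ⊗-assoc f g h zero    = ℚP.*-assoc (f 0) (g 0) (h 0)
  ⊗-assoc f g h (suc n) = begin
    ((f ⊗ g) ⊗ h) (suc n)
      ≡⟨ ⊗-tailˡ (f ⊗ g) h n ⟩
    f 0 * g 0 * h (suc n) + (tail (f ⊗ g) ⊗ h) n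
      ≡⟨ cong (λ x → f 0 * g 0 * h (suc n) + x) (⊗-cong {g = h} (⊗-tailˡ f g) (λ _ → refl) n) ⟩
    f 0 * g 0 * h (suc n) + (((f 0 · tail g) ⊕ (tail f ⊗ g)) ⊗ h) n
      ≡⟨ cong (λ x → f 0 * g 0 * h (suc n) + x) (⊗-distribʳ h (f 0 · tail g) (tail f ⊗ g) n) ⟩
    f 0 * g 0 * h (suc n) + (((f 0 · tail g) ⊗ h) n + ((tail f ⊗ g) ⊗ h) n)
      ≡⟨ cong (λ x → f 0 * g 0 * h (suc n) + x) (cong₂ _+_ (·-⊗ (f 0) (tail g) h n) (⊗-assoc (tail f) g h n)) ⟩
    f 0 * g 0 * h (suc n) + (f 0 * (tail g ⊗ h) n + (tail f ⊗ (g ⊗ h)) n)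
      ≡⟨ solve 5 (λ a b c d e → a :* b :* c :+ (a :* d :+ e) := a :* (b :* c :+ d) :+ e)
           refl (f 0) (g 0) (h (suc n)) ((tail g ⊗ h) n) ((tail f ⊗ (g ⊗ h)) n) ⟩
    f 0 * (g 0 * h (suc n) + (tail g ⊗ h) n) + (tail f ⊗ (g ⊗ h)) n
      ≡⟨ cong (λ x → f 0 * x + (tail f ⊗ (g ⊗ h)) n) (⊗-tailˡ g h n) ⟨
    f 0 * (g ⊗ h) (suc n) + (tail f ⊗ (g ⊗ h)) n
      ≡⟨ ⊗-tailˡ f (g ⊗ h) n ⟨
    (f ⊗ (g ⊗ h)) (suc n) ∎
    where
    open ≡-Reasoning
    open ℚR

  ⊗-zeroˡ : ∀ f g → (∀ n → f n ≡ 0ℚ) → ∀ n → (f ⊗ g) n ≡ 0ℚ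
  ⊗-zeroˡ f g z zero    = trans (cong (_* g 0) (z 0)) (ℚP.*-zeroˡ (g 0))
  ⊗-zeroˡ f g z (suc n) = begin
    (f ⊗ g) (suc n)                       ≡⟨ ⊗-tailˡ f g n ⟩
    f 0 * g (suc n) + (tail f ⊗ g) n      ≡⟨ cong₂ _+_ (cong (_* g (suc n)) (z 0)) (⊗-zeroˡ (tail f) g (λ k → z (suc k)) n) ⟩
    0ℚ * g (suc n) + 0ℚ                   ≡⟨ cong (_+ 0ℚ) (ℚP.*-zeroˡ (g (suc n))) ⟩
    0ℚ                                    ∎
    where open ≡-Reasoning

  ⊗-identityˡ : ∀ f → one ⊗ f ≈ f
  ⊗-identityˡ f zero    = ℚP.*-identityˡ (f 0)
  ⊗-identityˡ f (suc n) = begin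
    (one ⊗ f) (suc n)                     ≡⟨ ⊗-tailˡ one f n ⟩
    1ℚ * f (suc n) + (tail one ⊗ f) n     ≡⟨ cong₂ _+_ (ℚP.*-identityˡ (f (suc n))) (⊗-zeroˡ (tail one) f (λ _ → refl) n) ⟩
    f (suc n) + 0ℚ                        ≡⟨ ℚP.+-identityʳ (f (suc n)) ⟩
    f (suc n)                             ∎
    where open ≡-Reasoning

  seriesRing : CommutativeRing _ _
  seriesRing = record
    { Carrier = Series ; _≈_ = _≈_ ; _+_ = _⊕_ ; _*_ = _⊗_ ; -_ = negS ; 0# = zeroS ; 1# = one
    ; isCommutativeRing = record
      { isRing = record
        { +-isAbelianGroup = record
          { isGroup = record
            { isMonoid = record
              { isSemigroup = record
                { isMagma = record
                  { isEquivalence = record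
                    { refl = λ _ → refl ; sym = λ e n → sym (e n) ; trans = λ e e′ n → trans (e n) (e′ n) }
                  ; ∙-cong = λ e e′ n → cong₂ _+_ (e n) (e′ n) }
                ; assoc = λ f g h n → ℚP.+-assoc (f n) (g n) (h n) }
              ; identity = (λ f n → ℚP.+-identityˡ (f n)) , (λ f n → ℚP.+-identityʳ (f n)) }
            ; inverse = (λ f n → ℚP.+-inverseˡ (f n)) , (λ f n → ℚP.+-inverseʳ (f n))
            ; ⁻¹-cong = λ e n → cong -_ (e n) }
          ; comm = λ f g n → ℚP.+-comm (f n) (g n) }
        ; *-cong = λ e e′ → ⊗-cong e e′
        ; *-assoc = ⊗-assoc
        ; *-identity = ⊗-identityˡ , (λ f n → trans (⊗-comm f one n) (⊗-identityˡ f n))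
        ; distrib = (λ f g h n → trans (⊗-comm f (g ⊕ h) n)
                       (trans (⊗-distribʳ f g h n) (cong₂ _+_ (⊗-comm g f n) (⊗-comm h f n))))
                  , ⊗-distribʳ }
      ; *-comm = ⊗-comm } }

  open CommutativeRing seriesRing public
    using () renaming (setoid to seriesSetoid; +-cong to ⊕-cong; -‿cong to negS-cong)

  module SR = IntegerCoefficients seriesRing
  module ≈-Reasoning = SetoidReasoning seriesSetoid

  ≈-refl : ∀ {f} → f ≈ f
  ≈-refl _ = refl

  ≈-sym : ∀ {f g} → f ≈ g → g ≈ f
  ≈-sym e n = sym (e n)

  ≈-trans : ∀ {f g h} → f ≈ g → g ≈ h → f ≈ h
  ≈-trans e e′ n = trans (e n) (e′ n)

  ⊗-congˡ : ∀ {f g g′} → g ≈ g′ → f ⊗ g ≈ f ⊗ g′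
  ⊗-congˡ {f} = ⊗-cong {f} ≈-refl

  ⊗-congʳ : ∀ {f f′ g} → f ≈ f′ → f ⊗ g ≈ f′ ⊗ g
  ⊗-congʳ {g = g} e = ⊗-cong {g = g} e ≈-refl

  -- Absence of zero divisors, uniqueness of roots, and inverses of series.

  p*q≡0⇒q≡0 : ∀ p q → p ≢ 0ℚ → p * q ≡ 0ℚ → q ≡ 0ℚ
  p*q≡0⇒q≡0 p q p≢0 e = begin
    q                    ≡⟨ ℚP.*-identityˡ q ⟨
    1ℚ * q               ≡⟨ cong (_* q) (ℚP.*-inverseˡ p) ⟨
    1/ p * p * q         ≡⟨ ℚP.*-assoc (1/ p) p q ⟩
    1/ p * (p * q)       ≡⟨ cong (1/ p *_) e ⟩
    1/ p * 0ℚ            ≡⟨ ℚP.*-zeroʳ (1/ p) ⟩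
    0ℚ                   ∎
    where
    open ≡-Reasoning
    instance _ = ≢-nonZero p≢0

  p*p≡0⇒p≡0 : ∀ p → p * p ≡ 0ℚ → p ≡ 0ℚ
  p*p≡0⇒p≡0 p e with p ℚP.≟ 0ℚ
  ... | yes p≡0 = p≡0
  ... | no p≢0  = p*q≡0⇒q≡0 p p p≢0 e

  0≤p*p : ∀ p → 0ℚ ℚ.≤ p * p
  0≤p*p p with ℚP.≤-total 0ℚ p
  ... | inj₁ 0≤p = subst (ℚ._≤ p * p) (ℚP.*-zeroʳ p) (ℚP.*-monoˡ-≤-nonNeg p ⦃ ℚ.nonNegative 0≤p ⦄ 0≤p)
  ... | inj₂ p≤0 = subst (ℚ._≤ p * p) (ℚP.*-zeroʳ p) (ℚP.*-monoˡ-≤-nonPos p ⦃ ℚ.nonPositive p≤0 ⦄ p≤0)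

  nonneg-sum-zero : ∀ p q → 0ℚ ℚ.≤ p → 0ℚ ℚ.≤ q → p + q ≡ 0ℚ → p ≡ 0ℚ × q ≡ 0ℚ
  nonneg-sum-zero p q 0≤p 0≤q e =
      ℚP.≤-antisym (subst₂ ℚ._≤_ (ℚP.+-identityʳ p) e (ℚP.+-monoʳ-≤ p 0≤q)) 0≤p
    , ℚP.≤-antisym (subst₂ ℚ._≤_ (ℚP.+-identityˡ q) e (ℚP.+-monoˡ-≤ q 0≤p)) 0≤q

  -- Doubling the form gives p² + (p + q)² + q², a sum of nonnegative rationals.
  sumOfSquares-zero : ∀ p q → p * p + p * q + q * q ≡ 0ℚ → p ≡ 0ℚ × q ≡ 0ℚ
  sumOfSquares-zero p q e = p*p≡0⇒p≡0 p (proj₁ split₁) , p*p≡0⇒p≡0 q (proj₂ split₂)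
    where
    open ≡-Reasoning
    open ℚR
    doubled : p * p + ((p + q) * (p + q) + q * q) ≡ 0ℚ
    doubled = begin
      p * p + ((p + q) * (p + q) + q * q)
        ≡⟨ solve 2 (λ p q → p :* p :+ ((p :+ q) :* (p :+ q) :+ q :* q)
                   := (p :* p :+ p :* q :+ q :* q) :+ (p :* p :+ p :* q :+ q :* q)) refl p q ⟩
      (p * p + p * q + q * q) + (p * p + p * q + q * q)
        ≡⟨ cong₂ _+_ e e ⟩
      0ℚ ∎
    0≤rest = subst (ℚ._≤ (p + q) * (p + q) + q * q) (ℚP.+-identityʳ 0ℚ)
               (ℚP.+-mono-≤ (0≤p*p (p + q)) (0≤p*p q))
    split₁ = nonneg-sum-zero (p * p) ((p + q) * (p + q) + q * q) (0≤p*p p) 0≤rest doubled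
    split₂ = nonneg-sum-zero ((p + q) * (p + q)) (q * q) (0≤p*p (p + q)) (0≤p*p q) (proj₂ split₁)

  ⊗-lowest : ∀ a b f g → (∀ j → j ℕ.< a → f j ≡ 0ℚ) → (∀ j → j ℕ.< b → g j ≡ 0ℚ) →
             (f ⊗ g) (a ℕ.+ b) ≡ f a * g b
  ⊗-lowest zero zero f g _ _ = refl
  ⊗-lowest zero (suc b) f g zf zg = begin
    (f ⊗ g) (suc b)                      ≡⟨ ⊗-tailʳ f g b ⟩
    (f ⊗ tail g) b + f (suc b) * g 0     ≡⟨ cong₂ _+_ (⊗-lowest 0 b f (tail g) (λ _ ()) (λ j j<b → zg (suc j) (s≤s j<b)))
                                                     (trans (cong (f (suc b) *_) (zg 0 (s≤s z≤n))) (ℚP.*-zeroʳ (f (suc b)))) ⟩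
    f 0 * g (suc b) + 0ℚ                 ≡⟨ ℚP.+-identityʳ (f 0 * g (suc b)) ⟩
    f 0 * g (suc b)                      ∎
    where open ≡-Reasoning
  ⊗-lowest (suc a) b f g zf zg = begin
    (f ⊗ g) (suc (a ℕ.+ b))                              ≡⟨ ⊗-tailˡ f g (a ℕ.+ b) ⟩
    f 0 * g (suc (a ℕ.+ b)) + (tail f ⊗ g) (a ℕ.+ b)     ≡⟨ cong₂ _+_ (trans (cong (_* g (suc (a ℕ.+ b))) (zf 0 (s≤s z≤n))) (ℚP.*-zeroˡ (g (suc (a ℕ.+ b)))))
                                                                     (⊗-lowest a b (tail f) g (λ j j<a → zf (suc j) (s≤s j<a)) zg) ⟩
    0ℚ + f (suc a) * g b                                 ≡⟨ ℚP.+-identityˡ (f (suc a) * g b) ⟩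
    f (suc a) * g b                                      ∎
    where open ≡-Reasoning

  lowestNonzero : ∀ (f : Series) k → f k ≢ 0ℚ → ∃ λ a → (∀ j → j ℕ.< a → f j ≡ 0ℚ) × f a ≢ 0ℚ
  lowestNonzero f k fk≢0 with f 0 ℚP.≟ 0ℚ
  lowestNonzero f k       fk≢0 | no f0≢0  = 0 , (λ _ ()) , f0≢0
  lowestNonzero f zero    fk≢0 | yes f0≡0 = ⊥-elim (fk≢0 f0≡0)
  lowestNonzero f (suc k) fk≢0 | yes f0≡0 with lowestNonzero (tail f) k fk≢0
  ... | a , z , fa≢0 = suc a , (λ { zero _ → f0≡0 ; (suc j) (s≤s j<a) → z j j<a }) , fa≢0

  -- If `a` is the order of `f` and `g` vanishes below `n`, the coefficient of index a + n in the
  -- product is `f a * g n`.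
  ⊗-noZeroDivisors : ∀ (f g : Series) k → f k ≢ 0ℚ → f ⊗ g ≈ zeroS → g ≈ zeroS
  ⊗-noZeroDivisors f g k fk≢0 e with lowestNonzero f k fk≢0
  ... | a , z , fa≢0 = <-rec (λ n → g n ≡ 0ℚ) λ n ih →
    p*q≡0⇒q≡0 (f a) (g n) fa≢0 (trans (sym (⊗-lowest a n f g z (λ j j<n → ih j<n))) (e (a ℕ.+ n)))

  ≈⇒⊖≈0 : ∀ {f g} → f ≈ g → f ⊕ negS g ≈ zeroS
  ≈⇒⊖≈0 {f} {g} e n = trans (cong (_+ - g n) (e n)) (ℚP.+-inverseʳ (g n))

  ⊖≈0⇒≈ : ∀ {f g} → f ⊕ negS g ≈ zeroS → f ≈ g
  ⊖≈0⇒≈ {f} {g} e n = begin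
    f n                     ≡⟨ solve 2 (λ f g → f := (f :+ :- g) :+ g) refl (f n) (g n) ⟩
    (f n + - g n) + g n     ≡⟨ cong (_+ g n) (e n) ⟩
    0ℚ + g n                ≡⟨ ℚP.+-identityˡ (g n) ⟩
    g n                     ∎
    where
    open ≡-Reasoning
    open ℚR

  ⊗-cancelˡ : ∀ f g h k → f k ≢ 0ℚ → f ⊗ g ≈ f ⊗ h → g ≈ h
  ⊗-cancelˡ f g h k fk≢0 e = ⊖≈0⇒≈ (⊗-noZeroDivisors f (g ⊕ negS h) k fk≢0
    (≈-trans (solve 3 (λ f g h → f :* (g :+ :- h) := f :* g :+ :- (f :* h)) ≈-refl f g h) (≈⇒⊖≈0 e)))
    where open SR

  -- A single nonzero coefficient of `f ⊕ g` excludes f = -g, which settles the sign of the root.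
  square-injective : ∀ f g k → (f ⊕ g) k ≢ 0ℚ → f ⊗ f ≈ g ⊗ g → f ≈ g
  square-injective f g k s≢0 e = ⊖≈0⇒≈ (⊗-noZeroDivisors (f ⊕ g) (f ⊕ negS g) k s≢0
    (≈-trans (solve 2 (λ f g → (f :+ g) :* (f :+ :- g) := f :* f :+ :- (g :* g)) ≈-refl f g) (≈⇒⊖≈0 e)))
    where open SR

  -- If both series vanish below `n`, the coefficient of index 2n is the same form evaluated at
  -- `f n`, `g n`, and this form is definite over ℚ. This is where the absence of a primitive cube
  -- root of unity in ℚ enters.
  f²+fg+g²≈0⇒≈0 : ∀ f g → f ⊗ f ⊕ f ⊗ g ⊕ g ⊗ g ≈ zeroS → ∀ n → f n ≡ 0ℚ × g n ≡ 0ℚ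
  f²+fg+g²≈0⇒≈0 f g e = <-rec (λ n → f n ≡ 0ℚ × g n ≡ 0ℚ) λ n ih →
    let zf = λ j j<n → proj₁ (ih {j} j<n)
        zg = λ j j<n → proj₂ (ih {j} j<n)
    in sumOfSquares-zero (f n) (g n) (trans
         (sym (cong₂ _+_ (cong₂ _+_ (⊗-lowest n n f f zf zf) (⊗-lowest n n f g zf zg)) (⊗-lowest n n g g zg zg)))
         (e (n ℕ.+ n)))

  cube-injective : ∀ f g → f ⊗ (f ⊗ f) ≈ g ⊗ (g ⊗ g) → f ≈ g
  cube-injective f g e = ⊖≈0⇒≈ diff≈0
    where
    open SR
    product≈0 : (f ⊕ negS g) ⊗ (f ⊗ f ⊕ f ⊗ g ⊕ g ⊗ g) ≈ zeroS
    product≈0 = ≈-trans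
      (solve 2 (λ f g → (f :+ :- g) :* (f :* f :+ f :* g :+ g :* g) := f :* (f :* f) :+ :- (g :* (g :* g))) ≈-refl f g)
      (≈⇒⊖≈0 e)
    diff≈0 : f ⊕ negS g ≈ zeroS
    diff≈0 n with (f ⊕ negS g) n ℚP.≟ 0ℚ
    -- A nonzero coefficient of f - g would force the factor f² + fg + g² to vanish, hence f and g
    -- as well; then this coefficient is 0 - 0.
    ... | yes d≡0 = d≡0
    ... | no d≢0  = cong₂ (λ x y → x + - y) (proj₁ both) (proj₂ both)
      where both = f²+fg+g²≈0⇒≈0 f g (⊗-noZeroDivisors (f ⊕ negS g) _ n d≢0 product≈0) n

  module _ (f : Series) (c : ℚ) where
    private
      g : Series
      g n = headℚ (pre f c n)

    -- `pre` lists the coefficients in descending order, so `dot` is a Cauchy sum of the shifted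
    -- series with the inverse. The shift `k` is arbitrary because the recursion of `dot` raises it.
    dot-pre : ∀ k n → dot f c k (pre f c n) ≡ ((λ i → f (k ℕ.+ i)) ⊗ g) n
    dot-pre k zero    = trans (ℚP.+-identityʳ (f k * c)) (cong (λ j → f j * c) (sym (ℕP.+-identityʳ k)))
    dot-pre k (suc n) = begin
      f k * g (suc n) + dot f c (suc k) (pre f c n)
        ≡⟨ cong₂ (λ j x → f j * g (suc n) + x) (sym (ℕP.+-identityʳ k)) (dot-pre (suc k) n) ⟩
      f (k ℕ.+ 0) * g (suc n) + ((λ i → f (suc k ℕ.+ i)) ⊗ g) n
        ≡⟨ cong (λ x → f (k ℕ.+ 0) * g (suc n) + x) (⊗-congʳ {g = g} (λ i → cong f (sym (ℕP.+-suc k i))) n) ⟩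
      f (k ℕ.+ 0) * g (suc n) + ((λ i → f (k ℕ.+ suc i)) ⊗ g) n
        ≡⟨ ⊗-tailˡ (λ i → f (k ℕ.+ i)) g n ⟨
      ((λ i → f (k ℕ.+ i)) ⊗ g) (suc n) ∎
      where open ≡-Reasoning

    ⊗-pre : f 0 * c ≡ 1ℚ → f ⊗ g ≈ one
    ⊗-pre e zero    = e
    ⊗-pre e (suc n) = begin
      (f ⊗ g) (suc n)                                       ≡⟨ ⊗-tailˡ f g n ⟩
      f 0 * (- (c * dot f c 1 (pre f c n))) + (tail f ⊗ g) n ≡⟨ cong (λ d → f 0 * (- (c * d)) + (tail f ⊗ g) n) (dot-pre 1 n) ⟩
      f 0 * (- (c * d)) + d                                 ≡⟨ solve 3 (λ f c d → f :* (:- (c :* d)) :+ d := (con ℤ.1ℤ :+ :- (f :* c)) :* d) refl (f 0) c d ⟩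
      (1ℚ + - (f 0 * c)) * d                                ≡⟨ cong (λ x → (1ℚ + - x) * d) e ⟩
      0ℚ * d                                                ≡⟨ ℚP.*-zeroˡ d ⟩
      0ℚ                                                    ∎
      where
      open ≡-Reasoning
      open ℚR
      d = (tail f ⊗ g) n

  ⊗-inv : ∀ f → f 0 ≢ 0ℚ → f ⊗ inv f ≈ one
  ⊗-inv f f0≢0 with f 0 ℚP.≟ 0ℚ
  ... | yes f0≡0 = ⊥-elim (f0≢0 f0≡0)
  ... | no p     = ⊗-pre f (1/_ (f 0) ⦃ ≢-nonZero p ⦄) (ℚP.*-inverseʳ (f 0) ⦃ ≢-nonZero p ⦄)

  qtimes-⊗ : ∀ f g → qtimes f ⊗ g ≈ qtimes (f ⊗ g)
  qtimes-⊗ f g zero    = ℚP.*-zeroˡ (g 0)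
  qtimes-⊗ f g (suc n) = begin
    (qtimes f ⊗ g) (suc n)            ≡⟨ ⊗-tailˡ (qtimes f) g n ⟩
    0ℚ * g (suc n) + (f ⊗ g) n        ≡⟨ cong (_+ (f ⊗ g) n) (ℚP.*-zeroˡ (g (suc n))) ⟩
    0ℚ + (f ⊗ g) n                    ≡⟨ ℚP.+-identityˡ ((f ⊗ g) n) ⟩
    (f ⊗ g) n                         ∎
    where open ≡-Reasoning

  qtimes-cong : ∀ {f g} → f ≈ g → qtimes f ≈ qtimes g
  qtimes-cong e zero    = refl
  qtimes-cong e (suc n) = e n

  qpow : ℕ → Series
  qpow zero    = one
  qpow (suc k) = qtimes (qpow k)

  qpow-+ : ∀ a b → qpow (a ℕ.+ b) ≈ qpow a ⊗ qpow b
  qpow-+ zero    b = ≈-sym (⊗-identityˡ (qpow b))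
  qpow-+ (suc a) b = ≈-trans (qtimes-cong (qpow-+ a b)) (≈-sym (qtimes-⊗ (qpow a) (qpow b)))

  qtimes≈qpow : ∀ f → qtimes f ≈ qpow 1 ⊗ f
  qtimes≈qpow f = ≈-trans (qtimes-cong (≈-sym (⊗-identityˡ f))) (≈-sym (qtimes-⊗ one f))

  ⊘-≈-qtimes-⊘ : ∀ {n d u v} → d 0 ≢ 0ℚ → v 0 ≢ 0ℚ → n ⊗ v ≈ qpow 1 ⊗ (d ⊗ u) → n ⊘ d ≈ qtimes (u ⊘ v)
  ⊘-≈-qtimes-⊘ {n} {d} {u} {v} d0 v0 e = begin
    n ⊗ inv d                                       ≈⟨ ⊗-identityˡ (n ⊗ inv d) ⟨
    one ⊗ (n ⊗ inv d)                               ≈⟨ ⊗-congʳ {g = n ⊗ inv d} (⊗-inv v v0) ⟨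
    (v ⊗ inv v) ⊗ (n ⊗ inv d)                       ≈⟨ solve 4 (λ v v′ n d′ → (v :* v′) :* (n :* d′) := (n :* v) :* (v′ :* d′)) ≈-refl v (inv v) n (inv d) ⟩
    (n ⊗ v) ⊗ (inv v ⊗ inv d)                       ≈⟨ ⊗-congʳ {g = inv v ⊗ inv d} e ⟩
    (qpow 1 ⊗ (d ⊗ u)) ⊗ (inv v ⊗ inv d)            ≈⟨ solve 5 (λ q d u v′ d′ → (q :* (d :* u)) :* (v′ :* d′) := (d :* d′) :* (q :* (u :* v′))) ≈-refl (qpow 1) d u (inv v) (inv d) ⟩
    (d ⊗ inv d) ⊗ (qpow 1 ⊗ (u ⊗ inv v))            ≈⟨ ⊗-congʳ {g = qpow 1 ⊗ (u ⊗ inv v)} (⊗-inv d d0) ⟩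
    one ⊗ (qpow 1 ⊗ (u ⊗ inv v))                    ≈⟨ ⊗-identityˡ (qpow 1 ⊗ (u ⊗ inv v)) ⟩
    qpow 1 ⊗ (u ⊗ inv v)                            ≈⟨ qtimes≈qpow (u ⊗ inv v) ⟨
    qtimes (u ⊗ inv v)                              ∎
    where
    open ≈-Reasoning
    open SR

-- Graded sets with finite fibres and their generating series.

module GradedSets where

  open ≡ using (_≡_; refl; sym; trans; cong; cong₂; subst; module ≡-Reasoning)
  open import Data.Rational using (_+_; _*_)
  open SeriesAlgebra

  ι : ℕ → ℚ
  ι n = + n ℚ./ 1

  toℚᵘ-ι : ∀ n → ℚ.toℚᵘ (ι n) ℚᵘ.≃ ℚᵘ.mkℚᵘ (+ n) 0
  toℚᵘ-ι n = ℚP.toℚᵘ-fromℚᵘ (ℚᵘ.mkℚᵘ (+ n) 0)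

  ι-+ : ∀ m n → ι (m ℕ.+ n) ≡ ι m + ι n
  ι-+ m n = ℚP.toℚᵘ-injective (begin
    ℚ.toℚᵘ (ι (m ℕ.+ n))                      ≈⟨ toℚᵘ-ι (m ℕ.+ n) ⟩
    ℚᵘ.mkℚᵘ (+ (m ℕ.+ n)) 0                   ≈⟨ ℚᵘ.*≡* (cong (ℤ._* + 1) (sym (cong₂ ℤ._+_ (ℤP.*-identityʳ (+ m)) (ℤP.*-identityʳ (+ n))))) ⟩
    ℚᵘ.mkℚᵘ (+ m) 0 ℚᵘ.+ ℚᵘ.mkℚᵘ (+ n) 0      ≈⟨ ℚᵘP.+-cong (toℚᵘ-ι m) (toℚᵘ-ι n) ⟨
    ℚ.toℚᵘ (ι m) ℚᵘ.+ ℚ.toℚᵘ (ι n)            ≈⟨ ℚP.toℚᵘ-homo-+ (ι m) (ι n) ⟨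
    ℚ.toℚᵘ (ι m + ι n)                        ∎)
    where open import Relation.Binary.Reasoning.Setoid ℚᵘP.≃-setoid

  ι-* : ∀ m n → ι (m ℕ.* n) ≡ ι m * ι n
  ι-* m n = ℚP.toℚᵘ-injective (begin
    ℚ.toℚᵘ (ι (m ℕ.* n))                      ≈⟨ toℚᵘ-ι (m ℕ.* n) ⟩
    ℚᵘ.mkℚᵘ (+ (m ℕ.* n)) 0                   ≈⟨ ℚᵘ.*≡* (cong (ℤ._* + 1) (ℤP.pos-* m n)) ⟩
    ℚᵘ.mkℚᵘ (+ m) 0 ℚᵘ.* ℚᵘ.mkℚᵘ (+ n) 0      ≈⟨ ℚᵘP.*-cong (toℚᵘ-ι m) (toℚᵘ-ι n) ⟨
    ℚ.toℚᵘ (ι m) ℚᵘ.* ℚ.toℚᵘ (ι n)            ≈⟨ ℚP.toℚᵘ-homo-* (ι m) (ι n) ⟨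
    ℚ.toℚᵘ (ι m * ι n)                        ∎)
    where open import Relation.Binary.Reasoning.Setoid ℚᵘP.≃-setoid

  length-unique-≡ : ∀ {A : Set} {xs ys : List A} → Unique xs → Unique ys →
                    (∀ {x} → x ∈ xs → x ∈ ys) → (∀ {x} → x ∈ ys → x ∈ xs) → length xs ≡ length ys
  length-unique-≡ u v f g = ↭-length (∼bag⇒↭ (unique∧set⇒bag u v (mk⇔ f g)))

  -- Degrees are integers, so that invariance under a bijection is a polynomial identity over ℤ
  -- within reach of the solver. Nonnegativity is kept as a separate field: it makes the fibres of a
  -- product finite.
  record Graded : Set₁ where
    field
      Point         : Set
      deg           : Point → ℤ
      enum          : ℕ → List Point
      enum-unique   : ∀ N → Unique (enum N)
      enum-sound    : ∀ {N x} → x ∈ enum N → deg x ≡ + N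
      enum-complete : ∀ {N x} → deg x ≡ + N → x ∈ enum N
      deg-nonneg    : ∀ x → ∃ λ N → deg x ≡ + N

    count : ℕ → ℕ
    count N = length (enum N)

  open Graded public

  gen : Graded → Series
  gen G N = ι (count G N)

  infix 0 _↔_
  record _↔_ (A B : Set) : Set where
    field
      to      : A → B
      from    : B → A
      to∘from : ∀ y → to (from y) ≡ y
      from∘to : ∀ x → from (to x) ≡ x

  open _↔_ public

  ↔-sym : ∀ {A B} → A ↔ B → B ↔ A
  ↔-sym b = record { to = from b ; from = to b ; to∘from = from∘to b ; from∘to = to∘from b }

  ↔-trans : ∀ {A B C} → A ↔ B → B ↔ C → A ↔ C
  ↔-trans b c = record
    { to = λ x → to c (to b x) ; from = λ z → from b (from c z)
    ; to∘from = λ z → trans (cong (to c) (to∘from b (from c z))) (to∘from c z)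
    ; from∘to = λ x → trans (cong (from b) (from∘to c (to b x))) (from∘to b x) }

  count-↔ : ∀ G H (b : Point G ↔ Point H) → (∀ x → deg H (to b x) ≡ deg G x) → ∀ N → count G N ≡ count H N
  count-↔ G H b e N = begin
    length (enum G N)                 ≡⟨ ListP.length-map (to b) (enum G N) ⟨
    length (map (to b) (enum G N))    ≡⟨ length-unique-≡ (UniqueP.map⁺ to-injective (enum-unique G N)) (enum-unique H N) image preimage ⟩
    length (enum H N)                 ∎
    where
    open ≡-Reasoning
    to-injective : ∀ {x y} → to b x ≡ to b y → x ≡ y
    to-injective {x} {y} p = trans (sym (from∘to b x)) (trans (cong (from b) p) (from∘to b y))
    image : ∀ {y} → y ∈ map (to b) (enum G N) → y ∈ enum H N
    image y∈ with ∈P.∈-map⁻ (to b) y∈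
    ... | x , x∈ , refl = enum-complete H (trans (e x) (enum-sound G x∈))
    preimage : ∀ {y} → y ∈ enum H N → y ∈ map (to b) (enum G N)
    preimage {y} y∈ = subst (_∈ map (to b) (enum G N)) (to∘from b y)
      (∈P.∈-map⁺ (to b) (enum-complete G
        (trans (sym (e (from b y))) (trans (cong (deg H) (to∘from b y)) (enum-sound H y∈)))))

  gen-↔ : ∀ G H (b : Point G ↔ Point H) → (∀ x → deg H (to b x) ≡ deg G x) → gen G ≈ gen H
  gen-↔ G H b e N = cong ι (count-↔ G H b e N)

  searchGraded : (A : Set) (d : A → ℤ) (box : ℕ → List A) → (∀ N → Unique (box N)) →
                 (∀ {N x} → d x ≡ + N → x ∈ box N) → (∀ x → ∃ λ N → d x ≡ + N) → Graded
  searchGraded A d box box-unique box-complete nonneg = record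
    { Point = A ; deg = d
    ; enum = λ N → filter (λ x → d x ℤ.≟ + N) (box N)
    ; enum-unique = λ N → UniqueP.filter⁺ (λ x → d x ℤ.≟ + N) (box-unique N)
    ; enum-sound = λ {N} x∈ → proj₂ (∈P.∈-filter⁻ (λ x → d x ℤ.≟ + N) {xs = box N} x∈)
    ; enum-complete = λ {N} dx≡N → ∈P.∈-filter⁺ (λ x → d x ℤ.≟ + N) (box-complete dx≡N) dx≡N
    ; deg-nonneg = nonneg }

  -- As a factor of a product, this one-point set represents multiplication by qᵏ.
  pointGraded : ℕ → Graded
  pointGraded k = searchGraded ⊤ (λ _ → + k) (λ _ → tt ∷ []) (λ _ → [] ∷ []) (λ _ → here refl) (λ _ → k , refl)

  gen-point : ∀ k → gen (pointGraded k) ≈ qpow k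
  gen-point zero    zero    = refl
  gen-point zero    (suc n) = refl
  gen-point (suc k) zero    = refl
  gen-point (suc k) (suc n) = trans (cong ι (same (k ℕ.≟ n))) (gen-point k n)
    where
    same : Dec (k ≡ n) → count (pointGraded (suc k)) (suc n) ≡ count (pointGraded k) n
    same (yes refl) = cong length (trans (ListP.filter-accept (λ _ → + suc k ℤ.≟ + suc k) {tt} {[]} refl)
                                        (sym (ListP.filter-accept (λ _ → + k ℤ.≟ + k) {tt} {[]} refl)))
    same (no k≢n)   = cong length (trans (ListP.filter-reject (λ _ → + suc k ℤ.≟ + suc n) {tt} {[]} (k≢n ∘ ℕP.suc-injective ∘ ℤP.+-injective))
                                        (sym (ListP.filter-reject (λ _ → + k ℤ.≟ + n) {tt} {[]} (k≢n ∘ ℤP.+-injective))))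

  infixr 1 _⊎ᵍ_
  _⊎ᵍ_ : Graded → Graded → Graded
  G ⊎ᵍ H = record
    { Point = Point G ⊎ Point H
    ; deg = [ deg G , deg H ]′
    ; enum = λ N → map inj₁ (enum G N) ++ map inj₂ (enum H N)
    ; enum-unique = λ N → UniqueP.++⁺ (UniqueP.map⁺ inj₁-injective (enum-unique G N))
                                      (UniqueP.map⁺ inj₂-injective (enum-unique H N)) disjoint
    ; enum-sound = λ {N} x∈ → sound N x∈
    ; enum-complete = λ {N} {x} → complete N x
    ; deg-nonneg = λ { (inj₁ x) → deg-nonneg G x ; (inj₂ y) → deg-nonneg H y } }
    where
    disjoint : ∀ {N} {v : Point G ⊎ Point H} → ¬ (v ∈ map inj₁ (enum G N) × v ∈ map inj₂ (enum H N))
    disjoint (p , q) with ∈P.∈-map⁻ inj₁ p | ∈P.∈-map⁻ inj₂ q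
    ... | _ , _ , refl | _ , _ , ()
    sound : ∀ N {x} → x ∈ map inj₁ (enum G N) ++ map inj₂ (enum H N) → [ deg G , deg H ]′ x ≡ + N
    sound N x∈ with ∈P.∈-++⁻ (map inj₁ (enum G N)) x∈
    ... | inj₁ p with ∈P.∈-map⁻ inj₁ p
    ...   | _ , y∈ , refl = enum-sound G y∈
    sound N x∈ | inj₂ p with ∈P.∈-map⁻ inj₂ p
    ...   | _ , y∈ , refl = enum-sound H y∈
    complete : ∀ N x → [ deg G , deg H ]′ x ≡ + N → x ∈ map inj₁ (enum G N) ++ map inj₂ (enum H N)
    complete N (inj₁ x) e = ∈P.∈-++⁺ˡ (∈P.∈-map⁺ inj₁ (enum-complete G e))
    complete N (inj₂ y) e = ∈P.∈-++⁺ʳ (map inj₁ (enum G N)) (∈P.∈-map⁺ inj₂ (enum-complete H e))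

  gen-⊎ : ∀ G H → gen (G ⊎ᵍ H) ≈ gen G ⊕ gen H
  gen-⊎ G H N = begin
    ι (length (map inj₁ (enum G N) ++ map inj₂ (enum H N)))    ≡⟨ cong ι (ListP.length-++ (map inj₁ (enum G N))) ⟩
    ι (length (map inj₁ (enum G N)) ℕ.+ length (map inj₂ (enum H N)))
      ≡⟨ cong₂ (λ a b → ι (a ℕ.+ b)) (ListP.length-map inj₁ (enum G N)) (ListP.length-map inj₂ (enum H N)) ⟩
    ι (count G N ℕ.+ count H N)                                ≡⟨ ι-+ (count G N) (count H N) ⟩
    ι (count G N) + ι (count H N)                              ∎
    where open ≡-Reasoning

  length-cartesianProduct : ∀ {A B : Set} (xs : List A) (ys : List B) →
                            length (cartesianProduct xs ys) ≡ length xs ℕ.* length ys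
  length-cartesianProduct []       ys = refl
  length-cartesianProduct (x ∷ xs) ys = trans (ListP.length-++ (map (x ,_) ys))
    (cong₂ ℕ._+_ (ListP.length-map (x ,_) ys) (length-cartesianProduct xs ys))

  module _ (G H : Graded) where
    private
      P = Point G × Point H

      sumDeg : P → ℤ
      sumDeg (x , y) = deg G x ℤ.+ deg H y

      block : ℕ → ℕ → List P
      block N k = cartesianProduct (enum G k) (enum H (N ℕ.∸ k))

      -- The fibre of the product is grouped by the degree of the first component, in the order of
      -- `sumTo`; `gen-×` is then an induction over the same index.
      blocks : ℕ → ℕ → List P
      blocks N zero    = block N zero
      blocks N (suc m) = blocks N m ++ block N (suc m)

      ∈-blocks⁻ : ∀ N m {p} → p ∈ blocks N m → ∃ λ k → k ℕ.≤ m × proj₁ p ∈ enum G k × proj₂ p ∈ enum H (N ℕ.∸ k)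
      ∈-blocks⁻ N zero    p∈ = 0 , z≤n , ∈P.∈-cartesianProduct⁻ (enum G 0) _ p∈
      ∈-blocks⁻ N (suc m) p∈ with ∈P.∈-++⁻ (blocks N m) p∈
      ... | inj₁ q = let (k , k≤m , r) = ∈-blocks⁻ N m q in k , ℕP.m≤n⇒m≤1+n k≤m , r
      ... | inj₂ q = suc m , ℕP.≤-refl , ∈P.∈-cartesianProduct⁻ (enum G (suc m)) _ q

      ∈-blocks⁺ : ∀ N m k {p} → k ℕ.≤ m → p ∈ block N k → p ∈ blocks N m
      ∈-blocks⁺ N zero    zero    _   p∈ = p∈
      ∈-blocks⁺ N (suc m) k       k≤m p∈ with ℕP.m≤n⇒m<n∨m≡n k≤m
      ... | inj₁ (s≤s k≤m′) = ∈P.∈-++⁺ˡ (∈-blocks⁺ N m k k≤m′ p∈)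
      ... | inj₂ refl       = ∈P.∈-++⁺ʳ (blocks N m) p∈

      block-unique : ∀ N k → Unique (block N k)
      block-unique N k = UniqueP.cartesianProduct⁺ (enum-unique G k) (enum-unique H (N ℕ.∸ k))

      blocks-unique : ∀ N m → Unique (blocks N m)
      blocks-unique N zero    = block-unique N zero
      blocks-unique N (suc m) = UniqueP.++⁺ (blocks-unique N m) (block-unique N (suc m)) disjoint
        where
        disjoint : ∀ {v} → ¬ (v ∈ blocks N m × v ∈ block N (suc m))
        disjoint (p , q) with ∈-blocks⁻ N m p
        ... | k , k≤m , x∈ , _ = ℕP.<-irrefl (ℤP.+-injective
                (trans (sym (enum-sound G x∈)) (enum-sound G (proj₁ (∈P.∈-cartesianProduct⁻ (enum G (suc m)) _ q)))))
                (s≤s k≤m)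

      complete : ∀ {N p} → sumDeg p ≡ + N → p ∈ blocks N N
      complete {N} {x , y} e with deg-nonneg G x | deg-nonneg H y
      ... | a , ea | b , eb = ∈-blocks⁺ N N a a≤N
              (∈P.∈-cartesianProduct⁺ (enum-complete G ea) (enum-complete H (trans eb (cong +_ b≡))))
        where
        a+b≡N : a ℕ.+ b ≡ N
        a+b≡N = ℤP.+-injective (trans (sym (cong₂ ℤ._+_ ea eb)) e)
        a≤N = subst (a ℕ.≤_) a+b≡N (ℕP.m≤m+n a b)
        b≡ : b ≡ N ℕ.∸ a
        b≡ = trans (sym (ℕP.m+n∸m≡n a b)) (cong (ℕ._∸ a) a+b≡N)

      sound : ∀ {N p} → p ∈ blocks N N → sumDeg p ≡ + N
      sound {N} p∈ with ∈-blocks⁻ N N p∈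
      ... | k , k≤N , x∈ , y∈ = trans (cong₂ ℤ._+_ (enum-sound G x∈) (enum-sound H y∈)) (cong +_ (ℕP.m+[n∸m]≡n k≤N))

    infixr 2 _×ᵍ_
    _×ᵍ_ : Graded
    _×ᵍ_ = record
      { Point = P ; deg = sumDeg
      ; enum = λ N → blocks N N
      ; enum-unique = λ N → blocks-unique N N
      ; enum-sound = sound
      ; enum-complete = complete
      ; deg-nonneg = λ { (x , y) → let (a , ea) = deg-nonneg G x ; (b , eb) = deg-nonneg H y
                                   in a ℕ.+ b , cong₂ ℤ._+_ ea eb } }

    gen-× : gen _×ᵍ_ ≈ gen G ⊗ gen H
    gen-× N = go N
      where
      go : ∀ m → ι (length (blocks N m)) ≡ sumTo m (λ k → gen G k * gen H (N ℕ.∸ k))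
      block-length : ∀ k → ι (length (block N k)) ≡ gen G k * gen H (N ℕ.∸ k)
      block-length k = trans (cong ι (length-cartesianProduct (enum G k) (enum H (N ℕ.∸ k))))
                             (ι-* (count G k) (count H (N ℕ.∸ k)))
      go zero    = block-length zero
      go (suc m) = begin
        ι (length (blocks N m ++ block N (suc m)))                   ≡⟨ cong ι (ListP.length-++ (blocks N m)) ⟩
        ι (length (blocks N m) ℕ.+ length (block N (suc m)))         ≡⟨ ι-+ (length (blocks N m)) (length (block N (suc m))) ⟩
        ι (length (blocks N m)) + ι (length (block N (suc m)))       ≡⟨ cong₂ _+_ (go m) (block-length (suc m)) ⟩
        sumTo (suc m) (λ k → gen G k * gen H (N ℕ.∸ k))              ∎
        where open ≡-Reasoning

  lefts : ∀ {A B : Set} → List (A ⊎ B) → List A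
  lefts []            = []
  lefts (inj₁ x ∷ xs) = x ∷ lefts xs
  lefts (inj₂ _ ∷ xs) = lefts xs

  ∈-lefts⁺ : ∀ {A B : Set} {x : A} (xs : List (A ⊎ B)) → inj₁ x ∈ xs → x ∈ lefts xs
  ∈-lefts⁺ (inj₁ _ ∷ xs) (here refl) = here refl
  ∈-lefts⁺ (inj₁ _ ∷ xs) (there p)   = there (∈-lefts⁺ xs p)
  ∈-lefts⁺ (inj₂ _ ∷ xs) (there p)   = ∈-lefts⁺ xs p

  ∈-lefts⁻ : ∀ {A B : Set} {x : A} (xs : List (A ⊎ B)) → x ∈ lefts xs → inj₁ x ∈ xs
  ∈-lefts⁻ (inj₁ _ ∷ xs) (here refl) = here refl
  ∈-lefts⁻ (inj₁ _ ∷ xs) (there p)   = there (∈-lefts⁻ xs p)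
  ∈-lefts⁻ (inj₂ _ ∷ xs) p           = there (∈-lefts⁻ xs p)

  lefts-unique : ∀ {A B : Set} (xs : List (A ⊎ B)) → Unique xs → Unique (lefts xs)
  lefts-unique []            []       = []
  lefts-unique (inj₁ x ∷ xs) (p ∷ ps) =
    All.tabulate (λ y∈ x≡y → All.lookup p (∈-lefts⁻ xs y∈) (cong inj₁ x≡y)) ∷ lefts-unique xs ps
  lefts-unique (inj₂ _ ∷ xs) (p ∷ ps) = lefts-unique xs ps

  -- The part has `A` itself as its set of points instead of a subtype of `Point G`, so the
  -- bijections applied to it later are plain changes of coordinates.
  leftPart : ∀ {A B : Set} (G : Graded) → Point G ↔ A ⊎ B → Graded
  leftPart {A} G b = record
    { Point = A
    ; deg = λ x → deg G (from b (inj₁ x))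
    ; enum = λ N → lefts (map (to b) (enum G N))
    ; enum-unique = λ N → lefts-unique _ (UniqueP.map⁺ to-injective (enum-unique G N))
    ; enum-sound = λ {N} x∈ → sound N x∈
    ; enum-complete = λ {N} e → ∈-lefts⁺ _ (subst (_∈ map (to b) (enum G N)) (to∘from b _)
                                  (∈P.∈-map⁺ (to b) (enum-complete G e)))
    ; deg-nonneg = λ x → deg-nonneg G (from b (inj₁ x)) }
    where
    to-injective : ∀ {x y} → to b x ≡ to b y → x ≡ y
    to-injective {x} {y} p = trans (sym (from∘to b x)) (trans (cong (from b) p) (from∘to b y))
    sound : ∀ N {x} → x ∈ lefts (map (to b) (enum G N)) → deg G (from b (inj₁ x)) ≡ + N
    sound N x∈ with ∈P.∈-map⁻ (to b) (∈-lefts⁻ (map (to b) (enum G N)) x∈)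
    ... | y , y∈ , e = trans (cong (deg G) (trans (cong (from b) e) (from∘to b y))) (enum-sound G y∈)

  swap↔ : ∀ {A B : Set} → A ⊎ B ↔ B ⊎ A
  swap↔ = record { to = swap ; from = swap ; to∘from = swap-involutive ; from∘to = swap-involutive }

  rightPart : ∀ {A B : Set} (G : Graded) → Point G ↔ A ⊎ B → Graded
  rightPart G b = leftPart G (↔-trans b swap↔)

  gen-parts : ∀ {A B : Set} G (b : Point G ↔ A ⊎ B) → gen G ≈ gen (leftPart G b) ⊕ gen (rightPart G b)
  gen-parts G b = ≈-trans
    (gen-↔ G (leftPart G b ⊎ᵍ rightPart G b) b (λ x → trans (aux (to b x)) (cong (deg G) (from∘to b x))))
    (gen-⊎ (leftPart G b) (rightPart G b))
    where
    aux : ∀ y → deg (leftPart G b ⊎ᵍ rightPart G b) y ≡ deg G (from b y)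
    aux (inj₁ _) = refl
    aux (inj₂ _) = refl

-- Theta series as counts of lattice points.

module Lattices where

  open ≡ using (_≡_; refl; sym; trans; cong; cong₂; subst; module ≡-Reasoning)
  open import Data.Integer using (∣_∣; _+_; _*_; -_; _-_)
  open +-*-Solver using (solve; _:=_; _:+_; _:*_; _:-_; :-_; con; Polynomial)
  open SeriesAlgebra
  open GradedSets

  open AbelianGroupProperties ℤP.+-0-abelianGroup using () renaming (∙-cancelʳ to +ℤ-cancelʳ)

  intRange-unique : ∀ K → Unique (intRange K)
  intRange-unique K = UniqueP.map⁺ (λ {i} {j} e → ℤP.+-injective (+ℤ-cancelʳ (- + K) (+ i) (+ j) e))
                                   (UniqueP.upTo⁺ (suc (K ℕ.+ K)))

  ∈-intRange : ∀ K x → ∣ x ∣ ℕ.≤ K → x ∈ intRange K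
  ∈-intRange K x ∣x∣≤K = subst (_∈ intRange K) shifted (∈P.∈-map⁺ (λ i → + i - + K) (∈P.∈-upTo⁺ (s≤s i≤2K)))
    where
    i = ∣ x + + K ∣
    0≤x+K : + 0 ℤ.≤ x + + K
    0≤x+K = subst (ℤ._≤ x + + K) (ℤP.+-inverseˡ (+ K))
              (ℤP.+-monoˡ-≤ (+ K) (ℤP.≤-trans (ℤP.neg-mono-≤ (ℤ.+≤+ ∣x∣≤K)) (lower x)))
      where
      lower : ∀ y → - + ∣ y ∣ ℤ.≤ y
      lower (+ zero)   = ℤP.≤-refl
      lower (+ suc n)  = ℤ.-≤+
      lower -[1+ n ]   = ℤP.≤-refl
    i≤2K : i ℕ.≤ K ℕ.+ K
    i≤2K = ℕP.≤-trans (ℤP.∣i+j∣≤∣i∣+∣j∣ x (+ K)) (ℕP.+-monoˡ-≤ K ∣x∣≤K)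
    shifted : + i - + K ≡ x
    shifted = trans (cong (_- + K) (ℤP.0≤i⇒+∣i∣≡i 0≤x+K)) (solve 2 (λ x k → x :+ k :- k := x) refl x (+ K))

  concatMap≡cartesianProduct : ∀ {A B : Set} (xs : List A) (ys : List B) →
    concatMap (λ x → map (x ,_) ys) xs ≡ cartesianProduct xs ys
  concatMap≡cartesianProduct []       ys = refl
  concatMap≡cartesianProduct (x ∷ xs) ys = cong (map (x ,_) ys ++_) (concatMap≡cartesianProduct xs ys)

  -- The same expression as in `reps`, so that `theta` is `gen` of a searched form by computation.
  box : ℕ → List (ℤ × ℤ)
  box K = concatMap (λ n → map (n ,_) (intRange K)) (intRange K)

  box-unique : ∀ K → Unique (box K)
  box-unique K = subst Unique (sym (concatMap≡cartesianProduct (intRange K) (intRange K)))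
                   (UniqueP.cartesianProduct⁺ (intRange-unique K) (intRange-unique K))

  ∈-box : ∀ K {n m} → ∣ n ∣ ℕ.≤ K → ∣ m ∣ ℕ.≤ K → (n , m) ∈ box K
  ∈-box K {n} {m} p q = subst ((n , m) ∈_) (sym (concatMap≡cartesianProduct (intRange K) (intRange K)))
                   (∈P.∈-cartesianProduct⁺ (∈-intRange K n p) (∈-intRange K m q))

  sq : ℤ → ℕ
  sq x = ∣ x ∣ ℕ.* ∣ x ∣

  x*x≡+sq : ∀ x → x * x ≡ + sq x
  x*x≡+sq (+ n)    = sym (ℤP.pos-* n n)
  x*x≡+sq -[1+ n ] = refl

  ∣x∣≤sq : ∀ x → ∣ x ∣ ℕ.≤ sq x
  ∣x∣≤sq x = n≤n*n ∣ x ∣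
    where
    n≤n*n : ∀ n → n ℕ.≤ n ℕ.* n
    n≤n*n zero    = z≤n
    n≤n*n (suc n) = ℕP.m≤m*n (suc n) (suc n)

  -- The scale 0 is replaced by 1, so that every theta series below is defined.
  ⟨_⟩ : ℕ → ℕ
  ⟨ s ⟩ = suc (ℕ.pred s)

  -- ψ(q) = Σ_{n ≥ 0} q^(n(n+1)/2) is indexed by k ∈ ℤ through q^(2k²+k).
  φDeg ψDeg : ℕ → ℤ → ℤ
  φDeg s n = + ⟨ s ⟩ * (n * n)
  ψDeg s k = + ⟨ s ⟩ * (+ 2 * (k * k) + k)

  φDeg-value : ∀ s n → φDeg s n ≡ + (⟨ s ⟩ ℕ.* sq n)
  φDeg-value s n = trans (cong (+ ⟨ s ⟩ *_) (x*x≡+sq n)) (sym (ℤP.pos-* ⟨ s ⟩ (sq n)))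

  triangular : ℤ → ℕ
  triangular (+ n)    = n ℕ.* suc (n ℕ.+ n)
  triangular -[1+ n ] = suc n ℕ.* suc (n ℕ.+ n)

  ∣k∣≤triangular : ∀ k → ∣ k ∣ ℕ.≤ triangular k
  ∣k∣≤triangular (+ n)    = ℕP.m≤m*n n (suc (n ℕ.+ n))
  ∣k∣≤triangular -[1+ n ] = ℕP.m≤m*n (suc n) (suc (n ℕ.+ n))

  ψDeg-value : ∀ s k → ψDeg s k ≡ + (⟨ s ⟩ ℕ.* triangular k)
  ψDeg-value s k = trans (cong (+ ⟨ s ⟩ *_) (value k)) (sym (ℤP.pos-* ⟨ s ⟩ (triangular k)))
    where
    value : ∀ k → + 2 * (k * k) + k ≡ + triangular k
    value (+ n)    = trans (solve 1 (λ n → con (+ 2) :* (n :* n) :+ n := n :* (con (+ 1) :+ (n :+ n))) refl (+ n))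
                           (sym (ℤP.pos-* n (suc (n ℕ.+ n))))
    value -[1+ n ] = trans (solve 1 (λ n → con (+ 2) :* (:- (con (+ 1) :+ n) :* :- (con (+ 1) :+ n)) :+ :- (con (+ 1) :+ n)
                                      := (con (+ 1) :+ n) :* (con (+ 1) :+ (n :+ n))) refl (+ n))
                           (sym (ℤP.pos-* (suc n) (suc (n ℕ.+ n))))

  φ : ℕ → Graded
  φ s = searchGraded ℤ (φDeg s) intRange intRange-unique complete (λ n → _ , φDeg-value s n)
    where
    complete : ∀ {N n} → φDeg s n ≡ + N → n ∈ intRange N
    complete {N} {n} e = ∈-intRange N n (ℕP.≤-trans (∣x∣≤sq n)
      (subst (sq n ℕ.≤_) (ℤP.+-injective (trans (sym (φDeg-value s n)) e)) (ℕP.m≤n*m (sq n) ⟨ s ⟩)))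

  ψ : ℕ → Graded
  ψ s = searchGraded ℤ (ψDeg s) intRange intRange-unique complete (λ k → _ , ψDeg-value s k)
    where
    complete : ∀ {N k} → ψDeg s k ≡ + N → k ∈ intRange N
    complete {N} {k} e = ∈-intRange N k (ℕP.≤-trans (∣k∣≤triangular k)
      (subst (triangular k ℕ.≤_) (ℤP.+-injective (trans (sym (ψDeg-value s k)) e)) (ℕP.m≤n*m (triangular k) ⟨ s ⟩)))

  -- The norm form of the maximal order of ℚ(√-7).
  form : ℤ → ℤ → ℤ
  form j m = j * j + j * m + + 2 * (m * m)

  θDeg : ℕ → ℤ × ℤ → ℤ
  θDeg s (j , m) = + ⟨ s ⟩ * form j m

  half-nonneg : ∀ i M → + 2 * i ≡ + M → ∃ λ N → i ≡ + N
  half-nonneg (+ n)    M e = n , refl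
  half-nonneg -[1+ n ] M ()

  -- Positivity is seen on twice the form, which is (j + m)² + j² + 3m²; hence the radius 2N of the
  -- box.
  θ : ℕ → Graded
  θ s = searchGraded (ℤ × ℤ) (θDeg s) (λ N → box (2 ℕ.* N)) (λ N → box-unique (2 ℕ.* N)) complete nonneg
    where
    squares : ℤ → ℤ → ℕ
    squares j m = sq (j + m) ℕ.+ sq j ℕ.+ 3 ℕ.* sq m
    value : ∀ j m → + 2 * form j m ≡ + squares j m
    value j m = trans
      (solve 2 (λ j m → con (+ 2) :* (j :* j :+ j :* m :+ con (+ 2) :* (m :* m))
                     := (j :+ m) :* (j :+ m) :+ j :* j :+ con (+ 3) :* (m :* m)) refl j m)
      (cong₂ _+_ (cong₂ _+_ (x*x≡+sq (j + m)) (x*x≡+sq j))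
                 (trans (cong (+ 3 *_) (x*x≡+sq m)) (sym (ℤP.pos-* 3 (sq m)))))
    nonneg : ∀ p → ∃ λ N → θDeg s p ≡ + N
    nonneg (j , m) = let (N , e) = half-nonneg (form j m) (squares j m) (value j m)
                     in ⟨ s ⟩ ℕ.* N , trans (cong (+ ⟨ s ⟩ *_) e) (sym (ℤP.pos-* ⟨ s ⟩ N))
    complete : ∀ {N p} → θDeg s p ≡ + N → p ∈ box (2 ℕ.* N)
    complete {N} {j , m} e = ∈-box (2 ℕ.* N)
        (ℕP.≤-trans (∣x∣≤sq j) (ℕP.≤-trans (ℕP.m≤n+m (sq j) (sq (j + m))) (ℕP.≤-trans (ℕP.m≤m+n _ (3 ℕ.* sq m)) bound)))
        (ℕP.≤-trans (∣x∣≤sq m) (ℕP.≤-trans (ℕP.m≤n*m (sq m) 3) (ℕP.≤-trans (ℕP.m≤n+m (3 ℕ.* sq m) (sq (j + m) ℕ.+ sq j)) bound)))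
      where
      scaled : ⟨ s ⟩ ℕ.* squares j m ≡ 2 ℕ.* N
      scaled = ℤP.+-injective (begin
        + (⟨ s ⟩ ℕ.* squares j m)        ≡⟨ ℤP.pos-* ⟨ s ⟩ (squares j m) ⟩
        + ⟨ s ⟩ * + squares j m          ≡⟨ cong (+ ⟨ s ⟩ *_) (value j m) ⟨
        + ⟨ s ⟩ * (+ 2 * form j m)       ≡⟨ solve 2 (λ s f → s :* (con (+ 2) :* f) := con (+ 2) :* (s :* f)) refl (+ ⟨ s ⟩) (form j m) ⟩
        + 2 * (+ ⟨ s ⟩ * form j m)       ≡⟨ cong (+ 2 *_) e ⟩
        + 2 * + N                        ≡⟨ ℤP.pos-* 2 N ⟨
        + (2 ℕ.* N)                      ∎)
        where open ≡-Reasoning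
      bound : squares j m ℕ.≤ 2 ℕ.* N
      bound = subst (squares j m ℕ.≤_) scaled (ℕP.m≤n*m (squares j m) ⟨ s ⟩)

  -- `squares` is a certificate of definiteness: a natural number equal to the value of the form and
  -- bounding both coordinates, which places all solutions in the box of `reps`.
  binaryForm : ∀ a b c (squares : ℤ → ℤ → ℕ) →
    (∀ n m → qform a b c (n , m) ≡ + squares n m) →
    (∀ n m → ∣ n ∣ ℕ.≤ squares n m) → (∀ n m → ∣ m ∣ ℕ.≤ squares n m) →
    (∀ N → N ℕ.≤ 4 ℕ.* (a ℕ.+ c) ℕ.* N) → Graded
  binaryForm a b c squares value n≤ m≤ N≤K =
    searchGraded (ℤ × ℤ) (qform a b c) (λ N → box (4 ℕ.* (a ℕ.+ c) ℕ.* N)) (λ N → box-unique (4 ℕ.* (a ℕ.+ c) ℕ.* N))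
      complete (λ { (n , m) → squares n m , value n m })
    where
    complete : ∀ {N p} → qform a b c p ≡ + N → p ∈ box (4 ℕ.* (a ℕ.+ c) ℕ.* N)
    complete {N} {n , m} e = ∈-box _ (ℕP.≤-trans (n≤ n m) squares≤K) (ℕP.≤-trans (m≤ n m) squares≤K)
      where
      squares≤K : squares n m ℕ.≤ 4 ℕ.* (a ℕ.+ c) ℕ.* N
      squares≤K = subst (ℕ._≤ 4 ℕ.* (a ℕ.+ c) ℕ.* N)
                    (sym (ℤP.+-injective (trans (sym (value n m)) e))) (N≤K N)

  diagonalForm : ∀ a c → Graded
  diagonalForm a c = binaryForm (suc a) (+ 0) (suc c) (λ n m → suc a ℕ.* sq n ℕ.+ suc c ℕ.* sq m)
    (λ n m → cong₂ _+_ (trans (ℤP.+-identityʳ (+ suc a * (n * n))) (trans (cong (+ suc a *_) (x*x≡+sq n)) (sym (ℤP.pos-* (suc a) (sq n)))))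
                       (trans (cong (+ suc c *_) (x*x≡+sq m)) (sym (ℤP.pos-* (suc c) (sq m)))))
    (λ n m → ℕP.≤-trans (∣x∣≤sq n) (ℕP.≤-trans (ℕP.m≤n*m (sq n) (suc a)) (ℕP.m≤m+n _ _)))
    (λ n m → ℕP.≤-trans (∣x∣≤sq m) (ℕP.≤-trans (ℕP.m≤n*m (sq m) (suc c)) (ℕP.m≤n+m (suc c ℕ.* sq m) (suc a ℕ.* sq n))))
    (λ N → ℕP.m≤n*m N (4 ℕ.* (suc a ℕ.+ suc c)))

  T : Graded
  T = binaryForm 3 (+ 2) 5 (λ n m → sq (n + m) ℕ.+ (2 ℕ.* sq n ℕ.+ 4 ℕ.* sq m))
    (λ n m → trans
      (solve 2 (λ n m → con (+ 3) :* (n :* n) :+ con (+ 2) :* (n :* m) :+ con (+ 5) :* (m :* m)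
                     := (n :+ m) :* (n :+ m) :+ (con (+ 2) :* (n :* n) :+ con (+ 4) :* (m :* m))) refl n m)
      (cong₂ _+_ (x*x≡+sq (n + m))
        (cong₂ _+_ (trans (cong (+ 2 *_) (x*x≡+sq n)) (sym (ℤP.pos-* 2 (sq n))))
                   (trans (cong (+ 4 *_) (x*x≡+sq m)) (sym (ℤP.pos-* 4 (sq m)))))))
    (λ n m → ℕP.≤-trans (∣x∣≤sq n) (ℕP.≤-trans (ℕP.m≤n*m (sq n) 2)
               (ℕP.≤-trans (ℕP.m≤m+n _ (4 ℕ.* sq m)) (ℕP.m≤n+m _ (sq (n + m))))))
    (λ n m → ℕP.≤-trans (∣x∣≤sq m) (ℕP.≤-trans (ℕP.m≤n*m (sq m) 4)
               (ℕP.≤-trans (ℕP.m≤n+m _ (2 ℕ.* sq n)) (ℕP.m≤n+m _ (sq (n + m))))))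
    (λ N → ℕP.m≤n*m N 32)

  theta≈φφ : ∀ a c → theta (suc a) (+ 0) (suc c) ≈ gen (φ (suc a)) ⊗ gen (φ (suc c))
  theta≈φφ a c = ≈-trans
    (gen-↔ (diagonalForm a c) (φ (suc a) ×ᵍ φ (suc c))
      (record { to = λ p → p ; from = λ p → p ; to∘from = λ _ → refl ; from∘to = λ _ → refl })
      (λ { (n , m) → cong (_+ + suc c * (m * m)) (sym (ℤP.+-identityʳ (+ suc a * (n * n)))) }))
    (gen-× (φ (suc a)) (φ (suc c)))

  doubles-≢-odd : ∀ i → + 2 * i ≡ + 1 → ⊥
  doubles-≢-odd i e = impossible ∣ i ∣ (trans (sym (ℤP.abs-* (+ 2) i)) (cong ∣_∣ e))
    where
    impossible : ∀ n → 2 ℕ.* n ≡ 1 → ⊥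
    impossible (suc n) e with ℕP.suc-injective e
    ... | e′ rewrite ℕP.+-suc n (n ℕ.+ 0) with e′
    ... | ()

  -- The direction `from` computes on variables, while `to` uses division. Parts of a graded set
  -- take their degrees along `from`, so division never reaches the polynomial identities.
  parity : ℤ ↔ ℤ ⊎ ℤ
  parity = record { to = split ; from = join ; to∘from = λ y → join-injective _ y (join∘split (join y)) ; from∘to = join∘split }
    where
    join : ℤ ⊎ ℤ → ℤ
    join (inj₁ k) = + 2 * k
    join (inj₂ k) = + 2 * k + + 1
    classify : ∀ n r → r ℕ.< 2 → ∀ q → n ≡ + r + q * + 2 → ∃ λ y → join y ≡ n
    classify n 0 _ q e = inj₁ q , trans (solve 1 (λ q → con (+ 2) :* q := con (+ 0) :+ q :* con (+ 2)) refl q) (sym e)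
    classify n 1 _ q e = inj₂ q , trans (solve 1 (λ q → con (+ 2) :* q :+ con (+ 1) := con (+ 1) :+ q :* con (+ 2)) refl q) (sym e)
    classify n (suc (suc r)) (s≤s (s≤s ())) q e
    classified : ∀ n → ∃ λ y → join y ≡ n
    classified n = classify n (n ℤD.%ℕ 2) (ℤD.n%ℕd<d n 2) (n ℤD./ℕ 2) (ℤD.a≡a%ℕn+[a/ℕn]*n n 2)
    split : ℤ → ℤ ⊎ ℤ
    split n = proj₁ (classified n)
    join∘split : ∀ n → join (split n) ≡ n
    join∘split n = proj₂ (classified n)
    odd≢even : ∀ k l → + 2 * k ≡ + 2 * l + + 1 → ⊥
    odd≢even k l e = doubles-≢-odd (k - l) (begin
      + 2 * (k - l)                     ≡⟨ solve 2 (λ k l → con (+ 2) :* (k :- l) := con (+ 2) :* k :- con (+ 2) :* l) refl k l ⟩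
      + 2 * k - + 2 * l                 ≡⟨ cong (_- + 2 * l) e ⟩
      + 2 * l + + 1 - + 2 * l           ≡⟨ solve 1 (λ l → con (+ 2) :* l :+ con (+ 1) :- con (+ 2) :* l := con (+ 1)) refl l ⟩
      + 1                               ∎)
      where open ≡-Reasoning
    join-injective : ∀ x y → join x ≡ join y → x ≡ y
    join-injective (inj₁ k) (inj₁ l) e = cong inj₁ (ℤP.*-cancelˡ-≡ (+ 2) k l e)
    join-injective (inj₁ k) (inj₂ l) e = ⊥-elim (odd≢even k l e)
    join-injective (inj₂ k) (inj₁ l) e = ⊥-elim (odd≢even l k (sym e))
    join-injective (inj₂ k) (inj₂ l) e = cong inj₂ (ℤP.*-cancelˡ-≡ (+ 2) k l (+ℤ-cancelʳ (+ 1) _ _ e))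

  private
    module Poly {n : ℕ} where
      infixr 9 _′
      _′ : ℕ → Polynomial n
      c ′ = con (+ c)
      sqᵖ ψᵖ even odd flip : Polynomial n → Polynomial n
      sqᵖ x  = x :* x
      ψᵖ k   = 2 ′ :* (k :* k) :+ k
      even k = 2 ′ :* k
      odd k  = 2 ′ :* k :+ 1 ′
      flip k = :- k :- 1 ′
      formᵖ Tᵖ : Polynomial n → Polynomial n → Polynomial n
      formᵖ j m = j :* j :+ j :* m :+ 2 ′ :* (m :* m)
      Tᵖ n m = 3 ′ :* (n :* n) :+ 2 ′ :* (n :* m) :+ 5 ′ :* (m :* m)
  open Poly

  id↔ : ∀ {A : Set} → A ↔ A
  id↔ = record { to = λ x → x ; from = λ x → x ; to∘from = λ _ → refl ; from∘to = λ _ → refl }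

  -- Negation of the odd number 2k + 1, expressed on `k`.
  flip↔ : ℤ ↔ ℤ
  flip↔ = record { to = flipℤ ; from = flipℤ ; to∘from = involutive ; from∘to = involutive }
    where
    flipℤ : ℤ → ℤ
    flipℤ k = - k - + 1
    involutive : ∀ k → flipℤ (flipℤ k) ≡ k
    involutive = solve 1 (λ k → flip (flip k) := k) refl

  ×↔ : ∀ {A B C D : Set} → A ↔ B → C ↔ D → A × C ↔ B × D
  ×↔ b c = record
    { to = λ { (x , y) → to b x , to c y } ; from = λ { (x , y) → from b x , from c y }
    ; to∘from = λ { (x , y) → cong₂ _,_ (to∘from b x) (to∘from c y) }
    ; from∘to = λ { (x , y) → cong₂ _,_ (from∘to b x) (from∘to c y) } }

  ×-swap↔ : ∀ {A B : Set} → A × B ↔ B × A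
  ×-swap↔ = record
    { to = λ { (x , y) → y , x } ; from = λ { (x , y) → y , x } ; to∘from = λ _ → refl ; from∘to = λ _ → refl }

  point↔ : ∀ {A B : Set} → A ↔ B → A ↔ ⊤ × B
  point↔ b = record
    { to = λ x → tt , to b x ; from = λ { (_ , y) → from b y }
    ; to∘from = λ { (tt , y) → cong (tt ,_) (to∘from b y) } ; from∘to = from∘to b }

  -- The difference becomes the first coordinate, so that splitting it by parity separates the pairs
  -- with n ≡ m modulo 2 from the others.
  shear↔ : ℤ × ℤ ↔ ℤ × ℤ
  shear↔ = record
    { to = λ { (n , m) → n - m , m } ; from = λ { (d , m) → d + m , m }
    ; to∘from = λ { (d , m) → cong (_, m) (solve 2 (λ d m → d :+ m :- m := d) refl d m) }
    ; from∘to = λ { (n , m) → cong (_, m) (solve 2 (λ n m → n :- m :+ m := n) refl n m) } }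

  parity₁ : ∀ {Y : Set} → ℤ × Y ↔ (ℤ × Y) ⊎ (ℤ × Y)
  parity₁ {Y} = record { to = λ { (n , y) → push y (to parity n) } ; from = pull ; to∘from = to-pull ; from∘to = pull-to }
    where
    push : Y → ℤ ⊎ ℤ → (ℤ × Y) ⊎ (ℤ × Y)
    push y (inj₁ k) = inj₁ (k , y)
    push y (inj₂ k) = inj₂ (k , y)
    pull : (ℤ × Y) ⊎ (ℤ × Y) → ℤ × Y
    pull (inj₁ (k , y)) = + 2 * k , y
    pull (inj₂ (k , y)) = + 2 * k + + 1 , y
    to-pull : ∀ z → push (proj₂ (pull z)) (to parity (proj₁ (pull z))) ≡ z
    to-pull (inj₁ (k , y)) = cong (push y) (to∘from parity (inj₁ k))
    to-pull (inj₂ (k , y)) = cong (push y) (to∘from parity (inj₂ k))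
    pull-push : ∀ y z → pull (push y z) ≡ (from parity z , y)
    pull-push y (inj₁ k) = refl
    pull-push y (inj₂ k) = refl
    pull-to : ∀ x → pull (push (proj₂ x) (to parity (proj₁ x))) ≡ x
    pull-to (n , y) = trans (pull-push y (to parity n)) (cong (_, y) (from∘to parity n))

  evens odds : ∀ {Y : Set} (G : Graded) → Point G ↔ ℤ × Y → Graded
  evens G b = leftPart G (↔-trans b parity₁)
  odds G b  = rightPart G (↔-trans b parity₁)

  gen-parity : ∀ {Y : Set} G (b : Point G ↔ ℤ × Y) → gen G ≈ gen (evens G b) ⊕ gen (odds G b)
  gen-parity G b = gen-parts G (↔-trans b parity₁)

  gen-point× : ∀ s G → gen (pointGraded s ×ᵍ G) ≈ qpow s ⊗ gen G
  gen-point× s G = ≈-trans (gen-× (pointGraded s) G) (⊗-congʳ {g = gen G} (gen-point s))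

  -- Dissections of φ, ψ², φ² and of the norm form of ℤ[(1+√-7)/2].

  φDeg-* : ∀ c s n → φDeg (suc c ℕ.* suc s) n ≡ + suc c * + suc s * (n * n)
  φDeg-* c s n = cong (_* (n * n)) (ℤP.pos-* (suc c) (suc s))

  ψDeg-* : ∀ c s k → ψDeg (suc c ℕ.* suc s) k ≡ + suc c * + suc s * (+ 2 * (k * k) + k)
  ψDeg-* c s k = cong (_* (+ 2 * (k * k) + k)) (ℤP.pos-* (suc c) (suc s))

  θDeg-* : ∀ c s j m → θDeg (suc c ℕ.* suc s) (j , m) ≡ + suc c * + suc s * form j m
  θDeg-* c s j m = cong (_* form j m) (ℤP.pos-* (suc c) (suc s))

  -- Every odd integer is either 4k + 1 or -(4k + 1) for one k ∈ ℤ, and (4k + 1)² = 1 + 8(2k² + k).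
  φ-dissection : ∀ s → gen (φ (suc s)) ≈ gen (φ (4 ℕ.* suc s)) ⊕
    (qpow (suc s) ⊗ gen (ψ (8 ℕ.* suc s)) ⊕ qpow (suc s) ⊗ gen (ψ (8 ℕ.* suc s)))
  φ-dissection s = ≈-trans (gen-parts (φ (suc s)) parity) (⊕-cong
    (gen-↔ (leftPart (φ (suc s)) parity) (φ (4 ℕ.* suc s)) id↔ λ k → trans (φDeg-* 3 s k)
      (solve 2 (λ S k → 4 ′ :* S :* sqᵖ k := S :* sqᵖ (even k)) refl S k))
    (≈-trans (gen-parts O parity) (⊕-cong
      (piece (leftPart O parity) id↔ λ k → trans (cong (λ z → S + z) (ψDeg-* 7 s k))
        (solve 2 (λ S k → S :+ 8 ′ :* S :* ψᵖ k := S :* sqᵖ (odd (even k))) refl S k))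
      (piece (rightPart O parity) flip↔ λ k → trans (cong (λ z → S + z) (ψDeg-* 7 s (- k - + 1)))
        (solve 2 (λ S k → S :+ 8 ′ :* S :* ψᵖ (flip k) := S :* sqᵖ (odd (odd k))) refl S k)))))
    where
    S = + suc s
    O = rightPart (φ (suc s)) parity
    piece : ∀ P (b : Point P ↔ ℤ) → (∀ x → S + ψDeg (8 ℕ.* suc s) (to b x) ≡ deg P x) →
            gen P ≈ qpow (suc s) ⊗ gen (ψ (8 ℕ.* suc s))
    piece P b e = ≈-trans (gen-↔ P (pointGraded (suc s) ×ᵍ ψ (8 ℕ.* suc s)) (point↔ b) e)
                          (gen-point× (suc s) (ψ (8 ℕ.* suc s)))

  advance↔ : ℤ × ℤ ↔ ℤ × ℤ
  advance↔ = record
    { to = λ { (v , m) → v , m + v } ; from = λ { (v , u) → v , u - v }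
    ; to∘from = λ { (v , u) → cong (v ,_) (solve 2 (λ v u → u :- v :+ v := u) refl v u) }
    ; from∘to = λ { (v , m) → cong (v ,_) (solve 2 (λ v m → m :+ v :- v := m) refl v m) } }

  -- (v , m) ↦ (v , - (m + v) - 1)
  reflect↔ : ℤ × ℤ ↔ ℤ × ℤ
  reflect↔ = ↔-trans advance↔ (×↔ id↔ flip↔)

  gen-point×× : ∀ s G H P (b : Point P ↔ Point G × Point H) →
    (∀ x → + s + (deg G (proj₁ (to b x)) + deg H (proj₂ (to b x))) ≡ deg P x) →
    gen P ≈ qpow s ⊗ (gen G ⊗ gen H)
  gen-point×× s G H P b e = ≈-trans (gen-↔ P (pointGraded s ×ᵍ (G ×ᵍ H)) (point↔ b) e)
    (≈-trans (gen-point× s (G ×ᵍ H)) (⊗-congˡ {qpow s} (gen-× G H)))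

  gen-×↔ : ∀ G H P (b : Point P ↔ Point G × Point H) →
    (∀ x → deg G (proj₁ (to b x)) + deg H (proj₂ (to b x)) ≡ deg P x) → gen P ≈ gen G ⊗ gen H
  gen-×↔ G H P b e = ≈-trans (gen-↔ P (G ×ᵍ H) b e) (gen-× G H)

  -- At scale 1, a pair of indices u + v, u - v has degree 4v² + 2(2u² + u). An odd difference
  -- yields ψ(q²) times the two halves of the odd part 2qψ(q⁸) of φ(q), so that the sum regroups
  -- into φ(q)ψ(q²).
  ψ²-dissection : ∀ s → gen (ψ (suc s)) ⊗ gen (ψ (suc s)) ≈
    gen (φ (4 ℕ.* suc s)) ⊗ gen (ψ (2 ℕ.* suc s)) ⊕
    (qpow (suc s) ⊗ (gen (ψ (8 ℕ.* suc s)) ⊗ gen (ψ (2 ℕ.* suc s))) ⊕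
     qpow (suc s) ⊗ (gen (ψ (8 ℕ.* suc s)) ⊗ gen (ψ (2 ℕ.* suc s))))
  ψ²-dissection s = ≈-trans (≈-sym (gen-× (ψ (suc s)) (ψ (suc s)))) (≈-trans (gen-parity G shear↔) (⊕-cong
    (gen-×↔ (φ (4 ℕ.* suc s)) (ψ (2 ℕ.* suc s)) (evens G shear↔) advance↔
      λ { (v , m) → trans (cong₂ _+_ (φDeg-* 3 s v) (ψDeg-* 1 s (m + v)))
        (solve 3 (λ S v m → 4 ′ :* S :* sqᵖ v :+ 2 ′ :* S :* ψᵖ (m :+ v)
                         := S :* ψᵖ (even v :+ m) :+ S :* ψᵖ m) refl S v m) })
    (≈-trans (gen-parity O reflect↔) (⊕-cong
      (gen-point×× (suc s) (ψ (8 ℕ.* suc s)) (ψ (2 ℕ.* suc s)) (evens O reflect↔) id↔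
        λ { (v , u) → trans (cong (λ z → S + z) (cong₂ _+_ (ψDeg-* 7 s v) (ψDeg-* 1 s u)))
          (solve 3 (λ S v u → S :+ (8 ′ :* S :* ψᵖ v :+ 2 ′ :* S :* ψᵖ u)
                           := S :* ψᵖ (odd (even v) :+ (flip u :- even v)) :+ S :* ψᵖ (flip u :- even v)) refl S v u) })
      (gen-point×× (suc s) (ψ (8 ℕ.* suc s)) (ψ (2 ℕ.* suc s)) (odds O reflect↔) (×↔ flip↔ id↔)
        λ { (v , u) → trans (cong (λ z → S + z) (cong₂ _+_ (ψDeg-* 7 s (- v - + 1)) (ψDeg-* 1 s u)))
          (solve 3 (λ S v u → S :+ (8 ′ :* S :* ψᵖ (flip v) :+ 2 ′ :* S :* ψᵖ u)
                           := S :* ψᵖ (odd (odd v) :+ (flip u :- odd v)) :+ S :* ψᵖ (flip u :- odd v)) refl S v u) })))))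
    where
    S = + suc s
    G = ψ (suc s) ×ᵍ ψ (suc s)
    O = odds G shear↔

  neg↔ : ℤ ↔ ℤ
  neg↔ = record { to = -_ ; from = -_ ; to∘from = ℤP.neg-involutive ; from∘to = ℤP.neg-involutive }

  advance-swap↔ : ℤ × ℤ ↔ ℤ × ℤ
  advance-swap↔ = ↔-trans advance↔ ×-swap↔

  -- (i , k) ↦ (- k - 1 , i + k + 1)
  conjugate↔ : ℤ × ℤ ↔ ℤ × ℤ
  conjugate↔ = ↔-trans ×-swap↔ (↔-trans (×↔ flip↔ id↔) (↔-sym advance↔))

  -- Use n² + m² = ((n - m)² + (n + m)²)/2. If n - m is odd, so is n + m, and each odd square is 1 +
  -- 8(2k² + k) for one residue class modulo 4 and, after `flip↔`, for the other: hence four equal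
  -- pieces.
  φ²-dissection : ∀ s → gen (φ (suc s)) ⊗ gen (φ (suc s)) ≈
    gen (φ (2 ℕ.* suc s)) ⊗ gen (φ (2 ℕ.* suc s)) ⊕
    (let c = qpow (suc s) ⊗ (gen (ψ (4 ℕ.* suc s)) ⊗ gen (ψ (4 ℕ.* suc s))) in (c ⊕ c) ⊕ (c ⊕ c))
  φ²-dissection s = ≈-trans (≈-sym (gen-× (φ (suc s)) (φ (suc s)))) (≈-trans (gen-parity G shear↔) (⊕-cong
    (gen-×↔ (φ (2 ℕ.* suc s)) (φ (2 ℕ.* suc s)) (evens G shear↔) advance↔
      λ { (v , m) → trans (cong₂ _+_ (φDeg-* 1 s v) (φDeg-* 1 s (m + v)))
        (solve 3 (λ S v m → 2 ′ :* S :* sqᵖ v :+ 2 ′ :* S :* sqᵖ (m :+ v)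
                         := S :* sqᵖ (even v :+ m) :+ S :* sqᵖ m) refl S v m) })
    (≈-trans (gen-parity O advance↔) (⊕-cong
      (≈-trans (gen-parity Oᵉ ×-swap↔) (⊕-cong
        (piece (evens Oᵉ ×-swap↔) id↔ λ { (b , a) → trans (degs b a)
          (solve 3 (λ S b a → S :+ (4 ′ :* S :* ψᵖ b :+ 4 ′ :* S :* ψᵖ a)
            := S :* sqᵖ (odd (even a) :+ (even b :- even a)) :+ S :* sqᵖ (even b :- even a)) refl S b a) })
        (piece (odds Oᵉ ×-swap↔) (×↔ flip↔ id↔) λ { (b , a) → trans (degs (- b - + 1) a)
          (solve 3 (λ S b a → S :+ (4 ′ :* S :* ψᵖ (flip b) :+ 4 ′ :* S :* ψᵖ a)
            := S :* sqᵖ (odd (even a) :+ (odd b :- even a)) :+ S :* sqᵖ (odd b :- even a)) refl S b a) })))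
      (≈-trans (gen-parity Oᵒ ×-swap↔) (⊕-cong
        (piece (evens Oᵒ ×-swap↔) (×↔ id↔ flip↔) λ { (b , a) → trans (degs b (- a - + 1))
          (solve 3 (λ S b a → S :+ (4 ′ :* S :* ψᵖ b :+ 4 ′ :* S :* ψᵖ (flip a))
            := S :* sqᵖ (odd (odd a) :+ (even b :- odd a)) :+ S :* sqᵖ (even b :- odd a)) refl S b a) })
        (piece (odds Oᵒ ×-swap↔) (×↔ flip↔ flip↔) λ { (b , a) → trans (degs (- b - + 1) (- a - + 1))
          (solve 3 (λ S b a → S :+ (4 ′ :* S :* ψᵖ (flip b) :+ 4 ′ :* S :* ψᵖ (flip a))
            := S :* sqᵖ (odd (odd a) :+ (odd b :- odd a)) :+ S :* sqᵖ (odd b :- odd a)) refl S b a) })))))))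
    where
    S = + suc s
    G = φ (suc s) ×ᵍ φ (suc s)
    O = odds G shear↔
    Oᵉ = evens O advance↔
    Oᵒ = odds O advance↔
    piece = gen-point×× (suc s) (ψ (4 ℕ.* suc s)) (ψ (4 ℕ.* suc s))
    degs : ∀ b a → S + (ψDeg (4 ℕ.* suc s) b + ψDeg (4 ℕ.* suc s) a)
                 ≡ S + (+ 4 * S * (+ 2 * (b * b) + b) + + 4 * S * (+ 2 * (a * a) + a))
    degs b a = cong (λ z → S + z) (cong₂ _+_ (ψDeg-* 3 s b) (ψDeg-* 3 s a))

  κ : ℕ → Graded
  κ s = odds (θ s) id↔

  -- With ω = (1+√-7)/2, the element j + mω is divisible by ω, of norm 2, exactly when j is even:
  -- form(2i, m) = 2 form(m, i).
  θ-halving : ∀ s → gen (θ (suc s)) ≈ gen (θ (2 ℕ.* suc s)) ⊕ gen (κ (suc s))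
  θ-halving s = ≈-trans (gen-parity (θ (suc s)) id↔) (⊕-cong
    (gen-↔ (evens (θ (suc s)) id↔) (θ (2 ℕ.* suc s)) ×-swap↔ λ { (i , m) → trans (θDeg-* 1 s m i)
      (solve 3 (λ S i m → 2 ′ :* S :* formᵖ m i := S :* formᵖ (even i) m) refl S i m) })
    ≈-refl)
    where S = + suc s

  -- Eight times the form is (4m + j)² + 7j². For odd j both squares are odd, and each class of j
  -- modulo 4 contributes one product.
  κ≈2qψψ : ∀ s → let c = qpow (suc s) ⊗ (gen (ψ (suc s)) ⊗ gen (ψ (7 ℕ.* suc s))) in gen (κ (suc s)) ≈ c ⊕ c
  κ≈2qψψ s = ≈-trans (gen-parity (κ (suc s)) id↔) (⊕-cong
    (piece (evens (κ (suc s)) id↔) advance-swap↔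
      λ { (l , m) → trans (cong (λ z → S + (ψDeg (suc s) (m + l) + z)) (ψDeg-* 6 s l))
        (solve 3 (λ S l m → S :+ (S :* ψᵖ (m :+ l) :+ 7 ′ :* S :* ψᵖ l) := S :* formᵖ (odd (even l)) m) refl S l m) })
    (piece (odds (κ (suc s)) id↔) (↔-trans (×↔ flip↔ neg↔) advance-swap↔)
      λ { (l , m) → trans (cong (λ z → S + (ψDeg (suc s) (- m + (- l - + 1)) + z)) (ψDeg-* 6 s (- l - + 1)))
        (solve 3 (λ S l m → S :+ (S :* ψᵖ (:- m :+ flip l) :+ 7 ′ :* S :* ψᵖ (flip l)) := S :* formᵖ (odd (odd l)) m) refl S l m) }))
    where
    S = + suc s
    piece = gen-point×× (suc s) (ψ (suc s)) (ψ (7 ℕ.* suc s))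

  -- For m = 2i completing the square gives (j + i)² + 7i². For odd m exactly one of j and j + m is
  -- even, and the conjugation (j, m) ↦ (j + m, -m) exchanges the two cases; `conjugate↔` is its
  -- effect on half-indices.
  θ≈φφ+2κ : ∀ s → gen (θ (suc s)) ≈ gen (φ (suc s)) ⊗ gen (φ (7 ℕ.* suc s)) ⊕
                    (gen (κ (2 ℕ.* suc s)) ⊕ gen (κ (2 ℕ.* suc s)))
  θ≈φφ+2κ s = ≈-trans (gen-parity (θ (suc s)) ×-swap↔) (⊕-cong
    (gen-×↔ (φ (suc s)) (φ (7 ℕ.* suc s)) (evens (θ (suc s)) ×-swap↔) advance-swap↔
      λ { (i , j) → trans (cong (λ z → φDeg (suc s) (j + i) + z) (φDeg-* 6 s i))
        (solve 3 (λ S i j → S :* sqᵖ (j :+ i) :+ 7 ′ :* S :* sqᵖ i := S :* formᵖ j (even i)) refl S i j) })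
    (≈-trans (gen-parity M ×-swap↔) (⊕-cong
      (gen-↔ (evens M ×-swap↔) (κ (2 ℕ.* suc s)) ×-swap↔
        λ { (i , k) → trans (θDeg-* 1 s (+ 2 * k + + 1) i)
          (solve 3 (λ S i k → 2 ′ :* S :* formᵖ (odd k) i := S :* formᵖ (even i) (odd k)) refl S i k) })
      (gen-↔ (odds M ×-swap↔) (κ (2 ℕ.* suc s)) conjugate↔
        λ { (i , k) → trans (θDeg-* 1 s (+ 2 * (- k - + 1) + + 1) (i - (- k - + 1)))
          (solve 3 (λ S i k → 2 ′ :* S :* formᵖ (odd (flip k)) (i :- flip k) := S :* formᵖ (odd i) (odd k)) refl S i k) }))))
    where
    S = + suc s
    M = odds (θ (suc s)) ×-swap↔

  ω : ℕ → Graded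
  ω s = odds (φ s ×ᵍ φ (7 ℕ.* s)) shear↔

  -- At x = 2j + m, y = m the form x² + 7y² is four times the norm form. The pairs of opposite
  -- parity make up `ω`, whose series is determined afterwards by `Halvings`.
  φφ≈θ+ω : ∀ s → gen (φ (suc s)) ⊗ gen (φ (7 ℕ.* suc s)) ≈ gen (θ (4 ℕ.* suc s)) ⊕ gen (ω (suc s))
  φφ≈θ+ω s = ≈-trans (≈-sym (gen-× (φ (suc s)) (φ (7 ℕ.* suc s)))) (≈-trans (gen-parity G shear↔) (⊕-cong
    (gen-↔ (evens G shear↔) (θ (4 ℕ.* suc s)) id↔ λ { (j , m) → trans (θDeg-* 3 s j m) (trans
      (solve 3 (λ S j m → 4 ′ :* S :* formᵖ j m := S :* sqᵖ (even j :+ m) :+ 7 ′ :* S :* sqᵖ m) refl S j m)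
      (cong (λ z → φDeg (suc s) (+ 2 * j + m) + z) (sym (φDeg-* 6 s m)))) })
    ≈-refl))
    where
    S = + suc s
    G = φ (suc s) ×ᵍ φ (7 ℕ.* suc s)

  ψψᵉ ψψᵒ : ℕ → Graded
  ψψᵉ s = evens (ψ s ×ᵍ ψ (7 ℕ.* s)) shear↔
  ψψᵒ s = odds (ψ s ×ᵍ ψ (7 ℕ.* s)) shear↔

  ψψ≈ψψᵉ+ψψᵒ : ∀ s → gen (ψ s) ⊗ gen (ψ (7 ℕ.* s)) ≈ gen (ψψᵉ s) ⊕ gen (ψψᵒ s)
  ψψ≈ψψᵉ+ψψᵒ s = ≈-trans (≈-sym (gen-× (ψ s) (ψ (7 ℕ.* s)))) (gen-parity (ψ s ×ᵍ ψ (7 ℕ.* s)) shear↔)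

  -- For X = 4x + 1 and Y = 4y + 1, eight times the degree plus 8 is X² + 7Y². Dividing X + Y√-7 by
  -- (1+√-7)/2 halves this; up to sign the new coordinates are (X + 7Y)/4 and (X - Y)/4 = x - y,
  -- both odd when x - y is. The class of x - y modulo 4 decides which sign brings them back to the
  -- shape 4k + 1.
  ψψᵒ₁≈qψψ : gen (ψψᵒ 1) ≈ qpow 1 ⊗ (gen (ψ 2) ⊗ gen (ψ 14))
  ψψᵒ₁≈qψψ = begin
    gen (ψψᵒ 1)
      ≈⟨ gen-parity (ψψᵒ 1) id↔ ⟩
    gen (evens (ψψᵒ 1) id↔) ⊕ gen (odds (ψψᵒ 1) id↔)
      ≈⟨ ⊕-cong evens≈ odds≈ ⟩
    qpow 1 ⊗ gen (odds G shear↔) ⊕ qpow 1 ⊗ gen (evens G shear↔)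
      ≈⟨ SR.solve 3 (λ q o e → q SR.:* o SR.:+ q SR.:* e SR.:= q SR.:* (e SR.:+ o)) ≈-refl
           (qpow 1) (gen (odds G shear↔)) (gen (evens G shear↔)) ⟩
    qpow 1 ⊗ (gen (evens G shear↔) ⊕ gen (odds G shear↔))
      ≈⟨ ⊗-congˡ {qpow 1} (gen-parity G shear↔) ⟨
    qpow 1 ⊗ gen G
      ≈⟨ ⊗-congˡ {qpow 1} (gen-× (ψ 2) (ψ 14)) ⟩
    qpow 1 ⊗ (gen (ψ 2) ⊗ gen (ψ 14)) ∎
    where
    open ≈-Reasoning
    G = ψ 2 ×ᵍ ψ 14
    evens≈ : gen (evens (ψψᵒ 1) id↔) ≈ qpow 1 ⊗ gen (odds G shear↔)
    evens≈ = ≈-trans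
      (gen-↔ (evens (ψψᵒ 1) id↔) (pointGraded 1 ×ᵍ odds G shear↔) (point↔ (↔-trans reflect↔ ×-swap↔))
        λ { (a , k) → solve 2 (λ a k →
              1 ′ :+ (2 ′ :* ψᵖ (odd (flip (k :+ a)) :+ a) :+ 14 ′ :* ψᵖ a)
              := 1 ′ :* ψᵖ (odd (even a) :+ k) :+ 7 ′ :* ψᵖ k) refl a k })
      (gen-point× 1 (odds G shear↔))
    odds≈ : gen (odds (ψψᵒ 1) id↔) ≈ qpow 1 ⊗ gen (evens G shear↔)
    odds≈ = ≈-trans
      (gen-↔ (odds (ψψᵒ 1) id↔) (pointGraded 1 ×ᵍ evens G shear↔)
             (point↔ (↔-trans (×↔ flip↔ id↔) (↔-trans (↔-sym advance↔) ×-swap↔)))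
        λ { (a , k) → solve 2 (λ a k →
              1 ′ :+ (2 ′ :* ψᵖ (even (k :- flip a) :+ flip a) :+ 14 ′ :* ψᵖ (flip a))
              := 1 ′ :* ψᵖ (odd (odd a) :+ k) :+ 7 ′ :* ψᵖ k) refl a k })
      (gen-point× 1 (evens G shear↔))

  -- Up to a factor 8 the form T ⊥ T is x₁² + x₂² + 7 x₃² + 7 x₄² with x₁ = x₃ + 4 t - 8 c, x₂ = 3 x₃ - 2 t + 8 d,
  -- x₄ = x₃ - 2 t in the coordinates (x₃ , t , c , d); the residues of x₃ mod 4 and of t mod 2 make it a sum of
  -- products of binary lattices.
  module TSquared where
    TT : Graded
    TT = T ×ᵍ T

    chart : Point TT ↔ ℤ × (ℤ × (ℤ × ℤ))
    chart = record
      { to = λ { ((a , b) , (c , d)) → (a - d) + (b + c) , (b + c , (c , d)) }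
      ; from = λ { (x , (t , (c , d))) → (x - t + d , t - c) , (c , d) }
      ; to∘from = λ { (x , (t , (c , d))) → cong₂ _,_
          (solve 4 (λ x t c d → (x :- t :+ d :- d) :+ (t :- c :+ c) := x) refl x t c d)
          (cong (_, (c , d)) (solve 2 (λ t c → t :- c :+ c := t) refl t c)) }
      ; from∘to = λ { ((a , b) , (c , d)) → cong (_, (c , d)) (cong₂ _,_
          (solve 4 (λ a b c d → (a :- d) :+ (b :+ c) :- (b :+ c) :+ d := a) refl a b c d)
          (solve 2 (λ b c → b :+ c :- c := b) refl b c)) } }

    exchange : ℤ × (ℤ × (ℤ × ℤ)) ↔ ℤ × (ℤ × (ℤ × ℤ))
    exchange = record
      { to = λ { (u , (t , r)) → t , (u , r) } ; from = λ { (t , (u , r)) → u , (t , r) }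
      ; to∘from = λ _ → refl ; from∘to = λ _ → refl }

    -- When the chart coordinates are 4u and 2v, the quaternary form is the sum of a binary form in
    -- (v - c, u) and one in (u + d, u - v). The same pairing serves all eight residue classes, up
    -- to symmetries of the binary pieces.
    pairing : ℤ × (ℤ × (ℤ × ℤ)) ↔ (ℤ × ℤ) × (ℤ × ℤ)
    pairing = record
      { to = λ { (v , (u , (c , d))) → (v - c , u) , (u + d , u - v) }
      ; from = λ { ((p , u) , (q , r)) → u - r , (u , (u - r - p , q - u)) }
      ; to∘from = λ { ((p , u) , (q , r)) → cong₂ _,_
          (cong (_, u) (solve 3 (λ p u r → u :- r :- (u :- r :- p) := p) refl p u r))
          (cong₂ _,_ (solve 2 (λ u q → u :+ (q :- u) := q) refl u q) (solve 2 (λ u r → u :- (u :- r) := r) refl u r)) }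
      ; from∘to = λ { (v , (u , (c , d))) → cong₂ _,_ (solve 2 (λ u v → u :- (u :- v) := v) refl u v)
          (cong (u ,_) (cong₂ _,_ (solve 3 (λ u v c → u :- (u :- v) :- (v :- c) := c) refl u v c)
                                  (solve 2 (λ u d → u :+ d :- u := d) refl u d))) } }

    conjugate-swap↔ reflect-swap↔ negate↔ : ℤ × ℤ ↔ ℤ × ℤ
    conjugate-swap↔ = ↔-trans conjugate↔ ×-swap↔
    reflect-swap↔ = ↔-trans ×-swap↔ (↔-trans reflect↔ ×-swap↔)
    negate↔ = ↔-trans ×-swap↔ (↔-trans advance↔ (↔-trans (×↔ neg↔ id↔) ×-swap↔))

    -- The index is the residue modulo 4 of the first chart coordinate; the orthogonal coordinates
    -- named above are something else.
    x₀ x₁ x₂ x₃ : Graded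
    x₀ = evens (evens TT chart) id↔
    x₁ = evens (odds TT chart) id↔
    x₂ = odds (evens TT chart) id↔
    x₃ = odds (odds TT chart) id↔

    Tᵖᵖ : ∀ {n} → (x t c d : Polynomial n) → Polynomial n
    Tᵖᵖ x t c d = Tᵖ (x :- t :+ d) (t :- c) :+ Tᵖ c d

    κ₄ᵖ ω₂ᵖ ψψᵉᵖ ψψᵒᵖ : ∀ {n} → (k m : Polynomial n) → Polynomial n
    κ₄ᵖ k m  = 4 ′ :* formᵖ (odd k) m
    ω₂ᵖ k m  = 2 ′ :* sqᵖ (odd k :+ m) :+ 14 ′ :* sqᵖ m
    ψψᵉᵖ l k = 1 ′ :* ψᵖ (even l :+ k) :+ 7 ′ :* ψᵖ k
    ψψᵒᵖ l k = 1 ′ :* ψᵖ (odd l :+ k) :+ 7 ′ :* ψᵖ k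

    x₀ᵉ : gen (evens x₀ exchange) ≈ gen (θ 8) ⊗ gen (θ 8)
    x₀ᵉ = gen-×↔ (θ 8) (θ 8) (evens x₀ exchange) pairing λ { (v , (u , (c , d))) →
      solve 4 (λ v u c d → 8 ′ :* formᵖ (v :- c) u :+ 8 ′ :* formᵖ (u :+ d) (u :- v)
                        := Tᵖᵖ (even (even u)) (even v) c d) refl v u c d }

    x₀ᵒ : gen (odds x₀ exchange) ≈ gen (ω 2) ⊗ gen (κ 4)
    x₀ᵒ = gen-×↔ (ω 2) (κ 4) (odds x₀ exchange)
      (↔-trans pairing (×↔ id↔ (↔-trans ×-swap↔ (×↔ (↔-trans neg↔ flip↔) id↔)))) λ { (v , (u , (c , d))) →
      solve 4 (λ v u c d → ω₂ᵖ (v :- c) u :+ κ₄ᵖ (flip (:- (u :- v))) (u :+ d)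
                        := Tᵖᵖ (even (even u)) (odd v) c d) refl v u c d }

    x₂ᵉ : gen (evens x₂ exchange) ≈ gen (κ 4) ⊗ gen (κ 4)
    x₂ᵉ = gen-×↔ (κ 4) (κ 4) (evens x₂ exchange)
      (↔-trans pairing (×↔ ×-swap↔ conjugate↔)) λ { (v , (u , (c , d))) →
      solve 4 (λ v u c d → κ₄ᵖ u (v :- c) :+ κ₄ᵖ (flip (u :- v)) (u :+ d :- flip (u :- v))
                        := Tᵖᵖ (even (odd u)) (even v) c d) refl v u c d }

    x₂ᵒ : gen (odds x₂ exchange) ≈ gen (κ 4) ⊗ gen (ω 2)
    x₂ᵒ = gen-×↔ (κ 4) (ω 2) (odds x₂ exchange)
      (↔-trans pairing (×↔ conjugate↔ id↔)) λ { (v , (u , (c , d))) →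
      solve 4 (λ v u c d → κ₄ᵖ (flip u) (v :- c :- flip u) :+ ω₂ᵖ (u :+ d) (u :- v)
                        := Tᵖᵖ (even (odd u)) (odd v) c d) refl v u c d }

    x₁ᵉ : gen (evens x₁ exchange) ≈ qpow 2 ⊗ (gen (ψψᵉ 1) ⊗ gen (ψψᵒ 1))
    x₁ᵉ = gen-point×× 2 (ψψᵉ 1) (ψψᵒ 1) (evens x₁ exchange)
      (↔-trans pairing (×↔ id↔ reflect-swap↔)) λ { (v , (u , (c , d))) →
      solve 4 (λ v u c d → 2 ′ :+ (ψψᵉᵖ (v :- c) u :+ ψψᵒᵖ (flip (u :+ d :+ (u :- v))) (u :- v))
                        := Tᵖᵖ (odd (even u)) (even v) c d) refl v u c d }

    x₁ᵒ : gen (odds x₁ exchange) ≈ qpow 2 ⊗ (gen (ψψᵒ 1) ⊗ gen (ψψᵉ 1))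
    x₁ᵒ = gen-point×× 2 (ψψᵒ 1) (ψψᵉ 1) (odds x₁ exchange)
      (↔-trans pairing (×↔ id↔ negate↔)) λ { (v , (u , (c , d))) →
      solve 4 (λ v u c d → 2 ′ :+ (ψψᵒᵖ (v :- c) u :+ ψψᵉᵖ (u :+ d :+ (u :- v)) (:- (u :- v)))
                        := Tᵖᵖ (odd (even u)) (odd v) c d) refl v u c d }

    x₃ᵉ : gen (evens x₃ exchange) ≈ qpow 2 ⊗ (gen (ψψᵉ 1) ⊗ gen (ψψᵒ 1))
    x₃ᵉ = gen-point×× 2 (ψψᵉ 1) (ψψᵒ 1) (evens x₃ exchange)
      (↔-trans pairing (×↔ (×↔ neg↔ flip↔) conjugate-swap↔)) λ { (v , (u , (c , d))) →
      solve 4 (λ v u c d → 2 ′ :+ (ψψᵉᵖ (:- (v :- c)) (flip u) :+ ψψᵒᵖ (u :+ d :- flip (u :- v)) (flip (u :- v)))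
                        := Tᵖᵖ (odd (odd u)) (even v) c d) refl v u c d }

    x₃ᵒ : gen (odds x₃ exchange) ≈ qpow 2 ⊗ (gen (ψψᵒ 1) ⊗ gen (ψψᵉ 1))
    x₃ᵒ = gen-point×× 2 (ψψᵒ 1) (ψψᵉ 1) (odds x₃ exchange)
      (↔-trans pairing (×↔ (×↔ flip↔ flip↔) reflect-swap↔)) λ { (v , (u , (c , d))) →
      solve 4 (λ v u c d → 2 ′ :+ (ψψᵒᵖ (flip (v :- c)) (flip u) :+ ψψᵉᵖ (flip (u :+ d :+ (u :- v))) (u :- v))
                        := Tᵖᵖ (odd (odd u)) (odd v) c d) refl v u c d }

    T²-dissection : gen T ⊗ gen T ≈
      ((gen (θ 8) ⊗ gen (θ 8) ⊕ gen (ω 2) ⊗ gen (κ 4)) ⊕ (gen (κ 4) ⊗ gen (κ 4) ⊕ gen (κ 4) ⊗ gen (ω 2))) ⊕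
      ((qpow 2 ⊗ (gen (ψψᵉ 1) ⊗ gen (ψψᵒ 1)) ⊕ qpow 2 ⊗ (gen (ψψᵒ 1) ⊗ gen (ψψᵉ 1))) ⊕
       (qpow 2 ⊗ (gen (ψψᵉ 1) ⊗ gen (ψψᵒ 1)) ⊕ qpow 2 ⊗ (gen (ψψᵒ 1) ⊗ gen (ψψᵉ 1))))
    T²-dissection = ≈-trans (≈-sym (gen-× T T)) (≈-trans (gen-parity TT chart) (⊕-cong
      (≈-trans (gen-parity (evens TT chart) id↔) (⊕-cong
        (≈-trans (gen-parity x₀ exchange) (⊕-cong x₀ᵉ x₀ᵒ))
        (≈-trans (gen-parity x₂ exchange) (⊕-cong x₂ᵉ x₂ᵒ))))
      (≈-trans (gen-parity (odds TT chart) id↔) (⊕-cong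
        (≈-trans (gen-parity x₁ exchange) (⊕-cong x₁ᵉ x₁ᵒ))
        (≈-trans (gen-parity x₃ exchange) (⊕-cong x₃ᵉ x₃ᵒ))))))

  open TSquared public using (T²-dissection)

-- Gauss's products for φ(-q) and ψ(q).

module Products where

  open ≡ using (_≡_; _≢_; refl; sym; trans; cong; cong₂; subst; module ≡-Reasoning)
  open SeriesAlgebra
  open SR using (solve; _:=_; _:+_; _:*_; _:-_; :-_; con)
  open GradedSets
  open Lattices

  infix 4 _≈[_]_
  -- Congruence modulo q to the power `M`. Infinite products and sums are compared through finite
  -- truncations, with `M` exceeding the index of the coefficient in question.
  _≈[_]_ : Series → ℕ → Series → Set
  f ≈[ M ] g = ∀ n → n ℕ.< M → f n ≡ g n

  ≈⇒≈[] : ∀ {M f g} → f ≈ g → f ≈[ M ] g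
  ≈⇒≈[] e n _ = e n

  ≈[]-sym : ∀ {M f g} → f ≈[ M ] g → g ≈[ M ] f
  ≈[]-sym e n n<M = sym (e n n<M)

  ≈[]-trans : ∀ {M f g h} → f ≈[ M ] g → g ≈[ M ] h → f ≈[ M ] h
  ≈[]-trans e e′ n n<M = trans (e n n<M) (e′ n n<M)

  ≈[]-weaken : ∀ {M N f g} → N ℕ.≤ M → f ≈[ M ] g → f ≈[ N ] g
  ≈[]-weaken N≤M e n n<N = e n (ℕP.≤-trans n<N N≤M)

  ⊕-≈[] : ∀ {M f f′ g g′} → f ≈[ M ] f′ → g ≈[ M ] g′ → f ⊕ g ≈[ M ] f′ ⊕ g′
  ⊕-≈[] e e′ n n<M = cong₂ ℚ._+_ (e n n<M) (e′ n n<M)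

  negS-≈[] : ∀ {M f f′} → f ≈[ M ] f′ → negS f ≈[ M ] negS f′
  negS-≈[] e n n<M = cong ℚ.-_ (e n n<M)

  ⊗-≈[] : ∀ {M f f′ g g′} → f ≈[ M ] f′ → g ≈[ M ] g′ → f ⊗ g ≈[ M ] f′ ⊗ g′
  ⊗-≈[] e e′ n n<M = sumTo-cong n λ k k≤n →
    cong₂ ℚ._*_ (e k (ℕP.≤-<-trans k≤n n<M)) (e′ (n ℕ.∸ k) (ℕP.≤-<-trans (ℕP.m∸n≤m n k) n<M))

  ⊗-zero-≈[] : ∀ {M} f g → f 0 ≢ 0ℚ → f ⊗ g ≈[ M ] zeroS → g ≈[ M ] zeroS
  ⊗-zero-≈[] {M} f g f0≢0 e = <-rec (λ n → n ℕ.< M → g n ≡ 0ℚ) λ n ih n<M →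
    p*q≡0⇒q≡0 (f 0) (g n) f0≢0
      (trans (sym (⊗-lowest 0 n f g (λ _ ()) (λ j j<n → ih j<n (ℕP.<-trans j<n n<M)))) (e n n<M))

  -- Modulo a power of q the sum must have a nonzero constant term: cancelling a factor qᵏ would
  -- lose k coefficients.
  square-injective-≈[] : ∀ {M} f g → (f ⊕ g) 0 ≢ 0ℚ → f ⊗ f ≈[ M ] g ⊗ g → f ≈[ M ] g
  square-injective-≈[] {M} f g s≢0 e n n<M = begin
    f n                               ≡⟨ ℚR.solve 2 (λ f g → f ℚR.:= (f ℚR.:+ ℚR.:- g) ℚR.:+ g) refl (f n) (g n) ⟩
    (f n ℚ.+ ℚ.- g n) ℚ.+ g n         ≡⟨ cong (ℚ._+ g n) (⊗-zero-≈[] (f ⊕ g) (f ⊕ negS g) s≢0 product n n<M) ⟩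
    0ℚ ℚ.+ g n                        ≡⟨ ℚP.+-identityˡ (g n) ⟩
    g n                               ∎
    where
    open ≡-Reasoning
    product : (f ⊕ g) ⊗ (f ⊕ negS g) ≈[ M ] zeroS
    product = ≈[]-trans
      (≈⇒≈[] (solve 2 (λ f g → (f :+ g) :* (f :+ :- g) := f :* f :+ :- (g :* g)) ≈-refl f g))
      (λ n n<M → trans (cong (ℚ._+ ℚ.- (g ⊗ g) n) (e n n<M)) (ℚP.+-inverseʳ ((g ⊗ g) n)))

  qpow-low : ∀ k f → qpow k ⊗ f ≈[ k ] zeroS
  qpow-low (suc k) f zero    _         = ℚP.*-zeroˡ (f 0)
  qpow-low (suc k) f (suc n) (s≤s n<k) = trans (qtimes-⊗ (qpow k) f (suc n)) (qpow-low k f n n<k)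

  qpow-low′ : ∀ k → qpow k ≈[ k ] zeroS
  qpow-low′ (suc k) zero    _         = refl
  qpow-low′ (suc k) (suc n) (s≤s n<k) = qpow-low′ k n n<k

  gen-low : ∀ G M → (∀ x N → deg G x ≡ + N → M ℕ.≤ N) → gen G ≈[ M ] zeroS
  gen-low G M low N N<M = cong ι (empty (enum G N) (λ x∈ → ℕP.<⇒≱ N<M (low _ N (enum-sound G x∈))))
    where
    empty : (xs : List (Point G)) → (∀ {x} → x ∉ xs) → length xs ≡ 0
    empty []       _ = refl
    empty (x ∷ xs) ¬∈ = ⊥-elim (¬∈ (here refl))

  signs↔ : ℤ ↔ ℕ ⊎ ℕ
  signs↔ = record
    { to = λ { (+ n) → inj₁ n ; -[1+ n ] → inj₂ n } ; from = λ { (inj₁ n) → + n ; (inj₂ n) → -[1+ n ] }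
    ; to∘from = λ { (inj₁ _) → refl ; (inj₂ _) → refl } ; from∘to = λ { (+ _) → refl ; -[1+ _ ] → refl } }

  peel↔ : ℕ ↔ ⊤ ⊎ ℕ
  peel↔ = record
    { to = λ { zero → inj₁ tt ; (suc n) → inj₂ n } ; from = λ { (inj₁ _) → 0 ; (inj₂ n) → suc n }
    ; to∘from = λ { (inj₁ _) → refl ; (inj₂ _) → refl } ; from∘to = λ { zero → refl ; (suc _) → refl } }

  -- Apart from k = 0 every index has degree at least 1 + s.
  ψ≈[]one : ∀ s → gen (ψ (suc s)) ≈[ suc s ] one
  ψ≈[]one s = ≈[]-trans (≈⇒≈[] (≈-trans (gen-parts (ψ (suc s)) signs↔)
      (⊕-cong (gen-parts (leftPart (ψ (suc s)) signs↔) peel↔) (≈-refl {gen N}))))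
    (≈[]-trans (⊕-≈[] (⊕-≈[] {f′ = one} {g′ = zeroS}
        (≈⇒≈[] (gen-↔ (leftPart (leftPart (ψ (suc s)) signs↔) peel↔) (pointGraded 0) id↔ (λ _ → sym (ℤP.*-zeroʳ (+ suc s))) ▸ gen-point 0))
        (gen-low P (suc s) (λ n → low (+ suc n) (s≤s z≤n))))
      (gen-low N (suc s) (λ n → low -[1+ n ] (s≤s z≤n))))
    (λ n _ → trans (ℚP.+-identityʳ (one n ℚ.+ 0ℚ)) (ℚP.+-identityʳ (one n))))
    where
    _▸_ = ≈-trans
    P = rightPart (leftPart (ψ (suc s)) signs↔) peel↔
    N = rightPart (ψ (suc s)) signs↔
    low : ∀ k → 1 ℕ.≤ ℤ.∣ k ∣ → ∀ N → ψDeg (suc s) k ≡ + N → suc s ℕ.≤ N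
    low k 1≤k N e = subst (suc s ℕ.≤_) (ℤP.+-injective (trans (sym (ψDeg-value (suc s) k)) e))
      (ℕP.m≤m*n (suc s) (triangular k) ⦃ ℕ.>-nonZero (ℕP.≤-trans 1≤k (∣k∣≤triangular k)) ⦄)

  sumSquares : ℕ → ℕ → Series
  sumSquares s zero    = zeroS
  sumSquares s (suc n) = sumSquares s n ⊕ qpow (s ℕ.* (suc n ℕ.* suc n))

  squaresFrom : ℕ → ℕ → Graded
  squaresFrom s n = searchGraded ℕ (λ k → φDeg (suc s) (+ (n ℕ.+ k))) (λ N → upTo (suc N)) (λ N → UniqueP.upTo⁺ (suc N))
    (λ {N} {k} e → ∈P.∈-upTo⁺ (s≤s (ℕP.≤-trans (ℕP.m≤n+m k n) (ℕP.≤-trans (∣x∣≤sq (+ (n ℕ.+ k)))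
       (subst (sq (+ (n ℕ.+ k)) ℕ.≤_) (ℤP.+-injective (trans (sym (φDeg-value (suc s) (+ (n ℕ.+ k)))) e))
              (ℕP.m≤n*m (sq (+ (n ℕ.+ k))) (suc s)))))))
    (λ k → _ , φDeg-value (suc s) (+ (n ℕ.+ k)))

  squaresFrom-suc : ∀ s n → gen (squaresFrom s n) ≈ qpow (suc s ℕ.* (n ℕ.* n)) ⊕ gen (squaresFrom s (suc n))
  squaresFrom-suc s n = ≈-trans (gen-parts (squaresFrom s n) peel↔) (⊕-cong
    (≈-trans (gen-↔ (leftPart (squaresFrom s n) peel↔) (pointGraded (suc s ℕ.* (n ℕ.* n))) id↔
               λ _ → trans (sym (φDeg-value (suc s) (+ n))) (cong (λ m → φDeg (suc s) (+ m)) (sym (ℕP.+-identityʳ n))))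
             (gen-point (suc s ℕ.* (n ℕ.* n))))
    (gen-↔ (rightPart (squaresFrom s n) peel↔) (squaresFrom s (suc n)) id↔
      λ k → cong (λ m → φDeg (suc s) (+ m)) (sym (ℕP.+-suc n k))))

  squaresFrom-low : ∀ s n → gen (squaresFrom s n) ≈[ n ] zeroS
  squaresFrom-low s n = gen-low (squaresFrom s n) n λ k N e → ℕP.≤-trans (ℕP.m≤m+n n k) (ℕP.≤-trans (∣x∣≤sq (+ (n ℕ.+ k)))
    (subst (sq (+ (n ℕ.+ k)) ℕ.≤_) (ℤP.+-injective (trans (sym (φDeg-value (suc s) (+ (n ℕ.+ k)))) e))
           (ℕP.m≤n*m (sq (+ (n ℕ.+ k))) (suc s))))

  squaresFrom-sum : ∀ s n → gen (squaresFrom s 1) ≈ sumSquares (suc s) n ⊕ gen (squaresFrom s (suc n))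
  squaresFrom-sum s zero    = λ m → sym (ℚP.+-identityˡ (gen (squaresFrom s 1) m))
  squaresFrom-sum s (suc n) = ≈-trans (squaresFrom-sum s n) (≈-trans
    (⊕-cong (≈-refl {sumSquares (suc s) n}) (squaresFrom-suc s (suc n)))
    (solve 3 (λ a b c → a :+ (b :+ c) := (a :+ b) :+ c) ≈-refl
       (sumSquares (suc s) n) (qpow (suc s ℕ.* (suc n ℕ.* suc n))) (gen (squaresFrom s (suc (suc n))))))

  φ-partialSum : ∀ s n → gen (φ (suc s)) ≈[ suc n ] one ⊕ (sumSquares (suc s) n ⊕ sumSquares (suc s) n)
  φ-partialSum s n = ≈[]-trans (≈⇒≈[] φ≈) (⊕-≈[] {f = one} (λ _ _ → refl) (⊕-≈[] from1 from1))
    where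
    from1 : gen (squaresFrom s 1) ≈[ suc n ] sumSquares (suc s) n
    from1 = ≈[]-trans (≈⇒≈[] (squaresFrom-sum s n))
      (λ k k<n → trans (cong (sumSquares (suc s) n k ℚ.+_) (squaresFrom-low s (suc n) k k<n)) (ℚP.+-identityʳ (sumSquares (suc s) n k)))
    φ≈ : gen (φ (suc s)) ≈ one ⊕ (gen (squaresFrom s 1) ⊕ gen (squaresFrom s 1))
    φ≈ = begin
      gen (φ (suc s))
        ≈⟨ gen-parts (φ (suc s)) signs↔ ⟩
      gen (leftPart (φ (suc s)) signs↔) ⊕ gen (rightPart (φ (suc s)) signs↔)
        ≈⟨ ⊕-cong (gen-↔ (leftPart (φ (suc s)) signs↔) (squaresFrom s 0) id↔ (λ _ → refl))
                  (gen-↔ (rightPart (φ (suc s)) signs↔) (squaresFrom s 1) id↔ (λ _ → refl)) ⟩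
      gen (squaresFrom s 0) ⊕ gen (squaresFrom s 1)
        ≈⟨ ⊕-cong (≈-trans (squaresFrom-suc s 0) (⊕-cong (λ m → cong (λ j → qpow j m) (ℕP.*-zeroʳ (suc s))) (≈-refl {gen (squaresFrom s 1)})))
                  (≈-refl {gen (squaresFrom s 1)}) ⟩
      (one ⊕ gen (squaresFrom s 1)) ⊕ gen (squaresFrom s 1)
        ≈⟨ solve 2 (λ o g → (o :+ g) :+ g := o :+ (g :+ g)) ≈-refl one (gen (squaresFrom s 1)) ⟩
      one ⊕ (gen (squaresFrom s 1) ⊕ gen (squaresFrom s 1)) ∎
      where open ≈-Reasoning

  sign : ℕ → Series
  sign zero    = one
  sign (suc n) = negS (sign n)

  altSquares : ℕ → ℕ → Series
  altSquares s zero    = zeroS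
  altSquares s (suc n) = altSquares s n ⊕ sign (suc n) ⊗ qpow (s ℕ.* (suc n ℕ.* suc n))

  double : ℕ → ℕ
  double zero    = 0
  double (suc n) = suc (suc (double n))

  n≤double : ∀ n → n ℕ.≤ double n
  n≤double zero    = z≤n
  n≤double (suc n) = s≤s (ℕP.m≤n⇒m≤1+n (n≤double n))

  double≡2* : ∀ n → double n ≡ 2 ℕ.* n
  double≡2* zero    = refl
  double≡2* (suc n) = trans (cong (λ m → suc (suc m)) (double≡2* n)) (sym (ℕP.*-suc 2 n))

  sign-double : ∀ n → sign (double n) ≈ one
  sign-double zero    = ≈-refl
  sign-double (suc n) = ≈-trans (negS-cong (negS-cong (sign-double n))) (solve 1 (λ o → :- (:- o) := o) ≈-refl one)

  -- The factor (-1)ᵏ + 1 removes odd k and doubles even k, whose squares are 4 times all squares.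
  altSquares+sumSquares : ∀ s n → altSquares s (double n) ⊕ sumSquares s (double n) ≈
                                  sumSquares (4 ℕ.* s) n ⊕ sumSquares (4 ℕ.* s) n
  altSquares+sumSquares s zero    = λ _ → refl
  altSquares+sumSquares s (suc n) = begin
    (A ⊕ negS σ ⊗ q₁ ⊕ negS (negS σ) ⊗ q₂) ⊕ (B ⊕ q₁ ⊕ q₂)
      ≈⟨ ⊕-cong (⊕-cong (⊕-cong (≈-refl {A}) (⊗-congʳ {g = q₁} (negS-cong (sign-double n))))
           (⊗-congʳ {g = q₂} (negS-cong (negS-cong (sign-double n))))) (≈-refl {B ⊕ q₁ ⊕ q₂}) ⟩
    (A ⊕ negS one ⊗ q₁ ⊕ negS (negS one) ⊗ q₂) ⊕ (B ⊕ q₁ ⊕ q₂)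
      ≈⟨ solve 4 (λ a b q₁ q₂ → (a :+ :- con (+ 1) :* q₁ :+ :- (:- con (+ 1)) :* q₂) :+ (b :+ q₁ :+ q₂)
           := (a :+ b) :+ (q₂ :+ q₂)) ≈-refl A B q₁ q₂ ⟩
    (A ⊕ B) ⊕ (q₂ ⊕ q₂)
      ≈⟨ ⊕-cong (altSquares+sumSquares s n) (λ m → cong₂ ℚ._+_ (q₂≡ m) (q₂≡ m)) ⟩
    (S ⊕ S) ⊕ (q₄ ⊕ q₄)
      ≈⟨ solve 2 (λ s q → (s :+ s) :+ (q :+ q) := (s :+ q) :+ (s :+ q)) ≈-refl S q₄ ⟩
    (S ⊕ q₄) ⊕ (S ⊕ q₄) ∎
    where
    open ≈-Reasoning
    A = altSquares s (double n)
    B = sumSquares s (double n)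
    S = sumSquares (4 ℕ.* s) n
    σ = sign (double n)
    q₁ = qpow (s ℕ.* (suc (double n) ℕ.* suc (double n)))
    q₂ = qpow (s ℕ.* (double (suc n) ℕ.* double (suc n)))
    q₄ = qpow (4 ℕ.* s ℕ.* (suc n ℕ.* suc n))
    exponent : s ℕ.* (double (suc n) ℕ.* double (suc n)) ≡ 4 ℕ.* s ℕ.* (suc n ℕ.* suc n)
    exponent = trans (cong (λ d → s ℕ.* (d ℕ.* d)) (double≡2* (suc n)))
      (S.solve 2 (λ s n → s S.:* (S.con 2 S.:* n S.:* (S.con 2 S.:* n)) S.:= S.con 4 S.:* s S.:* (n S.:* n)) refl s (suc n))
      where module S = Data.Nat.Solver.+-*-Solver
    q₂≡ : q₂ ≈ q₄
    q₂≡ m = cong (λ j → qpow j m) exponent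

  -- φ(-q) = 2 φ(q⁴) - φ(q), in the variable q^s
  φ⁻ : ℕ → Series
  φ⁻ s = gen (φ (4 ℕ.* s)) ⊕ gen (φ (4 ℕ.* s)) ⊕ negS (gen (φ s))

  -- The alternating sum stops at an even index because n terms of φ(y⁴) account for the even
  -- squares among 2n terms of φ(y).
  φ⁻-partialSum : ∀ s n → φ⁻ (suc s) ≈[ suc n ] one ⊕ (altSquares (suc s) (double n) ⊕ altSquares (suc s) (double n))
  φ⁻-partialSum s n = ≈[]-trans
    (⊕-≈[] (⊕-≈[] φ₄ φ₄) (negS-≈[] (≈[]-weaken (s≤s (n≤double n)) (φ-partialSum s (double n)))))
    (≈⇒≈[] (begin
      (one ⊕ (S ⊕ S)) ⊕ (one ⊕ (S ⊕ S)) ⊕ negS (one ⊕ (B ⊕ B))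
        ≈⟨ ⊕-cong (⊕-cong (⊕-cong (≈-refl {one}) e) (⊕-cong (≈-refl {one}) e)) (≈-refl {negS (one ⊕ (B ⊕ B))}) ⟩
      (one ⊕ (A ⊕ B)) ⊕ (one ⊕ (A ⊕ B)) ⊕ negS (one ⊕ (B ⊕ B))
        ≈⟨ solve 3 (λ o a b → (o :+ (a :+ b)) :+ (o :+ (a :+ b)) :+ :- (o :+ (b :+ b))
             := o :+ (a :+ a)) ≈-refl one A B ⟩
      one ⊕ (A ⊕ A) ∎))
    where
    open ≈-Reasoning
    A = altSquares (suc s) (double n)
    B = sumSquares (suc s) (double n)
    S = sumSquares (4 ℕ.* suc s) n
    e : S ⊕ S ≈ A ⊕ B
    e = ≈-sym (altSquares+sumSquares (suc s) n)
    φ₄ : gen (φ (4 ℕ.* suc s)) ≈[ suc n ] one ⊕ (S ⊕ S)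
    φ₄ = φ-partialSum (ℕ.pred (4 ℕ.* suc s)) n

  qpow-≡ : ∀ {a b} → a ≡ b → qpow a ≈ qpow b
  qpow-≡ refl = ≈-refl

  -- Shanks' finite form of Gauss's product for φ(-x), x = q^(1+s): with aₙ = ∏ (1 - xᵏ) and bₙ = ∏ (1 + xᵏ),
  -- bₙ (1 + 2 Σ_{k ≤ n} (-1)ᵏ x^(k²)) is aₙ plus multiples of x^(n+1).
  module Shanks (s : ℕ) where
    X : ℕ → Series
    X k = qpow (suc s ℕ.* k)

    X-+ : ∀ a b → X (a ℕ.+ b) ≈ X a ⊗ X b
    X-+ a b = ≈-trans (qpow-≡ (ℕP.*-distribˡ-+ (suc s) a b)) (qpow-+ (suc s ℕ.* a) (suc s ℕ.* b))

    X-0 : X 0 ≈ one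
    X-0 = qpow-≡ (ℕP.*-zeroʳ (suc s))

    -- The quotient aₖ₊ᵢ/aₖ, written as a product.
    run : ℕ → ℕ → Series
    run k zero    = one
    run k (suc i) = run k i ⊗ (one ⊕ negS (X (k ℕ.+ suc i)))

    run-first : ∀ k i → run k (suc i) ≈ (one ⊕ negS (X (suc k))) ⊗ run (suc k) i
    run-first k zero    = ≈-trans (⊗-congˡ {one} (⊕-cong (≈-refl {one}) (negS-cong (qpow-≡ (cong (suc s ℕ.*_) (ℕP.+-comm k 1))))))
      (⊗-comm one (one ⊕ negS (X (suc k))))
    run-first k (suc i) = begin
      run k (suc i) ⊗ (one ⊕ negS (X (k ℕ.+ suc (suc i))))
        ≈⟨ ⊗-cong (run-first k i) (⊕-cong (≈-refl {one}) (negS-cong (qpow-≡ (cong (suc s ℕ.*_) (ℕP.+-suc k (suc i)))))) ⟩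
      ((one ⊕ negS (X (suc k))) ⊗ run (suc k) i) ⊗ (one ⊕ negS (X (suc k ℕ.+ suc i)))
        ≈⟨ ⊗-assoc (one ⊕ negS (X (suc k))) (run (suc k) i) (one ⊕ negS (X (suc k ℕ.+ suc i))) ⟩
      (one ⊕ negS (X (suc k))) ⊗ run (suc k) (suc i) ∎
      where open ≈-Reasoning

    -- (-1)ᵏ times the product of 1 + xʲ over 0 ≤ j < k. The factor with j = 0 supplies the 2 in
    -- front of the alternating sum.
    weight : ℕ → Series
    weight zero    = one
    weight (suc k) = negS (weight k ⊗ (one ⊕ X k))

    -- With n = k + i, `term k i` is the k-th summand of Shanks' sum for n, and `edge k i` is the
    -- boundary term left when n is raised by one. Indexing by i = n - k avoids truncated
    -- subtraction and quotients.
    term edge : ℕ → ℕ → Series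
    term k i = weight k ⊗ run k i ⊗ X (k ℕ.* suc (k ℕ.+ i))
    edge k i = weight (suc k) ⊗ run k i ⊗ X (suc k ℕ.* suc (k ℕ.+ i))

    partial : ℕ → ℕ → Series
    partial zero    i = term 0 i
    partial (suc k) i = partial k (suc i) ⊕ term (suc k) i

    edge-step : ∀ k i → edge k (suc i) ⊕ term (suc k) (suc i) ≈
                        (one ⊕ X (suc (suc k ℕ.+ i))) ⊗ term (suc k) i ⊕ edge (suc k) i
    edge-step k i = begin
      w ⊗ run k (suc i) ⊗ X (suc k ℕ.* suc (k ℕ.+ suc i)) ⊕ w ⊗ (C ⊗ (one ⊕ negS (X (suc k ℕ.+ suc i)))) ⊗ X (suc k ℕ.* suc (suc k ℕ.+ suc i))
        ≈⟨ ⊕-cong (⊗-cong (⊗-congˡ {w} (run-first k i)) (qpow-≡ (cong (λ m → suc s ℕ.* (suc k ℕ.* suc m)) (ℕP.+-suc k i))))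
                  (⊗-cong (⊗-congˡ {w} (⊗-congˡ {C} (⊕-cong (≈-refl {one}) (negS-cong y≈)))) Yz≈) ⟩
      w ⊗ ((one ⊕ negS z) ⊗ C) ⊗ Y ⊕ w ⊗ (C ⊗ (one ⊕ negS y)) ⊗ (z ⊗ Y)
        ≈⟨ solve 5 (λ w C Y y z → w :* ((con (+ 1) :+ :- z) :* C) :* Y :+ w :* (C :* (con (+ 1) :+ :- y)) :* (z :* Y)
             := (con (+ 1) :+ y) :* (w :* C :* Y) :+ :- (w :* (con (+ 1) :+ z)) :* C :* (y :* Y)) ≈-refl w C Y y z ⟩
      (one ⊕ y) ⊗ (w ⊗ C ⊗ Y) ⊕ negS (w ⊗ (one ⊕ z)) ⊗ C ⊗ (y ⊗ Y)
        ≈⟨ ⊕-cong (≈-refl {(one ⊕ y) ⊗ (w ⊗ C ⊗ Y)}) (⊗-congˡ {weight (suc (suc k)) ⊗ C} (X-+ n (suc k ℕ.* n))) ⟨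
      (one ⊕ y) ⊗ term (suc k) i ⊕ edge (suc k) i ∎
      where
      open ≈-Reasoning
      n = suc (suc k ℕ.+ i)
      w = weight (suc k)
      C = run (suc k) i
      z = X (suc k)
      y = X n
      Y = X (suc k ℕ.* n)
      y≈ : X (suc k ℕ.+ suc i) ≈ y
      y≈ = qpow-≡ (cong (suc s ℕ.*_) (ℕP.+-suc (suc k) i))
      Yz≈ : X (suc k ℕ.* suc (suc k ℕ.+ suc i)) ≈ z ⊗ Y
      Yz≈ = ≈-trans (qpow-≡ (cong (suc s ℕ.*_) (trans (cong (λ m → suc k ℕ.* suc m) (ℕP.+-suc (suc k) i)) (ℕP.*-suc (suc k) n))))
                    (X-+ (suc k) (suc k ℕ.* n))

    -- Passing from n to n + 1 multiplies the partial sum by 1 + xⁿ⁺¹ up to a single boundary term: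
    -- the discrepancies of the summands telescope by `edge-step`.
    partial-step : ∀ k i → partial k (suc i) ≈ (one ⊕ X (suc (k ℕ.+ i))) ⊗ partial k i ⊕ edge k i
    partial-step zero i = begin
      one ⊗ (R ⊗ (one ⊕ negS x)) ⊗ X 0
        ≈⟨ ⊗-congˡ {one ⊗ (R ⊗ (one ⊕ negS x))} X-0 ⟩
      one ⊗ (R ⊗ (one ⊕ negS x)) ⊗ one
        ≈⟨ solve 2 (λ R x → con (+ 1) :* (R :* (con (+ 1) :+ :- x)) :* con (+ 1)
             := (con (+ 1) :+ x) :* (con (+ 1) :* R :* con (+ 1)) :+ :- (con (+ 1) :* (con (+ 1) :+ con (+ 1))) :* R :* x) ≈-refl R x ⟩
      (one ⊕ x) ⊗ (one ⊗ R ⊗ one) ⊕ negS (one ⊗ (one ⊕ one)) ⊗ R ⊗ x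
        ≈⟨ ⊕-cong (⊗-congˡ {one ⊕ x} (⊗-congˡ {one ⊗ R} X-0))
                  (⊗-cong (⊗-congʳ {g = R} (negS-cong (⊗-congˡ {one} (⊕-cong (≈-refl {one}) X-0))))
                          (qpow-≡ (cong (suc s ℕ.*_) (ℕP.*-identityˡ (suc i))))) ⟨
      (one ⊕ x) ⊗ (one ⊗ R ⊗ X 0) ⊕ negS (one ⊗ (one ⊕ X 0)) ⊗ R ⊗ X (1 ℕ.* suc i) ∎
      where
      open ≈-Reasoning
      R = run 0 i
      x = X (suc i)
    partial-step (suc k) i = begin
      partial k (suc (suc i)) ⊕ term (suc k) (suc i)
        ≈⟨ ⊕-cong (partial-step k (suc i)) (≈-refl {term (suc k) (suc i)}) ⟩
      ((one ⊕ X (suc (k ℕ.+ suc i))) ⊗ p ⊕ edge k (suc i)) ⊕ term (suc k) (suc i)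
        ≈⟨ ⊕-cong (⊕-cong (⊗-congʳ {g = p} (⊕-cong (≈-refl {one}) (qpow-≡ (cong (λ m → suc s ℕ.* suc m) (ℕP.+-suc k i))))) (≈-refl {edge k (suc i)}))
                  (≈-refl {term (suc k) (suc i)}) ⟩
      ((one ⊕ y) ⊗ p ⊕ edge k (suc i)) ⊕ term (suc k) (suc i)
        ≈⟨ solve 3 (λ a b c → (a :+ b) :+ c := a :+ (b :+ c)) ≈-refl ((one ⊕ y) ⊗ p) (edge k (suc i)) (term (suc k) (suc i)) ⟩
      (one ⊕ y) ⊗ p ⊕ (edge k (suc i) ⊕ term (suc k) (suc i))
        ≈⟨ ⊕-cong (≈-refl {(one ⊕ y) ⊗ p}) (edge-step k i) ⟩
      (one ⊕ y) ⊗ p ⊕ ((one ⊕ y) ⊗ term (suc k) i ⊕ edge (suc k) i)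
        ≈⟨ solve 4 (λ y p t e → y :* p :+ (y :* t :+ e) := y :* (p :+ t) :+ e) ≈-refl (one ⊕ y) p (term (suc k) i) (edge (suc k) i) ⟩
      (one ⊕ y) ⊗ (p ⊕ term (suc k) i) ⊕ edge (suc k) i ∎
      where
      open ≈-Reasoning
      p = partial k (suc i)
      y = X (suc (suc k ℕ.+ i))

    productPlus : ℕ → Series
    productPlus zero    = one
    productPlus (suc n) = productPlus n ⊗ (one ⊕ X (suc n))

    weight-product : ∀ n → weight (suc n) ≈ (one ⊕ one) ⊗ (sign (suc n) ⊗ productPlus n)
    weight-product zero = ≈-trans (negS-cong (⊗-congˡ {one} (⊕-cong (≈-refl {one}) X-0)))
      (solve 0 (:- (con (+ 1) :* (con (+ 1) :+ con (+ 1))) := (con (+ 1) :+ con (+ 1)) :* (:- con (+ 1) :* con (+ 1))) ≈-refl)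
    weight-product (suc n) = ≈-trans (negS-cong (⊗-congʳ {g = one ⊕ X (suc n)} (weight-product n)))
      (solve 3 (λ σ p x → :- ((con (+ 1) :+ con (+ 1)) :* (σ :* p) :* x) := (con (+ 1) :+ con (+ 1)) :* (:- σ :* (p :* x)))
         ≈-refl (sign (suc n)) (productPlus n) (one ⊕ X (suc n)))

    alternating : ℕ → Series
    alternating n = one ⊕ (altSquares (suc s) n ⊕ altSquares (suc s) n)

    -- At i = 0 the boundary term and the newly added last term differ by the factor xⁿ⁺¹; together
    -- they give the new factor 1 + xⁿ⁺¹ of `productPlus` times the next alternating square.
    partial-closed : ∀ n → partial n 0 ≈ productPlus n ⊗ alternating n
    partial-closed zero = ≈-trans (⊗-congˡ {one ⊗ one} X-0)
      (λ m → trans (solve 0 (con (+ 1) :* con (+ 1) :* con (+ 1) := con (+ 1) :* (con (+ 1) :+ (con (+ 0) :+ con (+ 0)))) ≈-refl m) refl)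
    partial-closed (suc n) = begin
      partial n 1 ⊕ term (suc n) 0
        ≈⟨ ⊕-cong (partial-step n 0) (≈-refl {term (suc n) 0}) ⟩
      ((one ⊕ X (suc (n ℕ.+ 0))) ⊗ partial n 0 ⊕ w ⊗ one ⊗ X (suc n ℕ.* suc (n ℕ.+ 0))) ⊕ w ⊗ one ⊗ X (suc n ℕ.* suc (suc n ℕ.+ 0))
        ≈⟨ ⊕-cong (⊕-cong (⊗-cong (⊕-cong (≈-refl {one}) (qpow-≡ (cong (λ m → suc s ℕ.* suc m) (ℕP.+-identityʳ n)))) (partial-closed n))
                          (⊗-cong w≈ (qpow-≡ (cong (λ m → suc s ℕ.* (suc n ℕ.* suc m)) (ℕP.+-identityʳ n)))))
                  (⊗-cong w≈ last≈) ⟩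
      ((one ⊕ x) ⊗ (P ⊗ (one ⊕ (A ⊕ A))) ⊕ (one ⊕ one) ⊗ (σ ⊗ P) ⊗ one ⊗ x²) ⊕ (one ⊕ one) ⊗ (σ ⊗ P) ⊗ one ⊗ (x ⊗ x²)
        ≈⟨ solve 5 (λ x P A σ x² → ((con (+ 1) :+ x) :* (P :* (con (+ 1) :+ (A :+ A))) :+ (con (+ 1) :+ con (+ 1)) :* (σ :* P) :* con (+ 1) :* x²)
                                    :+ (con (+ 1) :+ con (+ 1)) :* (σ :* P) :* con (+ 1) :* (x :* x²)
             := (P :* (con (+ 1) :+ x)) :* (con (+ 1) :+ ((A :+ σ :* x²) :+ (A :+ σ :* x²)))) ≈-refl x P A σ x² ⟩
      (P ⊗ (one ⊕ x)) ⊗ (one ⊕ ((A ⊕ σ ⊗ x²) ⊕ (A ⊕ σ ⊗ x²))) ∎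
      where
      open ≈-Reasoning
      w = weight (suc n)
      P = productPlus n
      A = altSquares (suc s) n
      σ = sign (suc n)
      x = X (suc n)
      x² = X (suc n ℕ.* suc n)
      w≈ : w ⊗ one ≈ (one ⊕ one) ⊗ (σ ⊗ P) ⊗ one
      w≈ = ⊗-congʳ {g = one} (weight-product n)
      last≈ : X (suc n ℕ.* suc (suc n ℕ.+ 0)) ≈ x ⊗ x²
      last≈ = ≈-trans (qpow-≡ (cong (suc s ℕ.*_) (trans (cong (λ m → suc n ℕ.* suc m) (ℕP.+-identityʳ (suc n))) (ℕP.*-suc (suc n) (suc n)))))
                      (X-+ (suc n) (suc n ℕ.* suc n))

    -- The k-th summand carries the exponent k(n + 1), so modulo the stated power only the summand k
    -- = 0, which is aₙ, survives.
    partial-run : ∀ k i → partial k i ≈[ suc (k ℕ.+ i) ] run 0 (k ℕ.+ i)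
    partial-run zero    i = ≈⇒≈[] (≈-trans (⊗-congˡ {one ⊗ run 0 i} X-0)
      (solve 1 (λ r → con (+ 1) :* r :* con (+ 1) := r) ≈-refl (run 0 i)))
    partial-run (suc k) i n n< = trans (cong₂ ℚ._+_
        (trans (partial-run k (suc i) n (subst (λ m → n ℕ.< suc m) (sym (ℕP.+-suc k i)) n<)) (cong (λ m → run 0 m n) (ℕP.+-suc k i)))
        (trans (⊗-comm (weight (suc k) ⊗ run (suc k) i) (X (suc k ℕ.* suc (suc k ℕ.+ i))) n)
               (qpow-low (suc s ℕ.* (suc k ℕ.* suc (suc k ℕ.+ i))) (weight (suc k) ⊗ run (suc k) i) n
                 (ℕP.<-≤-trans n< (ℕP.≤-trans (ℕP.m≤n*m (suc (suc k ℕ.+ i)) (suc k)) (ℕP.m≤n*m (suc k ℕ.* suc (suc k ℕ.+ i)) (suc s)))))))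
      (ℚP.+-identityʳ (run 0 (suc k ℕ.+ i) n))

  oneMinusPow≈ : ∀ j → oneMinusPow (suc j) ≈ one ⊕ negS (qpow (suc j))
  oneMinusPow≈ j zero = refl
  oneMinusPow≈ j (suc n) with suc n ℕ.≟ suc j
  ... | yes refl = sym (cong (λ x → 0ℚ ℚ.+ ℚ.- x) (diagonal j))
    where
    diagonal : ∀ k → qpow k k ≡ 1ℚ
    diagonal zero    = refl
    diagonal (suc k) = diagonal k
  ... | no n≢j = sym (cong (λ x → 0ℚ ℚ.+ ℚ.- x) (off n j (λ e → n≢j (cong suc e))))
    where
    off : ∀ n k → n ≢ k → qpow k n ≡ 0ℚ
    off zero    zero    n≢k = ⊥-elim (n≢k refl)
    off zero    (suc k) _   = refl
    off (suc n) zero    _   = refl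
    off (suc n) (suc k) n≢k = off n k (λ e → n≢k (cong suc e))

  oneMinusPow≈[]one : ∀ j → oneMinusPow (suc j) ≈[ suc j ] one
  oneMinusPow≈[]one j n n<j = trans (oneMinusPow≈ j n)
    (trans (cong (λ x → one n ℚ.+ ℚ.- x) (qpow-low′ (suc j) n n<j)) (ℚP.+-identityʳ (one n)))

  partialE-stable : ∀ s {n} N → n ℕ.≤ N → partialE (suc s) N n ≡ partialE (suc s) n n
  partialE-stable s zero    z≤n = refl
  partialE-stable s {n} (suc N) n≤N with ℕP.m≤n⇒m<n∨m≡n n≤N
  ... | inj₂ refl = refl
  ... | inj₁ (s≤s n≤N′) = trans
    (⊗-≈[] {suc s ℕ.* suc N} {partialE (suc s) N} (λ _ _ → refl) (oneMinusPow≈[]one (ℕ.pred (suc s ℕ.* suc N))) n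
      (ℕP.<-≤-trans (s≤s n≤N′) (ℕP.m≤n*m (suc N) (suc s))))
    (trans (⊗-comm (partialE (suc s) N) one n) (trans (⊗-identityˡ (partialE (suc s) N) n) (partialE-stable s N n≤N′)))

  E≈[]partialE : ∀ s N → E (suc s) ≈[ suc N ] partialE (suc s) N
  E≈[]partialE s N n (s≤s n≤N) = sym (partialE-stable s N n≤N)

  E≈[]one : ∀ s → E (suc s) ≈[ suc s ] one
  E≈[]one s zero    _         = refl
  E≈[]one s (suc n) (s≤s n<s) = go (suc n) (suc n) (s≤s n<s)
    where
    go : ∀ N n → n ℕ.< suc s → partialE (suc s) N n ≡ one n
    go zero    n n<s = refl
    go (suc N) n n<s = trans
      (⊗-≈[] {suc s} {partialE (suc s) N} {one} (go N)
        (≈[]-weaken (ℕP.m≤m*n (suc s) (suc N)) (oneMinusPow≈[]one (ℕ.pred (suc s ℕ.* suc N)))) n n<s)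
      (⊗-identityˡ one n)

  -- The truncation of E(x²) is aₙbₙ by `partialE-double`, and Shanks' identity replaces bₙ times
  -- the alternating sum by aₙ modulo high powers of q.
  φ⁻-product : ∀ s → φ⁻ (suc s) ⊗ E (2 ℕ.* suc s) ≈ E² (suc s)
  φ⁻-product s N = (begin
    φ⁻ (suc s) ⊗ E (2 ℕ.* suc s)
      ≈⟨ ⊗-≈[] (φ⁻-partialSum s N) (E≈[]partialE (ℕ.pred (2 ℕ.* suc s)) N) ⟩
    alternating (double N) ⊗ partialE (2 ℕ.* suc s) N
      ≈⟨ ⊗-≈[] {f = alternating (double N)} (λ _ _ → refl) (E≈[]partialE₂) ⟩
    alternating (double N) ⊗ partialE (2 ℕ.* suc s) (double N)
      ≈⟨ ≈⇒≈[] (⊗-congˡ {alternating (double N)} (partialE-double (double N))) ⟩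
    alternating (double N) ⊗ (partialE (suc s) (double N) ⊗ productPlus (double N))
      ≈⟨ ≈⇒≈[] (solve 3 (λ a e p → a :* (e :* p) := e :* (p :* a)) ≈-refl (alternating (double N)) (partialE (suc s) (double N)) (productPlus (double N))) ⟩
    partialE (suc s) (double N) ⊗ (productPlus (double N) ⊗ alternating (double N))
      ≈⟨ ≈⇒≈[] (⊗-congˡ {partialE (suc s) (double N)} (≈-sym (partial-closed (double N)))) ⟩
    partialE (suc s) (double N) ⊗ partial (double N) 0
      ≈⟨ ⊗-≈[] {f = partialE (suc s) (double N)} (λ _ _ → refl) partial≈ ⟩
    partialE (suc s) (double N) ⊗ partialE (suc s) (double N)
      ≈⟨ ⊗-≈[] (≈[]-sym EN) (≈[]-sym EN) ⟩
    E² (suc s) ∎) N ℕP.≤-refl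
    where
    open Shanks s
    infixr 2 _≈⟨_⟩_
    infix 3 _∎
    infix 1 begin_
    begin_ : ∀ {f g} → f ≈[ suc N ] g → f ≈[ suc N ] g
    begin e = e
    _≈⟨_⟩_ : ∀ f {g h} → f ≈[ suc N ] g → g ≈[ suc N ] h → f ≈[ suc N ] h
    f ≈⟨ e ⟩ e′ = ≈[]-trans e e′
    _∎ : ∀ f → f ≈[ suc N ] f
    f ∎ = λ _ _ → refl
    EN : E (suc s) ≈[ suc N ] partialE (suc s) (double N)
    EN = ≈[]-weaken (s≤s (n≤double N)) (E≈[]partialE s (double N))
    E≈[]partialE₂ : partialE (2 ℕ.* suc s) N ≈[ suc N ] partialE (2 ℕ.* suc s) (double N)
    E≈[]partialE₂ = ≈[]-trans (≈[]-sym (E≈[]partialE (ℕ.pred (2 ℕ.* suc s)) N))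
      (≈[]-weaken (s≤s (n≤double N)) (E≈[]partialE (ℕ.pred (2 ℕ.* suc s)) (double N)))
    run≈ : ∀ n → run 0 n ≈ partialE (suc s) n
    run≈ zero    = ≈-refl
    run≈ (suc n) = ⊗-cong (run≈ n) (≈-sym (oneMinusPow≈ (ℕ.pred (suc s ℕ.* suc n))))
    partial≈ : partial (double N) 0 ≈[ suc N ] partialE (suc s) (double N)
    partial≈ = ≈[]-weaken (s≤s (n≤double N)) (subst (λ m → partial (double N) 0 ≈[ suc m ] partialE (suc s) m) (ℕP.+-identityʳ (double N))
      (≈[]-trans (partial-run (double N) 0) (≈⇒≈[] (run≈ (double N ℕ.+ 0)))))
    partialE-double : ∀ n → partialE (2 ℕ.* suc s) n ≈ partialE (suc s) n ⊗ productPlus n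
    partialE-double zero    = ≈-sym (⊗-identityˡ one)
    partialE-double (suc n) = ≈-trans
      (⊗-cong (partialE-double n) (≈-trans (oneMinusPow≈ (ℕ.pred (2 ℕ.* suc s ℕ.* suc n))) (⊕-cong (≈-refl {one}) (negS-cong x²))))
      (≈-trans (solve 3 (λ e p x → (e :* p) :* (con (+ 1) :+ :- (x :* x)) := (e :* (con (+ 1) :+ :- x)) :* (p :* (con (+ 1) :+ x)))
                 ≈-refl (partialE (suc s) n) (productPlus n) (X (suc n)))
               (⊗-congʳ {g = productPlus (suc n)} (⊗-congˡ {partialE (suc s) n} (≈-sym (oneMinusPow≈ (ℕ.pred (suc s ℕ.* suc n)))))))
      where
      x² : qpow (2 ℕ.* suc s ℕ.* suc n) ≈ X (suc n) ⊗ X (suc n)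
      x² = ≈-trans (qpow-≡ (S.solve 2 (λ s n → S.con 2 S.:* s S.:* n S.:= s S.:* n S.:+ s S.:* n) refl (suc s) (suc n)))
                   (qpow-+ (suc s ℕ.* suc n) (suc s ℕ.* suc n))
        where module S = Data.Nat.Solver.+-*-Solver

  φ-≡ : ∀ {a b} → a ≡ b → gen (φ a) ≈ gen (φ b)
  φ-≡ refl = ≈-refl

  ψ-≡ : ∀ {a b} → a ≡ b → gen (ψ a) ≈ gen (ψ b)
  ψ-≡ refl = ≈-refl

  ψ²≈φψ : ∀ s → gen (ψ (suc s)) ⊗ gen (ψ (suc s)) ≈ gen (φ (suc s)) ⊗ gen (ψ (2 ℕ.* suc s))
  ψ²≈φψ s = begin
    gen (ψ (suc s)) ⊗ gen (ψ (suc s))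
      ≈⟨ ψ²-dissection s ⟩
    f ⊗ p ⊕ (q ⊗ (r ⊗ p) ⊕ q ⊗ (r ⊗ p))
      ≈⟨ solve 4 (λ f p q r → f :* p :+ (q :* (r :* p) :+ q :* (r :* p)) := (f :+ (q :* r :+ q :* r)) :* p) ≈-refl f p q r ⟩
    (f ⊕ (q ⊗ r ⊕ q ⊗ r)) ⊗ p
      ≈⟨ ⊗-congʳ {g = p} (φ-dissection s) ⟨
    gen (φ (suc s)) ⊗ p ∎
    where
    open ≈-Reasoning
    f = gen (φ (4 ℕ.* suc s))
    p = gen (ψ (2 ℕ.* suc s))
    r = gen (ψ (8 ℕ.* suc s))
    q = qpow (suc s)

  module _ (s : ℕ) where
    private
      q q² : Series
      q  = qpow (suc s)
      q² = qpow (2 ℕ.* suc s)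
      φ₄ φ₈ ψ₄ ψ₈ ψ₁₆ : Series
      φ₄  = gen (φ (4 ℕ.* suc s))
      φ₈  = gen (φ (8 ℕ.* suc s))
      ψ₄  = gen (ψ (4 ℕ.* suc s))
      ψ₈  = gen (ψ (8 ℕ.* suc s))
      ψ₁₆ = gen (ψ (16 ℕ.* suc s))

      scale : ∀ a b → a ℕ.* (b ℕ.* suc s) ≡ a ℕ.* b ℕ.* suc s
      scale a b = sym (ℕP.*-assoc a b (suc s))

      q²≈ : q² ≈ q ⊗ q
      q²≈ = ≈-trans (qpow-≡ (cong (suc s ℕ.+_) (ℕP.+-identityʳ (suc s)))) (qpow-+ (suc s) (suc s))

      q⁴≈ : qpow (4 ℕ.* suc s) ≈ q² ⊗ q²
      q⁴≈ = ≈-trans (qpow-≡ (ℕP.*-distribʳ-+ (suc s) 2 2)) (qpow-+ (2 ℕ.* suc s) (2 ℕ.* suc s))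

      φ₁≈ : gen (φ (suc s)) ≈ φ₄ ⊕ (q ⊗ ψ₈ ⊕ q ⊗ ψ₈)
      φ₁≈ = φ-dissection s

      φ₂≈ : gen (φ (2 ℕ.* suc s)) ≈ φ₈ ⊕ (q² ⊗ ψ₁₆ ⊕ q² ⊗ ψ₁₆)
      φ₂≈ = ≈-trans (φ-dissection (ℕ.pred (2 ℕ.* suc s)))
        (⊕-cong (φ-≡ (scale 4 2)) (⊕-cong (⊗-congˡ {q²} (ψ-≡ (scale 8 2))) (⊗-congˡ {q²} (ψ-≡ (scale 8 2)))))

      φ₄²≈ : φ₄ ⊗ φ₄ ≈ φ₈ ⊗ φ₈ ⊕ SR.num (+ 4) ⊗ ((q² ⊗ ψ₁₆) ⊗ (q² ⊗ ψ₁₆))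
      φ₄²≈ = ≈-trans (φ²-dissection (ℕ.pred (4 ℕ.* suc s)))
        (≈-trans (⊕-cong (⊗-cong (φ-≡ (scale 2 4)) (φ-≡ (scale 2 4))) (⊕-cong (⊕-cong c≈ c≈) (⊕-cong c≈ c≈)))
          (solve 2 (λ f g → f :* f :+ ((g :* g :+ g :* g) :+ (g :* g :+ g :* g)) := f :* f :+ con (+ 4) :* (g :* g)) ≈-refl φ₈ (q² ⊗ ψ₁₆)))
        where
        c≈ : qpow (4 ℕ.* suc s) ⊗ (gen (ψ (4 ℕ.* (4 ℕ.* suc s))) ⊗ gen (ψ (4 ℕ.* (4 ℕ.* suc s)))) ≈ (q² ⊗ ψ₁₆) ⊗ (q² ⊗ ψ₁₆)
        c≈ = ≈-trans (⊗-cong q⁴≈ (⊗-cong (ψ-≡ (scale 4 4)) (ψ-≡ (scale 4 4))))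
               (solve 2 (λ q p → (q :* q) :* (p :* p) := (q :* p) :* (q :* p)) ≈-refl q² ψ₁₆)

      ψ₈²≈ : (q ⊗ ψ₈) ⊗ (q ⊗ ψ₈) ≈ φ₈ ⊗ (q² ⊗ ψ₁₆)
      ψ₈²≈ = begin
        (q ⊗ ψ₈) ⊗ (q ⊗ ψ₈)       ≈⟨ solve 2 (λ q p → (q :* p) :* (q :* p) := (q :* q) :* (p :* p)) ≈-refl q ψ₈ ⟩
        (q ⊗ q) ⊗ (ψ₈ ⊗ ψ₈)       ≈⟨ ⊗-cong (≈-sym q²≈) (≈-trans (ψ²≈φψ (ℕ.pred (8 ℕ.* suc s))) (⊗-congˡ {φ₈} (ψ-≡ (scale 2 8)))) ⟩
        q² ⊗ (φ₈ ⊗ ψ₁₆)           ≈⟨ solve 3 (λ q f p → q :* (f :* p) := f :* (q :* p)) ≈-refl q² φ₈ ψ₁₆ ⟩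
        φ₈ ⊗ (q² ⊗ ψ₁₆)           ∎
        where open ≈-Reasoning

      φ⁻≈ : φ⁻ (suc s) ≈ φ₄ ⊕ negS (q ⊗ ψ₈ ⊕ q ⊗ ψ₈)
      φ⁻≈ = ≈-trans (⊕-cong (≈-refl {φ₄ ⊕ φ₄}) (negS-cong φ₁≈))
        (solve 2 (λ c d → c :+ c :+ :- (c :+ (d :+ d)) := c :+ :- (d :+ d)) ≈-refl φ₄ (q ⊗ ψ₈))

      φ⁻₂≈ : φ⁻ (2 ℕ.* suc s) ≈ φ₈ ⊕ negS (q² ⊗ ψ₁₆ ⊕ q² ⊗ ψ₁₆)
      φ⁻₂≈ = ≈-trans (⊕-cong (⊕-cong (φ-≡ (scale 4 2)) (φ-≡ (scale 4 2))) (negS-cong φ₂≈))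
        (solve 2 (λ c d → c :+ c :+ :- (c :+ (d :+ d)) := c :+ :- (d :+ d)) ≈-refl φ₈ (q² ⊗ ψ₁₆))

    -- With e = φ(q⁸), g = q²ψ(q¹⁶), c = φ(q⁴) and d = qψ(q⁸) at scale 1, one has c² = e² + 4g² and
    -- d² = eg; hence (c + 2d)(c - 2d) = (e - 2g)², where e - 2g = φ(-q²).
    φφ⁻≈φ⁻² : gen (φ (suc s)) ⊗ φ⁻ (suc s) ≈ φ⁻ (2 ℕ.* suc s) ⊗ φ⁻ (2 ℕ.* suc s)
    φφ⁻≈φ⁻² = begin
      gen (φ (suc s)) ⊗ φ⁻ (suc s)
        ≈⟨ ⊗-cong φ₁≈ φ⁻≈ ⟩
      (φ₄ ⊕ (d ⊕ d)) ⊗ (φ₄ ⊕ negS (d ⊕ d))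
        ≈⟨ solve 2 (λ c d → (c :+ (d :+ d)) :* (c :+ :- (d :+ d)) := c :* c :+ :- (con (+ 4) :* (d :* d))) ≈-refl φ₄ d ⟩
      φ₄ ⊗ φ₄ ⊕ negS (SR.num (+ 4) ⊗ (d ⊗ d))
        ≈⟨ ⊕-cong φ₄²≈ (negS-cong (⊗-congˡ {SR.num (+ 4)} ψ₈²≈)) ⟩
      (φ₈ ⊗ φ₈ ⊕ SR.num (+ 4) ⊗ (g ⊗ g)) ⊕ negS (SR.num (+ 4) ⊗ (φ₈ ⊗ g))
        ≈⟨ solve 2 (λ e g → (e :* e :+ con (+ 4) :* (g :* g)) :+ :- (con (+ 4) :* (e :* g)) := (e :+ :- (g :+ g)) :* (e :+ :- (g :+ g))) ≈-refl φ₈ g ⟩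
      (φ₈ ⊕ negS (g ⊕ g)) ⊗ (φ₈ ⊕ negS (g ⊕ g))
        ≈⟨ ⊗-cong φ⁻₂≈ φ⁻₂≈ ⟨
      φ⁻ (2 ℕ.* suc s) ⊗ φ⁻ (2 ℕ.* suc s) ∎
      where
      open ≈-Reasoning
      d = q ⊗ ψ₈
      g = q² ⊗ ψ₁₆

    -- In the same notation (c - 2d)² = (e + 2g)² - 4cd, with e + 2g = φ(q²) and cd = qφ(q⁴)ψ(q⁸) =
    -- qψ(q⁴)².
    φ⁻²≈ : φ⁻ (suc s) ⊗ φ⁻ (suc s) ≈ gen (φ (2 ℕ.* suc s)) ⊗ gen (φ (2 ℕ.* suc s)) ⊕ negS (SR.num (+ 4) ⊗ (q ⊗ (ψ₄ ⊗ ψ₄)))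
    φ⁻²≈ = begin
      φ⁻ (suc s) ⊗ φ⁻ (suc s)
        ≈⟨ ⊗-cong φ⁻≈ φ⁻≈ ⟩
      (φ₄ ⊕ negS (q ⊗ ψ₈ ⊕ q ⊗ ψ₈)) ⊗ (φ₄ ⊕ negS (q ⊗ ψ₈ ⊕ q ⊗ ψ₈))
        ≈⟨ solve 3 (λ c q p → (c :+ :- (q :* p :+ q :* p)) :* (c :+ :- (q :* p :+ q :* p))
             := c :* c :+ con (+ 4) :* ((q :* p) :* (q :* p)) :+ :- (con (+ 4) :* (q :* (c :* p)))) ≈-refl φ₄ q ψ₈ ⟩
      φ₄ ⊗ φ₄ ⊕ SR.num (+ 4) ⊗ ((q ⊗ ψ₈) ⊗ (q ⊗ ψ₈)) ⊕ negS (SR.num (+ 4) ⊗ (q ⊗ (φ₄ ⊗ ψ₈)))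
        ≈⟨ ⊕-cong (⊕-cong φ₄²≈ (⊗-congˡ {SR.num (+ 4)} ψ₈²≈))
                  (negS-cong (⊗-congˡ {SR.num (+ 4)} (⊗-congˡ {q} (≈-sym (≈-trans (ψ²≈φψ (ℕ.pred (4 ℕ.* suc s))) (⊗-congˡ {φ₄} (ψ-≡ (scale 2 4)))))))) ⟩
      φ₈ ⊗ φ₈ ⊕ SR.num (+ 4) ⊗ (g ⊗ g) ⊕ SR.num (+ 4) ⊗ (φ₈ ⊗ g) ⊕ negS u
        ≈⟨ solve 3 (λ e g u → e :* e :+ con (+ 4) :* (g :* g) :+ con (+ 4) :* (e :* g) :+ :- u := (e :+ (g :+ g)) :* (e :+ (g :+ g)) :+ :- u) ≈-refl φ₈ g u ⟩
      (φ₈ ⊕ (g ⊕ g)) ⊗ (φ₈ ⊕ (g ⊕ g)) ⊕ negS u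
        ≈⟨ ⊕-cong (⊗-cong φ₂≈ φ₂≈) (≈-refl {negS u}) ⟨
      gen (φ (2 ℕ.* suc s)) ⊗ gen (φ (2 ℕ.* suc s)) ⊕ negS u ∎
      where
      open ≈-Reasoning
      g = q² ⊗ ψ₁₆
      u = SR.num (+ 4) ⊗ (q ⊗ (ψ₄ ⊗ ψ₄))

  -- The squares of both sides at s are the two sides at 2s multiplied by φ(-q^(2s))²; modulo q^M both are 1 once s ≥ M.
  ψ-product-≈[] : ∀ d s M → M ℕ.≤ suc s ℕ.+ d → gen (ψ (suc s)) ⊗ E (suc s) ≈[ M ] E² (2 ℕ.* suc s)
  ψ-product-≈[] zero s M M≤ = ≈[]-weaken (subst (M ℕ.≤_) (ℕP.+-identityʳ (suc s)) M≤)
    (≈[]-trans (⊗-≈[] (ψ≈[]one s) (E≈[]one s)) (≈[]-sym (⊗-≈[] E₂ E₂)))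
    where
    E₂ : E (2 ℕ.* suc s) ≈[ suc s ] one
    E₂ = ≈[]-weaken (ℕP.m≤m+n (suc s) (suc s ℕ.+ 0)) (E≈[]one (ℕ.pred (2 ℕ.* suc s)))
  ψ-product-≈[] (suc d) s M M≤ = square-injective-≈[] (p ⊗ e₁) (e₂ ⊗ e₂) (λ e → 2≢0 (trans (sym value) e))
    (≈[]-trans (≈⇒≈[] doubled) (≈[]-trans (⊗-≈[] {f = f₂ ⊗ f₂} (λ _ _ → refl) step) (≈⇒≈[] closed)))
    where
    open ≈-Reasoning
    p  = gen (ψ (suc s))
    p₂ = gen (ψ (2 ℕ.* suc s))
    e₁ = E (suc s)
    e₂ = E (2 ℕ.* suc s)
    e₄ = E (2 ℕ.* (2 ℕ.* suc s))
    f  = gen (φ (suc s))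
    f₁ = φ⁻ (suc s)
    f₂ = φ⁻ (2 ℕ.* suc s)
    value : (p ⊗ e₁ ⊕ e₂ ⊗ e₂) 0 ≡ 1ℚ ℚ.+ 1ℚ
    value = cong (λ x → x ℚ.* 1ℚ ℚ.+ 1ℚ) (ψ≈[]one s 0 (s≤s z≤n))
    2≢0 : 1ℚ ℚ.+ 1ℚ ≢ 0ℚ
    2≢0 ()
    step : p₂ ⊗ e₂ ≈[ M ] e₄ ⊗ e₄
    step = ψ-product-≈[] d (ℕ.pred (2 ℕ.* suc s)) M (ℕP.≤-trans M≤ bound)
      where
      -- Doubling the scale raises it by at least one, which pays for the decrease of `d`.
      bound : suc s ℕ.+ suc d ℕ.≤ 2 ℕ.* suc s ℕ.+ d
      bound = subst (ℕ._≤ 2 ℕ.* suc s ℕ.+ d) (sym (ℕP.+-suc (suc s) d))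
                (ℕP.+-monoˡ-≤ d (s≤s (ℕP.m<m+n s {suc s ℕ.+ 0} (s≤s z≤n))))
    doubled : (p ⊗ e₁) ⊗ (p ⊗ e₁) ≈ (f₂ ⊗ f₂) ⊗ (p₂ ⊗ e₂)
    doubled = begin
      (p ⊗ e₁) ⊗ (p ⊗ e₁)         ≈⟨ solve 2 (λ p e → (p :* e) :* (p :* e) := (p :* p) :* (e :* e)) ≈-refl p e₁ ⟩
      (p ⊗ p) ⊗ (e₁ ⊗ e₁)         ≈⟨ ⊗-cong (ψ²≈φψ s) (≈-sym (φ⁻-product s)) ⟩
      (f ⊗ p₂) ⊗ (f₁ ⊗ e₂)        ≈⟨ solve 4 (λ f p g e → (f :* p) :* (g :* e) := (f :* g) :* (p :* e)) ≈-refl f p₂ f₁ e₂ ⟩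
      (f ⊗ f₁) ⊗ (p₂ ⊗ e₂)        ≈⟨ ⊗-congʳ {g = p₂ ⊗ e₂} (φφ⁻≈φ⁻² s) ⟩
      (f₂ ⊗ f₂) ⊗ (p₂ ⊗ e₂)       ∎
    closed : (f₂ ⊗ f₂) ⊗ (e₄ ⊗ e₄) ≈ (e₂ ⊗ e₂) ⊗ (e₂ ⊗ e₂)
    closed = begin
      (f₂ ⊗ f₂) ⊗ (e₄ ⊗ e₄)       ≈⟨ solve 2 (λ f e → (f :* f) :* (e :* e) := (f :* e) :* (f :* e)) ≈-refl f₂ e₄ ⟩
      (f₂ ⊗ e₄) ⊗ (f₂ ⊗ e₄)       ≈⟨ ⊗-cong (φ⁻-product (ℕ.pred (2 ℕ.* suc s))) (φ⁻-product (ℕ.pred (2 ℕ.* suc s))) ⟩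
      (e₂ ⊗ e₂) ⊗ (e₂ ⊗ e₂)       ∎

  ψ-product : ∀ s → gen (ψ (suc s)) ⊗ E (suc s) ≈ E² (2 ℕ.* suc s)
  ψ-product s n = ψ-product-≈[] (suc n) s (suc n) (ℕP.m≤n+m (suc n) (suc s)) n ℕP.≤-refl

-- Specialisation to the theta series of the theorem, with choice of signs.

open ≡ using (_≢_)
open SeriesAlgebra
open SR using (solve; _:=_; _:+_; _:*_; _:-_; con)
open ≈-Reasoning
open GradedSets
open Lattices
open Products

private
  module D = DegreeSeven seriesRing

  f₁ f₂ f₇ f₁₄ p₁ p₂ p₄ p₇ p₁₄ p₂₈ : Series
  f₁  = gen (φ 1)
  f₂  = gen (φ 2)
  f₇  = gen (φ 7)
  f₁₄ = gen (φ 14)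
  p₁  = gen (ψ 1)
  p₂  = gen (ψ 2)
  p₄  = gen (ψ 4)
  p₇  = gen (ψ 7)
  p₁₄ = gen (ψ 14)
  p₂₈ = gen (ψ 28)

  w B a b Y N P t₃ : Series
  w = f₂ ⊗ f₁₄
  B = f₁ ⊗ f₇
  a = f₁ ⊗ f₁₄
  b = f₂ ⊗ f₇
  Y = qpow 1 ⊗ (p₁ ⊗ p₇)
  N = qpow 2 ⊗ (p₂ ⊗ p₁₄)
  P = qpow 4 ⊗ (p₄ ⊗ p₂₈)
  t₃ = gen T

  2# 4# : Series
  2# = SR.num (+ 2)
  4# = SR.num (+ 4)

  θ₁≈ : gen (θ 1) ≈ gen (θ 2) ⊕ (Y ⊕ Y)
  θ₁≈ = ≈-trans (θ-halving 0) (⊕-cong (≈-refl {gen (θ 2)}) (κ≈2qψψ 0))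

  κ₂≈ : gen (κ 2) ≈ N ⊕ N
  κ₂≈ = κ≈2qψψ 1

  κ₄≈ : gen (κ 4) ≈ P ⊕ P
  κ₄≈ = κ≈2qψψ 3

  θ₂≈ : gen (θ 2) ≈ gen (θ 4) ⊕ (N ⊕ N)
  θ₂≈ = ≈-trans (θ-halving 1) (⊕-cong (≈-refl {gen (θ 4)}) κ₂≈)

  θ₄≈ : gen (θ 4) ≈ gen (θ 8) ⊕ (P ⊕ P)
  θ₄≈ = ≈-trans (θ-halving 3) (⊕-cong (≈-refl {gen (θ 8)}) κ₄≈)

  θ₁≈B : gen (θ 1) ≈ B ⊕ ((N ⊕ N) ⊕ (N ⊕ N))
  θ₁≈B = ≈-trans (θ≈φφ+2κ 0) (⊕-cong (≈-refl {B}) (⊕-cong κ₂≈ κ₂≈))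

  θ₂≈w : gen (θ 2) ≈ w ⊕ ((P ⊕ P) ⊕ (P ⊕ P))
  θ₂≈w = ≈-trans (θ≈φφ+2κ 1) (⊕-cong (≈-refl {w}) (⊕-cong κ₄≈ κ₄≈))

  open D.Halvings (gen (θ 1)) (gen (θ 2)) (gen (θ 4)) (gen (θ 8)) (gen (ω 2)) w B Y N P
    θ₁≈ θ₂≈ θ₄≈ θ₁≈B θ₂≈w (φφ≈θ+ω 1) renaming (ω≈ to ω₂≈)

  Z : Series
  Z = 2# ⊗ Y ⊗ (w ⊕ negS (2# ⊗ N))

  N²≈ : N ⊗ N ≈ P ⊗ w
  N²≈ = begin
    N ⊗ N
      ≈⟨ solve 3 (λ q c d → (q :* (c :* d)) :* (q :* (c :* d)) := (q :* q) :* ((c :* c) :* (d :* d))) ≈-refl (qpow 2) p₂ p₁₄ ⟩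
    (qpow 2 ⊗ qpow 2) ⊗ ((p₂ ⊗ p₂) ⊗ (p₁₄ ⊗ p₁₄))
      ≈⟨ ⊗-cong (≈-sym (qpow-+ 2 2)) (⊗-cong (ψ²≈φψ 1) (ψ²≈φψ 13)) ⟩
    qpow 4 ⊗ ((f₂ ⊗ p₄) ⊗ (f₁₄ ⊗ p₂₈))
      ≈⟨ solve 5 (λ q f p F P → q :* ((f :* p) :* (F :* P)) := (q :* (p :* P)) :* (f :* F)) ≈-refl (qpow 4) f₂ p₄ f₁₄ p₂₈ ⟩
    P ⊗ w ∎

  Y²≈ : Y ⊗ Y ≈ N ⊗ B
  Y²≈ = begin
    Y ⊗ Y
      ≈⟨ solve 3 (λ q c d → (q :* (c :* d)) :* (q :* (c :* d)) := (q :* q) :* ((c :* c) :* (d :* d))) ≈-refl (qpow 1) p₁ p₇ ⟩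
    (qpow 1 ⊗ qpow 1) ⊗ ((p₁ ⊗ p₁) ⊗ (p₇ ⊗ p₇))
      ≈⟨ ⊗-cong (≈-sym (qpow-+ 1 1)) (⊗-cong (ψ²≈φψ 0) (ψ²≈φψ 6)) ⟩
    qpow 2 ⊗ ((f₁ ⊗ p₂) ⊗ (f₇ ⊗ p₁₄))
      ≈⟨ solve 5 (λ q f p F P → q :* ((f :* p) :* (F :* P)) := (q :* (p :* P)) :* (f :* F)) ≈-refl (qpow 2) f₁ p₂ f₇ p₁₄ ⟩
    N ⊗ B ∎

  ab≈ : a ⊗ b ≈ w ⊗ B
  ab≈ = solve 4 (λ f F g G → (f :* F) :* (g :* G) := (g :* F) :* (f :* G)) ≈-refl f₁ f₁₄ f₂ f₇

  -- Every piece of the dissection is a polynomial in `w`, `P`, `N`, `Y`. In particular q times the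
  -- odd part of ψ(q)ψ(Q) is N, so q times its even part is Y - N; the linear relation for B then
  -- produces ab = wB.
  T²≈ : t₃ ⊗ t₃ ≈ a ⊗ b ⊕ negS Z
  T²≈ = begin
    t₃ ⊗ t₃
      ≈⟨ T²-dissection ⟩
    ((gen (θ 8) ⊗ gen (θ 8) ⊕ gen (ω 2) ⊗ gen (κ 4)) ⊕ (gen (κ 4) ⊗ gen (κ 4) ⊕ gen (κ 4) ⊗ gen (ω 2))) ⊕
    ((qpow 2 ⊗ (F₀ ⊗ F₁) ⊕ qpow 2 ⊗ (F₁ ⊗ F₀)) ⊕ (qpow 2 ⊗ (F₀ ⊗ F₁) ⊕ qpow 2 ⊗ (F₁ ⊗ F₀)))
      ≈⟨ ⊕-cong (⊕-cong (⊕-cong (⊗-cong θ₈≈ θ₈≈) (⊗-cong ω₂≈ κ₄≈)) (⊕-cong (⊗-cong κ₄≈ κ₄≈) (⊗-cong κ₄≈ ω₂≈)))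
                (⊕-cong (⊕-cong F≈ F≈′) (⊕-cong F≈ F≈′)) ⟩
    ((e ⊗ e ⊕ o ⊗ (P ⊕ P)) ⊕ ((P ⊕ P) ⊗ (P ⊕ P) ⊕ (P ⊕ P) ⊗ o)) ⊕
    (((Y ⊕ negS N) ⊗ N ⊕ (Y ⊕ negS N) ⊗ N) ⊕ ((Y ⊕ negS N) ⊗ N ⊕ (Y ⊕ negS N) ⊗ N))
      ≈⟨ solve 4 (λ w P N Y → let e = w :+ (P :+ P) :- (N :+ N) ; o = (N :+ N) :- (P :+ P) ; g = (Y :- N) :* N in
           ((e :* e :+ o :* (P :+ P)) :+ ((P :+ P) :* (P :+ P) :+ (P :+ P) :* o)) :+ ((g :+ g) :+ (g :+ g))
           := w :* (w :+ con (+ 4) :* P :+ con (+ 2) :* Y :- con (+ 4) :* N) :- con (+ 2) :* Y :* (w :- con (+ 2) :* N)) ≈-refl w P N Y ⟩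
    w ⊗ (w ⊕ 4# ⊗ P ⊕ 2# ⊗ Y ⊕ negS (4# ⊗ N)) ⊕ negS Z
      ≈⟨ ⊕-cong (≈-trans ab≈ (⊗-congˡ {w} B≈)) (≈-refl {negS Z}) ⟨
    a ⊗ b ⊕ negS Z ∎
    where
    F₀ = gen (ψψᵉ 1)
    F₁ = gen (ψψᵒ 1)
    e = w ⊕ (P ⊕ P) ⊕ negS (N ⊕ N)
    o = (N ⊕ N) ⊕ negS (P ⊕ P)
    qF₁≈ : qpow 1 ⊗ F₁ ≈ N
    qF₁≈ = ≈-trans (⊗-congˡ {qpow 1} ψψᵒ₁≈qψψ) (≈-trans (≈-sym (⊗-assoc (qpow 1) (qpow 1) (p₂ ⊗ p₁₄)))
             (⊗-congʳ {g = p₂ ⊗ p₁₄} (≈-sym (qpow-+ 1 1))))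
    qF₀≈ : qpow 1 ⊗ F₀ ≈ Y ⊕ negS N
    qF₀≈ = ≈-trans (solve 3 (λ q F₀ F₁ → q :* F₀ := q :* (F₀ :+ F₁) :- q :* F₁) ≈-refl (qpow 1) F₀ F₁)
             (⊕-cong (⊗-congˡ {qpow 1} (≈-sym (ψψ≈ψψᵉ+ψψᵒ 1))) (negS-cong qF₁≈))
    F≈ : qpow 2 ⊗ (F₀ ⊗ F₁) ≈ (Y ⊕ negS N) ⊗ N
    F≈ = ≈-trans (⊗-congʳ {g = F₀ ⊗ F₁} (qpow-+ 1 1))
      (≈-trans (solve 3 (λ q F₀ F₁ → (q :* q) :* (F₀ :* F₁) := (q :* F₀) :* (q :* F₁)) ≈-refl (qpow 1) F₀ F₁) (⊗-cong qF₀≈ qF₁≈))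
    F≈′ : qpow 2 ⊗ (F₁ ⊗ F₀) ≈ (Y ⊕ negS N) ⊗ N
    F≈′ = ≈-trans (⊗-congˡ {qpow 2} (⊗-comm F₁ F₀)) F≈

  x X u U : Series
  x = f₂ ⊗ f₂
  X = f₁₄ ⊗ f₁₄
  u = 4# ⊗ (qpow 1 ⊗ (p₄ ⊗ p₄))
  U = 4# ⊗ (qpow 7 ⊗ (p₂₈ ⊗ p₂₈))

  four : ∀ f → (f ⊕ f) ⊕ (f ⊕ f) ≈ 4# ⊗ f
  four = solve 1 (λ f → (f :+ f) :+ (f :+ f) := con (+ 4) :* f) ≈-refl

  f₁²≈ : f₁ ⊗ f₁ ≈ x ⊕ u
  f₁²≈ = ≈-trans (φ²-dissection 0) (⊕-cong (≈-refl {x}) (four (qpow 1 ⊗ (p₄ ⊗ p₄))))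

  f₇²≈ : f₇ ⊗ f₇ ≈ X ⊕ U
  f₇²≈ = ≈-trans (φ²-dissection 6) (⊕-cong (≈-refl {X}) (four (qpow 7 ⊗ (p₂₈ ⊗ p₂₈))))

  interchange : ∀ f g h k → (f ⊗ g) ⊗ (h ⊗ k) ≈ (f ⊗ h) ⊗ (g ⊗ k)
  interchange = solve 4 (λ f g h k → (f :* g) :* (h :* k) := (f :* h) :* (g :* k)) ≈-refl

  uU≈ : u ⊗ U ≈ SR.num (+ 16) ⊗ (P ⊗ P)
  uU≈ = begin
    u ⊗ U
      ≈⟨ solve 4 (λ q Q c d → (con (+ 4) :* (q :* (c :* c))) :* (con (+ 4) :* (Q :* (d :* d)))
           := con (+ 16) :* ((q :* Q) :* ((c :* d) :* (c :* d)))) ≈-refl (qpow 1) (qpow 7) p₄ p₂₈ ⟩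
    16# ⊗ ((qpow 1 ⊗ qpow 7) ⊗ ((p₄ ⊗ p₂₈) ⊗ (p₄ ⊗ p₂₈)))
      ≈⟨ ⊗-congˡ {16#} (⊗-congʳ {g = (p₄ ⊗ p₂₈) ⊗ (p₄ ⊗ p₂₈)} (≈-trans (≈-sym (qpow-+ 1 7)) (qpow-+ 4 4))) ⟩
    16# ⊗ ((qpow 4 ⊗ qpow 4) ⊗ ((p₄ ⊗ p₂₈) ⊗ (p₄ ⊗ p₂₈)))
      ≈⟨ ⊗-congˡ {16#} (interchange (qpow 4) (qpow 4) (p₄ ⊗ p₂₈) (p₄ ⊗ p₂₈)) ⟩
    16# ⊗ (P ⊗ P) ∎
    where 16# = SR.num (+ 16)

  w₀≢0 : w 0 ≢ 0ℚ
  w₀≢0 ()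

  open D.Homogeneous w (inv w) N Y P B (⊗-inv w w₀≢0) N²≈ Y²≈ B≈ using (module Forms)
  open Forms x X u U a b t₃
    (interchange f₂ f₂ f₁₄ f₁₄)
    uU≈
    (≈-trans (⊗-cong (≈-sym f₁²≈) (≈-sym f₇²≈)) (interchange f₁ f₁ f₇ f₇))
    (≈-trans (interchange f₁ f₁₄ f₁ f₁₄) (⊗-congʳ {g = X} f₁²≈))
    (≈-trans (interchange f₂ f₇ f₂ f₇) (⊗-congˡ {x} f₇²≈))
    ab≈ T²≈
    using (squares; cubes; ratio²; Wᵃ; Wᵇ)

  TZ≈ : t₃ ⊗ Z ≈ (a ⊗ b) ⊗ (a ⊕ negS b)
  -- Both series begin with 2q, since Z = 2q + ..., a - b = 2q + ... and T, a, b have constant term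
  -- 1; their sum has coefficient 4 at q.
  TZ≈ = square-injective (t₃ ⊗ Z) ((a ⊗ b) ⊗ (a ⊕ negS b)) 1 (λ ()) squares

  -- φ(-q²)⁴ = φ(q)²φ(-q)², and the two squares are g + v and g - v.
  φ⁻⁴≈ : ∀ s → let f = φ⁻ (2 ℕ.* suc s)
                   g = gen (φ (2 ℕ.* suc s)) ⊗ gen (φ (2 ℕ.* suc s))
                   v = 4# ⊗ (qpow (suc s) ⊗ (gen (ψ (4 ℕ.* suc s)) ⊗ gen (ψ (4 ℕ.* suc s)))) in
    (f ⊗ f) ⊗ (f ⊗ f) ≈ g ⊗ g ⊕ negS (v ⊗ v)
  φ⁻⁴≈ s = begin
    (f ⊗ f) ⊗ (f ⊗ f)         ≈⟨ ⊗-cong (φφ⁻≈φ⁻² s) (φφ⁻≈φ⁻² s) ⟨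
    (k ⊗ l) ⊗ (k ⊗ l)         ≈⟨ interchange k l k l ⟩
    (k ⊗ k) ⊗ (l ⊗ l)         ≈⟨ ⊗-cong (≈-trans (φ²-dissection s) (⊕-cong (≈-refl {g}) (four (qpow (suc s) ⊗ (gen (ψ (4 ℕ.* suc s)) ⊗ gen (ψ (4 ℕ.* suc s))))))) (φ⁻²≈ s) ⟩
    (g ⊕ v) ⊗ (g ⊕ negS v)    ≈⟨ solve 2 (λ g v → (g :+ v) :* (g :- v) := g :* g :- v :* v) ≈-refl g v ⟩
    g ⊗ g ⊕ negS (v ⊗ v)      ∎
    where
    f = φ⁻ (2 ℕ.* suc s)
    k = gen (φ (suc s))
    l = φ⁻ (suc s)
    g = gen (φ (2 ℕ.* suc s)) ⊗ gen (φ (2 ℕ.* suc s))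
    v = 4# ⊗ (qpow (suc s) ⊗ (gen (ψ (4 ℕ.* suc s)) ⊗ gen (ψ (4 ℕ.* suc s))))

  ψ⁴≈ : ∀ s → let f = gen (φ (suc s)) ; g = gen (ψ (suc s)) ; k = gen (ψ (2 ℕ.* suc s)) in
    ∀ q → (f ⊗ f) ⊗ (4# ⊗ (q ⊗ (k ⊗ k))) ≈ (4# ⊗ q) ⊗ ((g ⊗ g) ⊗ (g ⊗ g))
  ψ⁴≈ s q = ≈-trans
    (solve 3 (λ f k q → (f :* f) :* (con (+ 4) :* (q :* (k :* k))) := (con (+ 4) :* q) :* ((f :* k) :* (f :* k)))
       ≈-refl (gen (φ (suc s))) (gen (ψ (2 ℕ.* suc s))) q)
    (⊗-congˡ {4# ⊗ q} (⊗-cong (≈-sym (ψ²≈φψ s)) (≈-sym (ψ²≈φψ s))))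

  g₂ g₁₄ : Series
  g₂  = φ⁻ 2
  g₁₄ = φ⁻ 14

  theta-cubes : (Wᵃ ⊗ (Wᵃ ⊗ Wᵃ)) ⊗ (((p₂ ⊗ p₂) ⊗ (p₂ ⊗ p₂)) ⊗ ((g₁₄ ⊗ g₁₄) ⊗ (g₁₄ ⊗ g₁₄)))
    ≈ (qpow 2 ⊗ (qpow 2 ⊗ qpow 2)) ⊗ ((Wᵇ ⊗ (Wᵇ ⊗ Wᵇ)) ⊗ (((p₁₄ ⊗ p₁₄) ⊗ (p₁₄ ⊗ p₁₄)) ⊗ ((g₂ ⊗ g₂) ⊗ (g₂ ⊗ g₂))))
  -- xu = 4qψ(q²)⁴ and XU = 4q⁷ψ(Q²)⁴ share the factor 4q; what remains of q⁷ is q⁶, the cube of q².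
  theta-cubes = ⊗-cancelˡ (4# ⊗ qpow 1) _ _ 1 (λ ()) (begin
    (4# ⊗ qpow 1) ⊗ (Wᵃ³ ⊗ (p₂⁴ ⊗ g₁₄⁴))
      ≈⟨ solve 4 (λ c W p g → c :* (W :* (p :* g)) := W :* ((c :* p) :* g)) ≈-refl (4# ⊗ qpow 1) Wᵃ³ p₂⁴ g₁₄⁴ ⟩
    Wᵃ³ ⊗ (((4# ⊗ qpow 1) ⊗ p₂⁴) ⊗ g₁₄⁴)
      ≈⟨ ⊗-congˡ {Wᵃ³} (⊗-cong (≈-sym (ψ⁴≈ 1 (qpow 1))) (φ⁻⁴≈ 6)) ⟩
    Wᵃ³ ⊗ ((x ⊗ u) ⊗ (X ⊗ X ⊕ negS (U ⊗ U)))
      ≈⟨ cubes ⟩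
    Wᵇ³ ⊗ ((X ⊗ U) ⊗ (x ⊗ x ⊕ negS (u ⊗ u)))
      ≈⟨ ⊗-congˡ {Wᵇ³} (⊗-cong (≈-trans (ψ⁴≈ 13 (qpow 7)) (⊗-congʳ {g = p₁₄⁴} (⊗-congˡ {4#} q⁷≈))) (≈-sym (φ⁻⁴≈ 0))) ⟩
    Wᵇ³ ⊗ (((4# ⊗ (qpow 1 ⊗ q⁶)) ⊗ p₁₄⁴) ⊗ g₂⁴)
      ≈⟨ solve 6 (λ c q r W p g → W :* (((c :* (q :* r)) :* p) :* g) := (c :* q) :* (r :* (W :* (p :* g))))
           ≈-refl 4# (qpow 1) q⁶ Wᵇ³ p₁₄⁴ g₂⁴ ⟩
    (4# ⊗ qpow 1) ⊗ (q⁶ ⊗ (Wᵇ³ ⊗ (p₁₄⁴ ⊗ g₂⁴))) ∎)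
    where
    Wᵃ³ = Wᵃ ⊗ (Wᵃ ⊗ Wᵃ)
    Wᵇ³ = Wᵇ ⊗ (Wᵇ ⊗ Wᵇ)
    p₂⁴ = (p₂ ⊗ p₂) ⊗ (p₂ ⊗ p₂)
    p₁₄⁴ = (p₁₄ ⊗ p₁₄) ⊗ (p₁₄ ⊗ p₁₄)
    g₂⁴ = (g₂ ⊗ g₂) ⊗ (g₂ ⊗ g₂)
    g₁₄⁴ = (g₁₄ ⊗ g₁₄) ⊗ (g₁₄ ⊗ g₁₄)
    q⁶ = qpow 2 ⊗ (qpow 2 ⊗ qpow 2)
    q⁷≈ : qpow 7 ≈ qpow 1 ⊗ q⁶
    q⁷≈ = ≈-trans (qpow-+ 1 6) (⊗-congˡ {qpow 1} (≈-trans (qpow-+ 2 4) (⊗-congˡ {qpow 2} (qpow-+ 2 2))))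

  open D.EtaQuotients (E 2) (E 4) (E 14) (E 28) g₂ p₂ g₁₄ p₁₄ (qpow 2) Wᵃ Wᵇ
    (φ⁻-product 1) (ψ-product 1) (φ⁻-product 13) (ψ-product 13) theta-cubes
    using (quotient³)

  𝒰 𝒱 : Series
  𝒰 = E² 28 ⊗ E² 2
  𝒱 = E² 14 ⊗ E² 4

  Wᵃ𝒱²≈ : Wᵃ ⊗ (𝒱 ⊗ 𝒱) ≈ qpow 2 ⊗ ((𝒰 ⊗ 𝒰) ⊗ Wᵇ)
  Wᵃ𝒱²≈ = cube-injective _ _ (⊗-cancelˡ (((p₂ ⊗ p₂) ⊗ (p₂ ⊗ p₂)) ⊗ ((g₁₄ ⊗ g₁₄) ⊗ (g₁₄ ⊗ g₁₄))) _ _ 0 (λ ()) quotient³)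

  numerator denominator : Series
  numerator   = a ⊕ negS t₃
  denominator = b ⊕ t₃

  cross-multiplied² : (numerator ⊗ 𝒱) ⊗ (numerator ⊗ 𝒱) ≈ (qpow 1 ⊗ (denominator ⊗ 𝒰)) ⊗ (qpow 1 ⊗ (denominator ⊗ 𝒰))
  -- `Wᵇ` has constant term 0 and begins with 4q, so it is not invertible; index 1 witnesses that it
  -- is nonzero.
  cross-multiplied² = ⊗-cancelˡ Wᵇ _ _ 1 (λ ()) (begin
    Wᵇ ⊗ ((numerator ⊗ 𝒱) ⊗ (numerator ⊗ 𝒱))
      ≈⟨ solve 3 (λ W n v → W :* ((n :* v) :* (n :* v)) := ((n :* n) :* W) :* (v :* v)) ≈-refl Wᵇ numerator 𝒱 ⟩
    ((numerator ⊗ numerator) ⊗ Wᵇ) ⊗ (𝒱 ⊗ 𝒱)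
      ≈⟨ ⊗-congʳ {g = 𝒱 ⊗ 𝒱} (ratio² TZ≈) ⟩
    ((denominator ⊗ denominator) ⊗ Wᵃ) ⊗ (𝒱 ⊗ 𝒱)
      ≈⟨ ⊗-assoc (denominator ⊗ denominator) Wᵃ (𝒱 ⊗ 𝒱) ⟩
    (denominator ⊗ denominator) ⊗ (Wᵃ ⊗ (𝒱 ⊗ 𝒱))
      ≈⟨ ⊗-congˡ {denominator ⊗ denominator} (≈-trans Wᵃ𝒱²≈ (⊗-congʳ {g = (𝒰 ⊗ 𝒰) ⊗ Wᵇ} (qpow-+ 1 1))) ⟩
    (denominator ⊗ denominator) ⊗ ((qpow 1 ⊗ qpow 1) ⊗ ((𝒰 ⊗ 𝒰) ⊗ Wᵇ))
      ≈⟨ solve 4 (λ W d q u → (d :* d) :* ((q :* q) :* ((u :* u) :* W)) := W :* ((q :* (d :* u)) :* (q :* (d :* u)))) ≈-refl Wᵇ denominator (qpow 1) 𝒰 ⟩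
    Wᵇ ⊗ ((qpow 1 ⊗ (denominator ⊗ 𝒰)) ⊗ (qpow 1 ⊗ (denominator ⊗ 𝒰))) ∎)

  cross-multiplied : numerator ⊗ 𝒱 ≈ qpow 1 ⊗ (denominator ⊗ 𝒰)
  -- Both sides begin with 2q, as a - T = 2q + ... and b + T = 2 + ..., so the sign is positive.
  cross-multiplied = square-injective _ _ 1 (λ ()) cross-multiplied²

theorem4p4 : (theta 1 (+ 0) 14 ⊖ theta 3 (+ 2) 5) ⊘ (theta 2 (+ 0) 7 ⊕ theta 3 (+ 2) 5)
    ≈ qtimes ((E² 28 ⊗ E² 2) ⊘ (E² 14 ⊗ E² 4))
-- The divisors have constant terms 2 and 1, which keeps `inv` away from its default value 0.
theorem4p4 = ⊘-≈-qtimes-⊘ {theta 1 (+ 0) 14 ⊖ theta 3 (+ 2) 5} {theta 2 (+ 0) 7 ⊕ theta 3 (+ 2) 5} {𝒰} {𝒱} (λ ()) (λ ()) (begin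
  (theta 1 (+ 0) 14 ⊖ theta 3 (+ 2) 5) ⊗ 𝒱
    ≈⟨ ⊗-congʳ {g = 𝒱} (⊕-cong (theta≈φφ 0 13) (≈-refl {negS t₃})) ⟩
  numerator ⊗ 𝒱
    ≈⟨ cross-multiplied ⟩
  qpow 1 ⊗ (denominator ⊗ 𝒰)
    ≈⟨ ⊗-congˡ {qpow 1} (⊗-congʳ {g = 𝒰} (⊕-cong (theta≈φφ 1 6) (≈-refl {t₃}))) ⟨
  qpow 1 ⊗ ((theta 2 (+ 0) 7 ⊕ theta 3 (+ 2) 5) ⊗ 𝒰) ∎)
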